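{- Let $k\ge 3$ and $\epsilon\in(0,1)$ be constants. There exists a (constructive) randomized algorithm that makes one pass over an insertion-only stream $D$ of elements of $\{1,\dots,n\}$, uses $O(n^{1-2/k}\log n)$ bits of memory, and outputs a pair $(i,\tilde f_i)$ such that: 1. $\tilde f_i\le f_i$ with probability $1$; and 2. if $D$ has a heavy element $i$, i.e. an element $i$ with $f_i^k>100\sum_{j\ne i}f_j^k$, then with constant (positive, independent of $n$ and $D$) probability the algorithm outputs $(i,\tilde f_i)$ for this $i$ with $(1-\epsilon)f_i\le\tilde f_i$.
   Context: A stream $D=\{p_1,\dots,p_m\}$ is a sequence of $m$ numbers from $\{1,\dots,n\}$, read sequentially. The frequency of $i$ is $f_i=|\{j:p_j=i\}|$. Standing assumptions: $n$ and $m$ are polynomially related (so $\log m=\Theta(\log n)$); the approximation error $\epsilon$ and the parameter $k\ge 3$ are constants, so the constants hidden in $O(\cdot)$ may depend on $k$, $\epsilon$ and the polynomial relation between $n$ and $m$. -}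

module Defs where

open import Data.Bool.Base using (Bool; true; false)
open import Data.Fin.Base using (Fin)
import Data.Fin.Properties as Fin
open import Data.Integer.Base using (+_)
open import Data.List.Base as List using (List; []; _∷_; allFin; cartesianProductWith; filter; length)
open import Data.Nat.Base using (ℕ; zero; suc; _+_; _*_; _∸_; _^_; _≤_; _<_)
open import Data.Nat.ListAction using (sum)
open import Data.Nat.Logarithm using (⌊log₂_⌋)
open import Data.Nat.Properties using (m^n≢0)
open import Data.Product.Base using (_×_; _,_; proj₁; proj₂)
open import Data.Rational as ℚ using (ℚ; 1ℚ)
import Data.Rational.Properties as ℚ
open import Data.Vec.Base as Vec using (Vec; []; _∷_)
open import Level using (0ℓ)
open import Relation.Binary.PropositionalEquality using (_≡_)
open import Relation.Nullary.Decidable using (_×-dec_; ¬?)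
open import Relation.Unary using (Pred; Decidable)

private
  variable
    n m : ℕ

-- The elements 1, …, n of the universe are represented by Fin n.
Stream : ℕ → ℕ → Set
Stream n m = Vec (Fin n) m

freq : Stream n m → Fin n → ℕ
freq D i = Vec.count (λ p → p Fin.≟ i) D

freqℚ : Stream n m → Fin n → ℚ
freqℚ D i = + freq D i ℚ./ 1

-- Σ_{j ≠ i} f_j ^ k
restMoment : ℕ → Stream n m → Fin n → ℕ
restMoment {n} k D i =
  sum (List.map (λ j → freq D j ^ k) (filter (λ j → ¬? (j Fin.≟ i)) (allFin n)))

Heavy : ℕ → Stream n m → Fin n → Set
Heavy k D i = 100 * restMoment k D i < freq D i ^ k

PolynomiallyRelated : ℕ → ℕ → ℕ → Set
PolynomiallyRelated c n m = m ≤ c * n ^ c × n ≤ c * m ^ c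

Output : ℕ → Set
Output n = Fin n × ℚ

-- A one-pass algorithm over the universe Fin n.  Between two stream elements it
-- retains exactly `memory` bits; it sees neither the stream length nor the
-- position unless it stores them.  Each step receives `coins` fresh fair coin
-- flips, which are lost unless they are written into the memory.
record StreamingAlgorithm (n : ℕ) : Set where
  field
    memory : ℕ
    coins  : ℕ

  State : Set
  State = Vec Bool memory

  Coins : Set
  Coins = Vec Bool coins

  field
    init   : Coins → State
    update : Coins → Fin n → State → State
    output : Coins → State → Output n

  process : Vec Coins m → Stream n m → State → State
  process []       []      s = s
  process (c ∷ cs) (p ∷ D) s = process cs D (update c p s)

  -- The first two blocks of coins go to initialisation and output, the others
  -- to the successive updates.
  run : Stream n m → Vec Coins (2 + m) → Output n
  run D (c₀ ∷ c₁ ∷ cs) = output c₁ (process cs D (init c₀))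

-- All vectors of length l with entries from the given list; duplicate-free if
-- that list is.
vectors : {A : Set} → List A → (l : ℕ) → List (Vec A l)
vectors xs zero    = [] ∷ []
vectors xs (suc l) = cartesianProductWith _∷_ xs (vectors xs l)

tapes : (r l : ℕ) → List (Vec (Vec Bool r) l)
tapes r l = vectors (vectors (true ∷ false ∷ []) r) l

-- The probability, over uniform independent coins, that the output of A on D
-- satisfies P: favourable tapes divided by all (2 ^ coins) ^ (2 + m) tapes.
PrOutput : (A : StreamingAlgorithm n) → Stream n m →
           {P : Pred (Output n) 0ℓ} → Decidable P → ℚ
PrOutput {m = m} A D P? =
  ℚ._/_ (+ length (filter (λ ω → P? (run D ω)) (tapes coins (2 + m))))
        ((2 ^ coins) ^ (2 + m))
        {{m^n≢0 (2 ^ coins) (2 + m) {{m^n≢0 2 coins}}}}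
  where open StreamingAlgorithm A

NoOverestimate : Stream n m → Pred (Output n) 0ℓ
NoOverestimate D (j , f̃) = f̃ ℚ.≤ freqℚ D j

noOverestimate? : (D : Stream n m) → Decidable (NoOverestimate D)
noOverestimate? D (j , f̃) = f̃ ℚ.≤? freqℚ D j

Finds : ℚ → Stream n m → Fin n → Pred (Output n) 0ℓ
Finds ε D i (j , f̃) = j ≡ i × (1ℚ ℚ.- ε) ℚ.* freqℚ D i ℚ.≤ f̃

finds? : (ε : ℚ) (D : Stream n m) (i : Fin n) → Decidable (Finds ε D i)
finds? ε D i (j , f̃) = (j Fin.≟ i) ×-dec ((1ℚ ℚ.- ε) ℚ.* freqℚ D i ℚ.≤? f̃)

-- s ≤ C · n^(1 - 2/k) · log₂ n, with both sides raised to the k-th power to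
-- avoid the root.  Rounding the logarithm down costs at most a factor 2 for
-- n ≥ 2, and makes the bound only stricter.
SpaceBound : (k C n s : ℕ) → Set
SpaceBound k C n s = s ^ k ≤ (C * ⌊log₂ n ⌋) ^ k * n ^ (k ∸ 2)

{-# OPTIONS --safe #-}

-- A variant of pick-and-drop sampling. A slot cuts a stretch of the stream into
-- rows, picks a uniformly random position in each row, counts the picked element
-- (the challenger) to the end of the row, and then keeps it in place of its
-- champion if its count exceeds the champion's count less a penalty per row of
-- age. Given the picks of the other elements, an occurrence of the heavy element i
-- is good if picking it makes i the final champion. Occurrences that come too late
-- in their row to beat the current champion, or after which i falls behind, are
-- bounded by a potential in terms of the squared frequencies of the picked
-- elements, whose expectation is a cubic moment of the frequencies; this is where
-- k ≥ 3 enters. So most occurrences are good, and a slot finds i with probability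
-- about f / (length of a row).
--
-- Neither the stream length nor f is known. Time is cut into phases of geometric
-- lengths Q ^ e, a slot picks in one phase and then only counts for l phases, and
-- there are slots for every ratio Q ^ ρ of stream length to frequency and every l.
-- Of the first ε f occurrences of i, a share of 2 ^ -(l + 2) falls into the phase
-- that is l phases before the last one, for some l; this share decays so slowly
-- that the numbers of slots needed form a geometric series, with sum O(n ^ (1 -
-- 2/k)). All slots use independent coins, and the largest count is output; counts
-- never exceed frequencies.

module Submission where

open import Defs
open import Data.Bool.Base using (Bool; true; false; if_then_else_; _∧_; _∨_; not; T)
open import Data.Empty using (⊥-elim)
open import Data.Fin.Base as Fin using (Fin; toℕ; fromℕ<)
import Data.Fin.Properties as Fin
import Data.Integer.Base as ℤ
import Data.Integer.Properties as ℤ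
open import Data.List.Base as List using (List; []; _∷_; _++_; length; filter; map; concat; take; drop; replicate; upTo; allFin)
import Data.List.Properties as List
open import Data.List.Properties using (map-tabulate; drop-all; take-all; take-[]; length-tabulate; length-upTo; map-cong; length-++; length-take; length-drop; take++drop≡id; length-replicate)
open import Data.List.Membership.Propositional using (_∈_)
open import Data.List.Membership.Propositional.Properties using (∈-filter⁺; ∈-allFin; ∈-upTo⁺; ∈-concat⁺′; ∈-map⁺)
open import Data.List.Relation.Unary.All as All using (All; []; _∷_)
open import Data.List.Relation.Unary.Any using (here; there)
open import Data.Nat.Base
open import Data.Nat.DivMod using (_%_; _/_; m≡m%n+[m/n]*n; m%n<n; [m+kn]%n≡m%n; m<n⇒m%n≡m; m/n*n≤m)
open import Data.Nat.ListAction using (sum)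
open import Data.Nat.Logarithm using (⌊log₂_⌋; ⌊log₂⌋-mono-≤; ⌊log₂[2^n]⌋≡n; ⌊log₂⌊n/2⌋⌋≡⌊log₂n⌋∸1)
open import Data.Nat.Induction using (<-rec)
open import Data.Nat.Properties
open import Data.Nat.Tactic.RingSolver using (solve-∀)
open import Data.Product.Base using (Σ-syntax; _×_; _,_; proj₁; proj₂)
open import Data.Rational as ℚ using (ℚ; 0ℚ; 1ℚ)
import Data.Rational.Properties as ℚ
open import Data.Rational.Unnormalised.Base as ℚᵘ using (mkℚᵘ)
import Data.Rational.Unnormalised.Properties as ℚᵘ
open import Data.Sum.Base using (_⊎_; inj₁; inj₂)
open import Data.Unit.Base using (⊤; tt)
open import Data.Vec.Base as Vec using (Vec; []; _∷_)
import Data.Vec.Properties as Vec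
import Data.Vec.Relation.Unary.All as VAll
open import Function.Base using (_∘_; id)
open import Level using (0ℓ)
open import Relation.Binary.PropositionalEquality
open import Relation.Nullary using (¬_; yes; no; does; contradiction)
open import Relation.Nullary.Decidable using (¬?)
open import Relation.Unary using (Pred; Decidable)

-- Where the exponents come from. Let a slot with P rows watch τ elements and aim at H occurrences
-- of i. The potential keeps most of them good once P ^ 2 times the squared counts of the other
-- elements, summed over the τ positions, is at most a constant times H ^ 2 * τ. By interpolation
-- this follows from the same condition with exponent k - 1, where the sum over positions is at most
-- the k-th moment, hence at most f ^ k. With H close to f this permits about (τ / f) ^ (1 / (k -
-- 1)) rows. One slot then succeeds with probability about H * P / τ, so (τ / f) ^ ((k - 2) / (k -
-- 1)) copies suffice, and since τ / f is O(n ^ ((k - 1) / k)) by the power mean inequality, these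
-- are O(n ^ (1 - 2/k)). For Q = 8 ^ (k - 1) and τ / f = Q ^ ρ the numbers of rows and copies are 8
-- ^ ρ and 8 ^ ((k - 2) * ρ), powers of two up to constants. The base 8 leaves room for a loss of 4
-- ^ l per l and for the l + 1 residues. Probabilities are counts of coin sequences with all
-- denominators multiplied out, so that nearly everything is an inequality in ℕ.

private
  variable
    n : ℕ

-- Finite sums and uniform bits

∑ : {A : Set} → List A → (A → ℕ) → ℕ
∑ xs f = sum (map f xs)

⟦_⟧ : Bool → ℕ
⟦ true ⟧  = 1
⟦ false ⟧ = 0

∑< : ℕ → (ℕ → ℕ) → ℕ
∑< zero    f = 0
∑< (suc n) f = f 0 + ∑< n (f ∘ suc)

interchange : ∀ a b c d → (a + b) + (c + d) ≡ (a + c) + (b + d)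
interchange = solve-∀

∑-map : {A B : Set} (g : B → A) (xs : List B) (f : A → ℕ) → ∑ (map g xs) f ≡ ∑ xs (f ∘ g)
∑-map g []       f = refl
∑-map g (x ∷ xs) f = cong (f (g x) +_) (∑-map g xs f)

module _ {A : Set} where

  ∑-cong : ∀ (xs : List A) {f g : A → ℕ} → (∀ x → f x ≡ g x) → ∑ xs f ≡ ∑ xs g
  ∑-cong xs eq = cong sum (map-cong eq xs)

  ∑-mono : ∀ (xs : List A) {f g : A → ℕ} → (∀ x → f x ≤ g x) → ∑ xs f ≤ ∑ xs g
  ∑-mono []       le = z≤n
  ∑-mono (x ∷ xs) le = +-mono-≤ (le x) (∑-mono xs le)

  ∑-+ : ∀ (xs : List A) (f g : A → ℕ) → ∑ xs (λ x → f x + g x) ≡ ∑ xs f + ∑ xs g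
  ∑-+ []       f g = refl
  ∑-+ (x ∷ xs) f g rewrite ∑-+ xs f g = interchange (f x) (g x) (∑ xs f) (∑ xs g)

  ∑-*ˡ : ∀ c (xs : List A) (f : A → ℕ) → ∑ xs (λ x → c * f x) ≡ c * ∑ xs f
  ∑-*ˡ c []       f = sym (*-zeroʳ c)
  ∑-*ˡ c (x ∷ xs) f rewrite ∑-*ˡ c xs f = sym (*-distribˡ-+ c (f x) (∑ xs f))

  ∑-*ʳ : ∀ (xs : List A) (f : A → ℕ) c → ∑ xs (λ x → f x * c) ≡ ∑ xs f * c
  ∑-*ʳ []       f c = refl
  ∑-*ʳ (x ∷ xs) f c rewrite ∑-*ʳ xs f c = sym (*-distribʳ-+ c (f x) (∑ xs f))

  ∑-const : ∀ (xs : List A) c → ∑ xs (λ _ → c) ≡ length xs * c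
  ∑-const []       c = refl
  ∑-const (x ∷ xs) c = cong (c +_) (∑-const xs c)

  ∑-++ : ∀ (xs ys : List A) (f : A → ℕ) → ∑ (xs ++ ys) f ≡ ∑ xs f + ∑ ys f
  ∑-++ []       ys f = refl
  ∑-++ (x ∷ xs) ys f rewrite ∑-++ xs ys f = sym (+-assoc (f x) _ _)

  ∑-∈ : ∀ {xs : List A} {x} (f : A → ℕ) → x ∈ xs → f x ≤ ∑ xs f
  ∑-∈ f (here refl) = m≤m+n _ _
  ∑-∈ {xs = y ∷ _} f (there x∈xs) = ≤-trans (∑-∈ f x∈xs) (m≤n+m _ (f y))

  length-filter : ∀ {P : Pred A 0ℓ} (P? : Decidable P) (xs : List A) →
                  length (filter P? xs) ≡ ∑ xs (λ x → ⟦ does (P? x) ⟧)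
  length-filter P? []       = refl
  length-filter P? (x ∷ xs) with does (P? x)
  ... | true  = cong suc (length-filter P? xs)
  ... | false = length-filter P? xs

module _ {A : Set} where

  ∑-vectors-suc : ∀ (xs : List A) l (f : Vec A (suc l) → ℕ) →
                  ∑ (vectors xs (suc l)) f ≡ ∑ xs (λ x → ∑ (vectors xs l) (λ v → f (x ∷ v)))
  ∑-vectors-suc xs l f = go xs
    where
    go : ∀ ys → ∑ (List.cartesianProductWith _∷_ ys (vectors xs l)) f ≡
                ∑ ys (λ x → ∑ (vectors xs l) (λ v → f (x ∷ v)))
    go []       = refl
    go (y ∷ ys) = trans (∑-++ (map (y ∷_) (vectors xs l)) _ f)
                        (cong₂ _+_ (∑-map {A = Vec A (suc l)} (y ∷_) (vectors xs l) f) (go ys))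

  length-vectors : ∀ (xs : List A) l → length (vectors xs l) ≡ length xs ^ l
  length-vectors xs l = trans (sym (*-identityʳ _)) (trans (sym (∑-const (vectors xs l) 1)) (go l))
    where
    go : ∀ l → ∑ (vectors xs l) (λ _ → 1) ≡ length xs ^ l
    go zero    = refl
    go (suc l) = trans (∑-vectors-suc xs l _) (trans (∑-cong xs (λ _ → go l)) (∑-const xs _))

  ∑-vectors-+ : ∀ (xs : List A) m n (f : Vec A m → Vec A n → ℕ) →
                ∑ (vectors xs (m + n)) (λ v → f (Vec.take m v) (Vec.drop m v)) ≡
                ∑ (vectors xs m) (λ u → ∑ (vectors xs n) (f u))
  ∑-vectors-+ xs zero    n f = sym (+-identityʳ _)
  ∑-vectors-+ xs (suc m) n f =
    trans (∑-vectors-suc xs (m + n) _)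
   (trans (∑-cong xs (λ x → ∑-vectors-+ xs m n (λ u → f (x ∷ u))))
          (sym (∑-vectors-suc xs m _)))

∑<-cong : ∀ n {f g : ℕ → ℕ} → (∀ o → f o ≡ g o) → ∑< n f ≡ ∑< n g
∑<-cong zero    eq = refl
∑<-cong (suc n) eq = cong₂ _+_ (eq 0) (∑<-cong n (eq ∘ suc))

∑<-mono : ∀ n {f g : ℕ → ℕ} → (∀ o → f o ≤ g o) → ∑< n f ≤ ∑< n g
∑<-mono zero    le = z≤n
∑<-mono (suc n) le = +-mono-≤ (le 0) (∑<-mono n (le ∘ suc))

∑<-+ : ∀ n (f g : ℕ → ℕ) → ∑< n (λ o → f o + g o) ≡ ∑< n f + ∑< n g
∑<-+ zero    f g = refl
∑<-+ (suc n) f g rewrite ∑<-+ n (f ∘ suc) (g ∘ suc) = interchange (f 0) (g 0) _ _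

∑<-*ˡ : ∀ c n (f : ℕ → ℕ) → ∑< n (λ o → c * f o) ≡ c * ∑< n f
∑<-*ˡ c zero    f = sym (*-zeroʳ c)
∑<-*ˡ c (suc n) f rewrite ∑<-*ˡ c n (f ∘ suc) = sym (*-distribˡ-+ c (f 0) _)

∑<-const : ∀ n c → ∑< n (λ _ → c) ≡ n * c
∑<-const zero    c = refl
∑<-const (suc n) c = cong (c +_) (∑<-const n c)

∑<-split : ∀ m n (f : ℕ → ℕ) → ∑< (m + n) f ≡ ∑< m f + ∑< n (λ o → f (m + o))
∑<-split zero    n f = refl
∑<-split (suc m) n f = trans (cong (f 0 +_) (∑<-split m n (f ∘ suc))) (sym (+-assoc (f 0) _ _))

bitBlocks : ∀ a → List (Vec Bool a)
bitBlocks a = vectors (true ∷ false ∷ []) a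

fromBits : (a : ℕ) {A : ℕ} → Vec Bool A → ℕ
fromBits zero    _           = 0
fromBits (suc a) []          = 0
fromBits (suc a) (true  ∷ v) = 2 ^ a + fromBits a v
fromBits (suc a) (false ∷ v) = fromBits a v

-- The leading `a` bits of a uniform block are uniform, each value arising from `2 ^ (A ∸ a)`
-- blocks; multiplying by `2 ^ a` avoids the subtraction. So all rows can draw from blocks of one
-- common size.
∑-fromBits : ∀ {a A} → a ≤ A → (F : ℕ → ℕ) →
             2 ^ a * ∑ (bitBlocks A) (F ∘ fromBits a) ≡ 2 ^ A * ∑< (2 ^ a) F
∑-fromBits {zero} {A} z≤n F = begin
  1 * ∑ (bitBlocks A) (λ _ → F 0) ≡⟨ +-identityʳ _ ⟩
  ∑ (bitBlocks A) (λ _ → F 0) ≡⟨ ∑-const (bitBlocks A) (F 0) ⟩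
  length (bitBlocks A) * F 0 ≡⟨ cong₂ _*_ (length-vectors (true ∷ false ∷ []) A) (sym (+-identityʳ _)) ⟩
  2 ^ A * (F 0 + 0) ∎
  where open ≡-Reasoning
∑-fromBits {suc a} {suc A} (s≤s a≤A) F = begin
  2 ^ suc a * ∑ (bitBlocks (suc A)) (F ∘ fromBits (suc a))
    ≡⟨ cong (2 ^ suc a *_) (∑-vectors-suc _ A _) ⟩
  2 ^ suc a * (∑ (bitBlocks A) (F₁ ∘ fromBits a) + (∑ (bitBlocks A) (F ∘ fromBits a) + 0))
    ≡⟨ regroup (2 ^ a) _ _ ⟩
  2 * (2 ^ a * ∑ (bitBlocks A) (F ∘ fromBits a) + 2 ^ a * ∑ (bitBlocks A) (F₁ ∘ fromBits a))
    ≡⟨ cong (2 *_) (cong₂ _+_ (∑-fromBits a≤A F) (∑-fromBits a≤A F₁)) ⟩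
  2 * (2 ^ A * ∑< (2 ^ a) F + 2 ^ A * ∑< (2 ^ a) F₁)
    ≡⟨ collect (2 ^ A) _ _ ⟩
  2 ^ suc A * (∑< (2 ^ a) F + ∑< (2 ^ a) F₁)
    ≡⟨ cong (2 ^ suc A *_) (sym (∑<-split (2 ^ a) (2 ^ a) F)) ⟩
  2 ^ suc A * ∑< (2 ^ a + 2 ^ a) F
    ≡⟨ cong (λ x → 2 ^ suc A * ∑< (2 ^ a + x) F) (sym (+-identityʳ _)) ⟩
  2 ^ suc A * ∑< (2 ^ suc a) F ∎
  where
  open ≡-Reasoning
  F₁ : ℕ → ℕ
  F₁ o = F (2 ^ a + o)
  regroup : ∀ x y z → (2 * x) * (y + (z + 0)) ≡ 2 * (x * z + x * y)
  regroup = solve-∀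
  collect : ∀ x y z → 2 * (x * y + x * z) ≡ 2 * x * (y + z)
  collect = solve-∀

*-^ : ∀ x y k → (x * y) ^ k ≡ x ^ k * y ^ k
*-^ x y zero    = refl
*-^ x y (suc k) = trans (cong (x * y *_) (*-^ x y k)) ([m*n]*[o*p]≡[m*o]*[n*p] x y (x ^ k) (y ^ k))

≡≤-trans : ∀ {x y z} → x ≡ y → y ≤ z → x ≤ z
≡≤-trans refl le = le

≤≡-trans : ∀ {x y z} → x ≤ y → y ≡ z → x ≤ z
≤≡-trans le refl = le

+-swap : ∀ a b c → a + (b + c) ≡ b + a + c
+-swap = solve-∀

-- A single slot

cnt : Fin n → List (Fin n) → ℕ
cnt y []       = 0
cnt y (x ∷ xs) = ⟦ does (x Fin.≟ y) ⟧ + cnt y xs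

cnt-++ : ∀ (y : Fin n) xs ys → cnt y (xs ++ ys) ≡ cnt y xs + cnt y ys
cnt-++ y []       ys = refl
cnt-++ y (x ∷ xs) ys rewrite cnt-++ y xs ys = sym (+-assoc ⟦ does (x Fin.≟ y) ⟧ _ _)

cnt-self : ∀ (x : Fin n) xs → cnt x (x ∷ xs) ≡ suc (cnt x xs)
cnt-self x xs with x Fin.≟ x
... | yes _  = refl
... | no x≢x = contradiction refl x≢x

-- A score of 0 marks an empty register.  `delay` is one more than the number of
-- elements to skip before the next challenger is picked, and 0 if no pick is due.
record Slot (n : ℕ) : Set where
  constructor slot
  field
    champ     : Fin n
    score     : ℕ
    age       : ℕ
    chal      : Fin n
    chalScore : ℕ
    delay     : ℕ
open Slot

bump : Fin n → Fin n → ℕ → ℕ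
bump y p zero    = zero
bump y p (suc c) = ⟦ does (p Fin.≟ y) ⟧ + suc c

tick : Fin n → Slot n → Slot n
tick p (slot y c α z d zero)          = slot y (bump y p c) α z (bump z p d) zero
tick p (slot y c α z d (suc zero))    = slot y (bump y p c) α p 1 zero
tick p (slot y c α z d (suc (suc w))) = slot y (bump y p c) α z (bump z p d) (suc w)

ticks : List (Fin n) → Slot n → Slot n
ticks []       s = s
ticks (p ∷ xs) s = ticks xs (tick p s)

-- Per row of age the champion loses U points, where an occurrence is worth D points.
contest : (D U : ℕ) → Slot n → Slot n
contest D U (slot y c α z d w) with D * c <? D * d + U * suc α
... | yes _ = slot z d 0 z d w
... | no  _ = slot y c (suc α) z d w

start : ℕ → Slot n → Slot n
start o (slot y c α z d w) = slot y c α y 0 (suc o)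

grow : Fin n → ℕ → List (Fin n) → ℕ
grow y zero    xs = zero
grow y (suc c) xs = suc c + cnt y xs

grow-bump : ∀ (y p : Fin n) c xs → grow y (bump y p c) xs ≡ grow y c (p ∷ xs)
grow-bump y p zero    xs = refl
grow-bump y p (suc c) xs with does (p Fin.≟ y)
... | true  = cong suc (sym (+-suc c (cnt y xs)))
... | false = refl

grow-pos : ∀ (y : Fin n) {c} xs → 1 ≤ c → grow y c xs ≡ c + cnt y xs
grow-pos y {suc c} xs _ = refl

grow-≤ : ∀ (y : Fin n) c xs → grow y c xs ≤ c + cnt y xs
grow-≤ y zero    xs = z≤n
grow-≤ y (suc c) xs = ≤-refl

ticks-settled : ∀ xs (y : Fin n) c α z d →
                ticks xs (slot y c α z d 0) ≡ slot y (grow y c xs) α z (grow z d xs) 0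
ticks-settled [] y zero    α z zero    = refl
ticks-settled [] y zero    α z (suc d) = cong (λ e → slot y 0 α z e 0) (sym (+-identityʳ (suc d)))
ticks-settled [] y (suc c) α z zero    = cong (λ e → slot y e α z 0 0) (sym (+-identityʳ (suc c)))
ticks-settled [] y (suc c) α z (suc d) =
  cong₂ (λ e f → slot y e α z f 0) (sym (+-identityʳ (suc c))) (sym (+-identityʳ (suc d)))
ticks-settled (x ∷ xs) y c α z d =
  trans (ticks-settled xs y (bump y x c) α z (bump z x d))
        (cong₂ (λ e f → slot y e α z f 0) (grow-bump y x c xs) (grow-bump z x d xs))

-- The challenger registers and the delay at the end of a row. The offset may lie beyond the end,
-- because the stream can stop in the middle of a row; then nothing is picked.
pick : ℕ → Fin n → List (Fin n) → Fin n × ℕ × ℕ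
pick o       z []       = z , 0 , suc o
pick zero    z (x ∷ xs) = x , suc (cnt x xs) , 0
pick (suc o) z (x ∷ xs) = pick o z xs

withPick : Fin n → ℕ → ℕ → Fin n × ℕ × ℕ → Slot n
withPick y c α (z , d , w) = slot y c α z d w

ticks-pending : ∀ xs (y : Fin n) c α z o →
                ticks xs (slot y c α z 0 (suc o)) ≡ withPick y (grow y c xs) α (pick o z xs)
ticks-pending [] y zero    α z o = refl
ticks-pending [] y (suc c) α z o = cong (λ e → slot y e α z 0 (suc o)) (sym (+-identityʳ (suc c)))
ticks-pending (x ∷ xs) y c α z zero =
  trans (ticks-settled xs y (bump y x c) α x 1)
        (cong (λ e → slot y e α x (suc (cnt x xs)) 0) (grow-bump y x c xs))
ticks-pending (x ∷ xs) y c α z (suc o) =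
  trans (ticks-pending xs y (bump y x c) α z o)
        (cong (λ e → withPick y e α (pick o z xs)) (grow-bump y x c xs))

at : (Fin n → ℕ) → ℕ → List (Fin n) → ℕ
at G o       []       = 0
at G zero    (x ∷ xs) = G x
at G (suc o) (x ∷ xs) = at G o xs

-- Does position o hold i with Pr true of the number of i's before it and of the
-- number of i's from it to the end of the row?
hit : Fin n → (ℕ → ℕ → Bool) → ℕ → ℕ → List (Fin n) → Bool
hit i Pr o       seen []       = false
hit i Pr zero    seen (x ∷ xs) = does (x Fin.≟ i) ∧ Pr seen (suc (cnt i xs))
hit i Pr (suc o) seen (x ∷ xs) = hit i Pr o (⟦ does (x Fin.≟ i) ⟧ + seen) xs

-- With at most `b` occurrences before it, a count started here misses at most `b`.
early : ℕ → ℕ → ℕ → Bool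
early b s x = s ≤ᵇ b

strong : (b D θ : ℕ) → ℕ → ℕ → Bool
strong b D θ s x = (s ≤ᵇ b) ∧ (θ <ᵇ D * x)

-- A challenger other than i is controlled by `G`, and i as a challenger by its own count in the
-- row, which a champion i has gained as well.
pick-bounds : ∀ (i : Fin n) G o z₀ xs → (∀ z → z ≢ i → cnt z xs ≤ G z) →
              proj₁ (proj₂ (pick o z₀ xs)) ≤ at G o xs ⊔ cnt i xs
pick-bounds i G o       z₀ []       h = z≤n
pick-bounds i G zero    z₀ (x ∷ xs) h with x Fin.≟ i
... | yes refl = m≤n⊔m (G x) _
... | no x≢i   = ≡≤-trans (sym (cnt-self x xs)) (≤-trans (h x x≢i) (m≤m⊔n (G x) _))
pick-bounds i G (suc o) z₀ (x ∷ xs) h =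
  ≤-trans (pick-bounds i G o z₀ xs (λ z z≢i → ≤-trans (m≤n+m _ _) (h z z≢i)))
          (⊔-monoʳ-≤ (at G o xs) (m≤n+m _ _))

PickSpec : (Fin n → ℕ) → ℕ → List (Fin n) → Fin n × ℕ × ℕ → Set
PickSpec G o xs (z , d , _) = d ≡ 0 ⊎ (d ≤ cnt z xs × at G o xs ≡ G z)

pick-spec : ∀ (G : Fin n → ℕ) o z₀ xs → PickSpec G o xs (pick o z₀ xs)
pick-spec G o       z₀ []       = inj₁ refl
pick-spec G zero    z₀ (x ∷ xs) = inj₂ (≤-reflexive (sym (cnt-self x xs)) , refl)
pick-spec G (suc o) z₀ (x ∷ xs) with pick-spec G o z₀ xs
... | inj₁ eq        = inj₁ eq
... | inj₂ (le , eq) = inj₂ (≤-trans le (m≤n+m _ _) , eq)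

≤ᵇ-sound : ∀ {a b} → (a ≤ᵇ b) ≡ true → a ≤ b
≤ᵇ-sound {a} {b} eq = ≤ᵇ⇒≤ a b (subst T (sym eq) tt)

<ᵇ-sound : ∀ {a b} → (a <ᵇ b) ≡ true → a < b
<ᵇ-sound {a} {b} eq = <ᵇ⇒< a b (subst T (sym eq) tt)

pick-hit : ∀ (i : Fin n) b D θ o seen z₀ xs → hit i (strong b D θ) o seen xs ≡ true →
           Σ[ x ∈ ℕ ] (pick o z₀ xs ≡ (i , suc x , 0) × cnt i xs + seen ≤ suc x + b × θ < D * suc x)
pick-hit i b D θ zero seen z₀ (x ∷ xs) eq with x Fin.≟ i
... | no _     = contradiction eq λ ()
... | yes refl with seen ≤ᵇ b in e₁ | θ <ᵇ D * suc (cnt x xs) in e₂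
...   | true | true = cnt x xs , refl , +-monoʳ-≤ (suc (cnt x xs)) (≤ᵇ-sound e₁) , <ᵇ-sound e₂
pick-hit i b D θ (suc o) seen z₀ (x ∷ xs) eq with pick-hit i b D θ o _ z₀ xs eq
... | y , e , le , lt = y , e , ≡≤-trans (swap ⟦ does (x Fin.≟ i) ⟧ (cnt i xs) seen) le , lt
  where
  swap : ∀ a c s → a + c + s ≡ c + (a + s)
  swap = solve-∀

module Window (i : Fin n) (G : Fin n → ℕ) (b D U : ℕ) where

  -- The value at which i has to enter the rows Rs as champion to stay so to the end.
  need : (Rs : List (List (Fin n))) → Vec ℕ (length Rs) → ℕ
  need []       []      = 0
  -- In this row i earns `D * cnt i R` and pays `U` at the contest, where it must withstand the pick
  -- and keep what the later rows ask for.
  need (R ∷ Rs) (o ∷ O) = U + ((D * at G o R ⊔ need Rs O) ∸ D * cnt i R)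

  -- How a bound V on the value of any champion other than i evolves in a row.
  next : ℕ → ℕ → List (Fin n) → ℕ
  next V o R = (V ⊔ D * at G o R) ∸ U

  success : ℕ → ℕ → (Rs : List (List (Fin n))) → Vec ℕ (length Rs) → Bool
  success V seen []       []      = false
  success V seen (R ∷ Rs) (o ∷ O) =
    hit i (strong b D (V ⊔ need Rs O)) o seen R ∨ success (next V o R) (cnt i R + seen) Rs O

  rowRun : ℕ → List (Fin n) → Slot n → Slot n
  rowRun o R s = ticks R (start o s)

  rowsRun : (Rs : List (List (Fin n))) → Vec ℕ (length Rs) → Slot n → Slot n
  rowsRun []       []      s = s
  rowsRun (R ∷ Rs) (o ∷ O) s = rowsRun Rs O (rowRun o R (contest D U s))

  Champion : ℕ → Slot n → Set
  Champion seen s = champ s ≡ i × 1 ≤ score s × seen ≤ score s + b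

  -- Contests take place only when another row begins. After the last row i may therefore still be
  -- the challenger, and both registers go on counting.
  Found : ℕ → Slot n → Set
  Found seen s = Champion seen s ⊎ (chal s ≡ i × delay s ≡ 0 × 1 ≤ chalScore s × seen ≤ chalScore s + b)

  -- The value of a champion is `D * score` less `U * age`; the penalty is moved to the other side
  -- to stay in ℕ.
  Safe : ℕ → ℕ → Slot n → Set
  Safe v seen t = Champion seen t × v + U * age t ≤ D * score t

  Ready : ℕ → ℕ → Slot n → Set
  Ready v seen s = Found seen s × Safe v seen (contest D U s)

  -- All occurrences of the champion still to come in the window are credited in advance, so its
  -- value falls by `U` per row whatever the picks are. `suc (age t)` includes the penalty of the
  -- coming contest.
  Bounded : ℕ → List (List (Fin n)) → Slot n → Set
  Bounded V Rs t = score t ≡ 0 ⊎ champ t ≡ i ⊎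
                   D * (score t + cnt (champ t) (concat Rs)) ≤ V + U * suc (age t)

  Dominates : List (List (Fin n)) → Set
  Dominates Rs = ∀ z → z ≢ i → cnt z (concat Rs) ≤ G z

  rowRun≡ : ∀ o (R : List (Fin n)) y c α z d w → rowRun o R (slot y c α z d w) ≡ withPick y (grow y c R) α (pick o y R)
  rowRun≡ o R y c α z d w = ticks-pending R y c α y o

  private
    cnt-row : ∀ (z : Fin n) R (Rs : List (List (Fin n))) → cnt z R ≤ cnt z (concat (R ∷ Rs))
    cnt-row z R Rs = ≤≡-trans (m≤m+n _ _) (sym (cnt-++ z R (concat Rs)))

    dominates-row : ∀ {R Rs} → Dominates (R ∷ Rs) → ∀ z → z ≢ i → cnt z R ≤ G z
    dominates-row {R} {Rs} dom z z≢i = ≤-trans (cnt-row z R Rs) (dom z z≢i)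

    dominates-tail : ∀ {R Rs} → Dominates (R ∷ Rs) → Dominates Rs
    dominates-tail {R} {Rs} dom z z≢i =
      ≤-trans (≤≡-trans (m≤n+m _ _) (sym (cnt-++ z R (concat Rs)))) (dom z z≢i)

  module _ (D>0 : 1 ≤ D) where

    -- `V` caps what a foreign champion has left after its penalties, so a pick of i above `V` ousts
    -- it. If i is champion already and survives, its count is at least that of the new pick, and
    -- nothing is lost.
    ready-enter : ∀ {V v θ} o R Rs seen t → Bounded V (R ∷ Rs) t → V ≤ θ → v ≤ θ →
                  hit i (strong b D θ) o seen R ≡ true → Ready v (cnt i R + seen) (rowRun o R t)
    ready-enter {V} {v} {θ} o R Rs seen t@(slot y c α z d w) bd V≤θ v≤θ isHit
      with pick-hit i b D θ o seen y R isHit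
    ... | x , eq , le , lt rewrite rowRun≡ o R y c α z d w | eq = inj₂ (refl , refl , s≤s z≤n , le) , safe
      where
      c′ = grow y c R
      lose : D * c′ < D * suc x + U * suc α → Safe v (cnt i R + seen) (slot i (suc x) 0 i (suc x) 0)
      lose _ = (refl , s≤s z≤n , le) ,
               ≡≤-trans (trans (cong (v +_) (*-zeroʳ U)) (+-identityʳ v))
                       (≤-trans v≤θ (<⇒≤ lt))
      keep : Bounded V (R ∷ Rs) t → ¬ (D * c′ < D * suc x + U * suc α) →
             Safe v (cnt i R + seen) (slot y c′ (suc α) i (suc x) 0)
      keep (inj₁ c≡0) ≮ = contradiction (≤-trans (≤-trans lt (m≤m+n _ _)) (≮⇒≥ ≮))
        (λ p → n≮0 (≤≡-trans p (trans (cong (λ e → D * grow y e R) c≡0) (*-zeroʳ D))))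
      keep (inj₂ (inj₁ y≡i)) ≮ = (y≡i , ≤-trans (s≤s z≤n) x≤c′ , ≤-trans le (+-monoˡ-≤ b x≤c′)) ,
                               ≤-trans (+-monoˡ-≤ (U * suc α) (≤-trans v≤θ (<⇒≤ lt))) (≮⇒≥ ≮)
        where
        x≤c′ : suc x ≤ c′
        x≤c′ = *-cancelˡ-≤ D {{>-nonZero D>0}} (≤-trans (m≤m+n _ _) (≮⇒≥ ≮))
      keep (inj₂ (inj₂ bound)) ≮ = contradiction (begin-strict
        D * c′ ≤⟨ *-monoʳ-≤ D (≤-trans (grow-≤ y c R) (+-monoʳ-≤ c (cnt-row y R Rs))) ⟩
        D * (c + cnt y (concat (R ∷ Rs))) ≤⟨ bound ⟩
        V + U * suc α <⟨ +-monoˡ-< (U * suc α) (≤-<-trans V≤θ lt) ⟩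
        D * suc x + U * suc α ∎) ≮
        where open ≤-Reasoning
      safe : Safe v (cnt i R + seen) (contest D U (slot y c′ α i (suc x) 0))
      safe with D * c′ <? D * suc x + U * suc α
      ... | yes p = lose p
      ... | no ¬p = keep bd ¬p

    -- The budget covers the worst foreign pick, the need of the later rows, and `D * h`, the most
    -- that i can reach as its own challenger. Hence no contest removes i.
    ready-step : ∀ o R Rs O seen s → Dominates (R ∷ Rs) → Safe (need (R ∷ Rs) (o ∷ O)) seen s →
                 Ready (need Rs O) (cnt i R + seen) (rowRun o R s)
    ready-step o R Rs O seen (slot y c α z d w) dom ((refl , 1≤c , le) , safe)
      rewrite rowRun≡ o R y c α z d w | grow-pos y R 1≤c
      with pick o y R | pick-bounds i G o y R (dominates-row {R} {Rs} dom)
    ... | z′ , d′ , w′ | d′≤ = inj₁ champion , result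
      where
      h = cnt i R
      M = D * at G o R ⊔ need Rs O
      champion : Champion (h + seen) (slot y (c + h) α z′ d′ w′)
      champion = refl , ≤-trans 1≤c (m≤m+n _ _) ,
                 ≤≡-trans (+-monoʳ-≤ h le) (+-swap h c b)
      budget : (M ⊔ D * h) + U * suc α ≤ D * (c + h)
      budget = begin
        (M ⊔ D * h) + U * suc α ≤⟨ +-monoˡ-≤ (U * suc α) (⊔-lub (m≤n+m∸n M (D * h)) (m≤m+n (D * h) _)) ⟩
        (D * h + (M ∸ D * h)) + U * suc α ≡⟨ regroup U α (D * h) (M ∸ D * h) ⟩
        (U + (M ∸ D * h) + U * α) + D * h ≤⟨ +-monoˡ-≤ (D * h) safe ⟩
        D * c + D * h ≡⟨ sym (*-distribˡ-+ D c h) ⟩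
        D * (c + h) ∎
        where
        open ≤-Reasoning
        regroup : ∀ u a x y → (x + y) + u * suc a ≡ (u + y + u * a) + x
        regroup = solve-∀
      D*d′≤ : D * d′ ≤ M ⊔ D * h
      D*d′≤ = begin
        D * d′ ≤⟨ *-monoʳ-≤ D d′≤ ⟩
        D * (at G o R ⊔ h) ≡⟨ *-distribˡ-⊔ D (at G o R) h ⟩
        D * at G o R ⊔ D * h ≤⟨ ⊔-monoˡ-≤ (D * h) (m≤m⊔n (D * at G o R) (need Rs O)) ⟩
        M ⊔ D * h ∎
        where open ≤-Reasoning
      result : Safe (need Rs O) (h + seen) (contest D U (slot y (c + h) α z′ d′ w′))
      result with D * (c + h) <? D * d′ + U * suc α
      ... | yes p = contradiction (≤-trans (+-monoˡ-≤ (U * suc α) D*d′≤) budget) (<⇒≱ p)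
      ... | no  _ = champion ,
                    ≤-trans (+-monoˡ-≤ (U * suc α) (≤-trans (m≤n⊔m (D * at G o R) _) (m≤m⊔n M (D * h)))) budget

    -- A foreign challenger z enters with at most `D * G z`, which already includes its future in
    -- the window; a surviving champion has had its gains credited before. In both cases one more
    -- penalty `U` is due.
    bounded-step : ∀ V o R Rs t → Dominates (R ∷ Rs) → Bounded V (R ∷ Rs) t →
                   Bounded (next V o R) Rs (contest D U (rowRun o R t))
    bounded-step V o R Rs (slot y c α z d w) dom bd rewrite rowRun≡ o R y c α z d w
      with pick o y R | pick-spec G o y R
    ... | z′ , d′ , w′ | other with D * grow y c R <? D * d′ + U * suc α
    ...   | yes _ with other
    ...     | inj₁ refl = inj₁ refl
    ...     | inj₂ (d′≤ , eq) with z′ Fin.≟ i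
    ...       | yes z′≡i = inj₂ (inj₁ z′≡i)
    ...       | no  z′≢i = inj₂ (inj₂ (begin
      D * (d′ + cnt z′ (concat Rs)) ≤⟨ *-monoʳ-≤ D (+-monoˡ-≤ _ d′≤) ⟩
      D * (cnt z′ R + cnt z′ (concat Rs)) ≡⟨ cong (D *_) (sym (cnt-++ z′ R (concat Rs))) ⟩
      D * cnt z′ (concat (R ∷ Rs)) ≤⟨ *-monoʳ-≤ D (dom z′ z′≢i) ⟩
      D * G z′ ≡⟨ cong (D *_) (sym eq) ⟩
      D * at G o R ≤⟨ m≤n⊔m V _ ⟩
      V ⊔ D * at G o R ≤⟨ m≤n+m∸n _ U ⟩
      U + next V o R ≡⟨ +-comm U _ ⟩
      next V o R + U ≡⟨ cong (next V o R +_) (sym (*-identityʳ U)) ⟩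
      next V o R + U * 1 ∎))
      where open ≤-Reasoning
    bounded-step V o R Rs (slot y c α z d w) dom bd | z′ , d′ , w′ | other | no _ with bd
    ... | inj₁ refl        = inj₁ refl
    ... | inj₂ (inj₁ y≡i)  = inj₂ (inj₁ y≡i)
    ... | inj₂ (inj₂ bound) = inj₂ (inj₂ (begin
      D * (grow y c R + cnt y (concat Rs)) ≤⟨ *-monoʳ-≤ D (+-monoˡ-≤ _ (grow-≤ y c R)) ⟩
      D * (c + cnt y R + cnt y (concat Rs)) ≡⟨ cong (D *_) (trans (+-assoc c _ _) (cong (c +_) (sym (cnt-++ y R (concat Rs))))) ⟩
      D * (c + cnt y (concat (R ∷ Rs))) ≤⟨ bound ⟩
      V + U * suc α ≤⟨ +-monoˡ-≤ (U * suc α) (≤-trans (m≤m⊔n V (D * at G o R)) (m≤n+m∸n _ U)) ⟩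
      U + next V o R + U * suc α ≡⟨ regroup U (next V o R) α ⟩
      next V o R + U * suc (suc α) ∎))
      where
      open ≤-Reasoning
      regroup : ∀ u v a → u + v + u * suc a ≡ v + u * suc (suc a)
      regroup = solve-∀

    private
      advance : ∀ R Rs seen → cnt i (concat Rs) + (cnt i R + seen) ≡ cnt i (concat (R ∷ Rs)) + seen
      advance R Rs seen = trans (+-swap (cnt i (concat Rs)) (cnt i R) seen)
                                (cong (_+ seen) (sym (cnt-++ i R (concat Rs))))

    ready⇒found : ∀ Rs O seen s → Dominates Rs → Ready (need Rs O) seen s →
                  Found (cnt i (concat Rs) + seen) (rowsRun Rs O s)
    ready⇒found []       []      seen s dom (found , _) = found
    ready⇒found (R ∷ Rs) (o ∷ O) seen s dom (_ , safe) =
      subst (λ x → Found x (rowsRun (R ∷ Rs) (o ∷ O) s)) (advance R Rs seen)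
        (ready⇒found Rs O (cnt i R + seen) _ (dominates-tail {R} {Rs} dom)
          (ready-step o R Rs O seen (contest D U s) dom safe))

    -- Up to the first good row only the bound on foreign champions is maintained, from there on
    -- only the safety of i.
    success⇒found : ∀ Rs O V seen s → Dominates Rs → Bounded V Rs (contest D U s) →
                    success V seen Rs O ≡ true → Found (cnt i (concat Rs) + seen) (rowsRun Rs O s)
    success⇒found []       []      V seen s dom bd ()
    success⇒found (R ∷ Rs) (o ∷ O) V seen s dom bd eq
      with hit i (strong b D (V ⊔ need Rs O)) o seen R in isHit
    ... | true  = subst (λ x → Found x (rowsRun (R ∷ Rs) (o ∷ O) s)) (advance R Rs seen)
      (ready⇒found Rs O (cnt i R + seen) _ (dominates-tail {R} {Rs} dom)
        (ready-enter o R Rs seen (contest D U s) bd (m≤m⊔n V _) (m≤n⊔m V _) isHit))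
    ... | false = subst (λ x → Found x (rowsRun (R ∷ Rs) (o ∷ O) s)) (advance R Rs seen)
      (success⇒found Rs O (next V o R) (cnt i R + seen) _ (dominates-tail {R} {Rs} dom)
        (bounded-step V o R Rs (contest D U s) dom bd) eq)

-- Counting good positions

∑-upTo : ∀ L (f : ℕ → ℕ) → ∑ (upTo L) f ≡ ∑< L f
∑-upTo L f = go L id
  where
  go : ∀ L g → ∑ (List.applyUpTo g L) f ≡ ∑< L (f ∘ g)
  go zero    g = refl
  go (suc L) g = cong (f (g 0) +_) (go L (g ∘ suc))

∑<-∑ : {A : Set} (L : ℕ) (xs : List A) (f : ℕ → A → ℕ) →
       ∑< L (λ o → ∑ xs (f o)) ≡ ∑ xs (λ x → ∑< L (λ o → f o x))
∑<-∑ zero    xs f = sym (trans (∑-const xs 0) (*-zeroʳ (length xs)))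
∑<-∑ (suc L) xs f = trans (cong (∑ xs (f 0) +_) (∑<-∑ L xs (f ∘ suc))) (sym (∑-+ xs (f 0) _))

∑-offsets-suc : ∀ L P (f : Vec ℕ (suc P) → ℕ) →
                ∑ (vectors (upTo L) (suc P)) f ≡ ∑< L (λ o → ∑ (vectors (upTo L) P) (λ O → f (o ∷ O)))
∑-offsets-suc L P f = trans (∑-vectors-suc (upTo L) P f) (∑-upTo L _)

∑-offsets-const : ∀ L P c → ∑ (vectors (upTo L) P) (λ _ → c) ≡ L ^ P * c
∑-offsets-const L P c =
  trans (∑-const (vectors (upTo L) P) c)
        (cong (_* c) (trans (length-vectors (upTo L) P) (cong (_^ P) (length-upTo L))))

⟦⟧≤1 : ∀ x → ⟦ x ⟧ ≤ 1
⟦⟧≤1 true  = ≤-refl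
⟦⟧≤1 false = z≤n

module Offsets (i : Fin n) (G : Fin n → ℕ) (b D U L : ℕ) where
  open Window i G b D U

  Rows : Set
  Rows = List (List (Fin n))

  offsets : (Rs : Rows) → List (Vec ℕ (length Rs))
  offsets Rs = vectors (upTo L) (length Rs)

  ∑ᵒ : (Rs : Rows) → (Vec ℕ (length Rs) → ℕ) → ℕ
  ∑ᵒ Rs = ∑ (offsets Rs)

  ∑ᵒ-∷ : ∀ R Rs (F : Vec ℕ (suc (length Rs)) → ℕ) (f h : ℕ → Vec ℕ (length Rs) → ℕ) →
         (∀ o O → F (o ∷ O) ≡ f o O + h o O) →
         ∑ᵒ (R ∷ Rs) F ≡ ∑< L (λ o → ∑ᵒ Rs (f o)) + ∑< L (λ o → ∑ᵒ Rs (h o))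
  ∑ᵒ-∷ R Rs F f h eq =
    trans (∑-offsets-suc L (length Rs) F)
   (trans (∑<-cong L (λ o → trans (∑-cong (offsets Rs) (eq o)) (∑-+ (offsets Rs) (f o) (h o))))
          (∑<-+ L _ _))

  X : Rows → ℕ
  X Rs = L ^ length Rs

  badAt : ℕ → List (Fin n) → ℕ
  badAt θ []       = 0
  badAt θ (x ∷ xs) = ⟦ does (x Fin.≟ i) ∧ not (θ <ᵇ D * suc (cnt i xs)) ⟧ + badAt θ xs

  badAt-≤-cnt : ∀ θ xs → badAt θ xs ≤ cnt i xs
  badAt-≤-cnt θ []       = z≤n
  badAt-≤-cnt θ (x ∷ xs) with does (x Fin.≟ i)
  ... | false = badAt-≤-cnt θ xs
  ... | true  = +-mono-≤ (⟦⟧≤1 _) (badAt-≤-cnt θ xs)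

  -- The count to the end of the row shrinks from one occurrence of i to the next, so those that
  -- fail the threshold are the last ones, at most `θ / D` of them.
  badAt-≤ : ∀ θ xs → D * badAt θ xs ≤ θ
  badAt-≤ θ []       = ≡≤-trans (*-zeroʳ D) z≤n
  badAt-≤ θ (x ∷ xs) with does (x Fin.≟ i)
  ... | false = badAt-≤ θ xs
  ... | true with θ <ᵇ D * suc (cnt i xs) in eq
  ...   | true  = badAt-≤ θ xs
  ...   | false = ≤-trans (*-monoʳ-≤ D (s≤s (badAt-≤-cnt θ xs))) (≮⇒≥ λ lt → subst T eq (<⇒<ᵇ lt))

  early-strong : ∀ θ seen R l →
    ∑< l (λ o → ⟦ hit i (early b) o seen R ⟧) ≤
    ∑< l (λ o → ⟦ hit i (strong b D θ) o seen R ⟧) + badAt θ R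
  early-strong θ seen R        zero    = z≤n
  early-strong θ seen []       (suc l) = early-strong θ seen [] l
  early-strong θ seen (x ∷ xs) (suc l) = begin
    ⟦ d ∧ p ⟧ + E ≤⟨ +-mono-≤ (split d p q) (early-strong θ _ xs l) ⟩
    (⟦ d ∧ (p ∧ q) ⟧ + ⟦ d ∧ not q ⟧) + (S + B) ≡⟨ interchange ⟦ d ∧ (p ∧ q) ⟧ _ S B ⟩
    (⟦ d ∧ (p ∧ q) ⟧ + S) + (⟦ d ∧ not q ⟧ + B) ∎
    where
    open ≤-Reasoning
    d = does (x Fin.≟ i)
    p = seen ≤ᵇ b
    q = θ <ᵇ D * suc (cnt i xs)
    E = ∑< l (λ o → ⟦ hit i (early b) o (⟦ d ⟧ + seen) xs ⟧)
    S = ∑< l (λ o → ⟦ hit i (strong b D θ) o (⟦ d ⟧ + seen) xs ⟧)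
    B = badAt θ xs
    split : ∀ d p q → ⟦ d ∧ p ⟧ ≤ ⟦ d ∧ (p ∧ q) ⟧ + ⟦ d ∧ not q ⟧
    split false p     q     = z≤n
    split true  false q     = z≤n
    split true  true  false = ≤-refl
    split true  true  true  = ≤-refl

  strong⇒early : ∀ θ o seen R → ⟦ hit i (strong b D θ) o seen R ⟧ ≤ ⟦ hit i (early b) o seen R ⟧
  strong⇒early θ o       seen []       = z≤n
  strong⇒early θ zero    seen (x ∷ xs) with does (x Fin.≟ i) | seen ≤ᵇ b
  ... | false | _     = z≤n
  ... | true  | false = z≤n
  ... | true  | true  = ⟦⟧≤1 _
  strong⇒early θ (suc o) seen (x ∷ xs) = strong⇒early θ o _ xs

  targets : ℕ → List (Fin n) → ℕ
  targets seen []       = 0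
  targets seen (x ∷ xs) = ⟦ does (x Fin.≟ i) ∧ (seen ≤ᵇ b) ⟧ + targets (⟦ does (x Fin.≟ i) ⟧ + seen) xs

  targets-++ : ∀ seen xs ys → targets seen (xs ++ ys) ≡ targets seen xs + targets (cnt i xs + seen) ys
  targets-++ seen []       ys = refl
  targets-++ seen (x ∷ xs) ys = begin
    t + targets (d + seen) (xs ++ ys) ≡⟨ cong (t +_) (targets-++ _ xs ys) ⟩
    t + (targets (d + seen) xs + targets (cnt i xs + (d + seen)) ys) ≡⟨ sym (+-assoc t _ _) ⟩
    t + targets (d + seen) xs + targets (cnt i xs + (d + seen)) ys ≡⟨ cong (λ z → t + targets (d + seen) xs + targets z ys) (+-swap (cnt i xs) d seen) ⟩
    t + targets (d + seen) xs + targets (d + cnt i xs + seen) ys ∎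
    where
    open ≡-Reasoning
    d = ⟦ does (x Fin.≟ i) ⟧
    t = ⟦ does (x Fin.≟ i) ∧ (seen ≤ᵇ b) ⟧

  targets-⊓ : ∀ seen xs → targets seen xs ≡ cnt i xs ⊓ (suc b ∸ seen)
  targets-⊓ seen []       = refl
  targets-⊓ seen (x ∷ xs) with does (x Fin.≟ i)
  ... | false = targets-⊓ seen xs
  ... | true with seen ≤ᵇ b in eq
  ...   | true  = trans (cong suc (targets-⊓ (suc seen) xs))
                        (cong (suc (cnt i xs) ⊓_) (sym (+-∸-assoc 1 (≤ᵇ-sound {seen} {b} eq))))
  ...   | false = trans (targets-⊓ (suc seen) xs)
                  (trans (trans (cong (cnt i xs ⊓_) (m≤n⇒m∸n≡0 (m≤n⇒m≤1+n b<seen))) (⊓-zeroʳ _))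
                         (cong (suc (cnt i xs) ⊓_) (sym (m≤n⇒m∸n≡0 b<seen))))
    where
    b<seen : b < seen
    b<seen = ≰⇒> λ le → subst T eq (≤⇒≤ᵇ le)

  targets-∑ : ∀ seen R l → length R ≤ l → ∑< l (λ o → ⟦ hit i (early b) o seen R ⟧) ≡ targets seen R
  targets-∑ seen []       l       le       = trans (∑<-const l 0) (*-zeroʳ l)
  targets-∑ seen (x ∷ xs) (suc l) (s≤s le) = cong (_ +_) (targets-∑ _ xs l le)

  Tot : ℕ → Rows → ℕ
  Tot seen []       = 0
  Tot seen (R ∷ Rs) = ∑< L (λ o → ⟦ hit i (early b) o seen R ⟧) + Tot (cnt i R + seen) Rs

  -- Makes the number of targets a matter of choice: for `b = seen + H - 1` it is exactly H,
  -- provided that i occurs at least H times. The second moment needs it bounded from above too.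
  Tot-⊓ : ∀ seen Rs → All (λ R → length R ≤ L) Rs → Tot seen Rs ≡ cnt i (concat Rs) ⊓ (suc b ∸ seen)
  Tot-⊓ seen Rs short = trans (go seen Rs short) (targets-⊓ seen (concat Rs))
    where
    go : ∀ seen Rs → All (λ R → length R ≤ L) Rs → Tot seen Rs ≡ targets seen (concat Rs)
    go seen []       []       = refl
    go seen (R ∷ Rs) (p ∷ ps) = trans (cong₂ _+_ (targets-∑ seen R L p) (go _ Rs ps))
                                      (sym (targets-++ seen R (concat Rs)))

  hits : ℕ → (Rs : Rows) → Vec ℕ (length Rs) → ℕ
  hits seen []       []      = 0
  hits seen (R ∷ Rs) (o ∷ O) = ⟦ hit i (early b) o seen R ⟧ + hits (cnt i R + seen) Rs O

  goods : ℕ → ℕ → (Rs : Rows) → Vec ℕ (length Rs) → ℕ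
  goods V seen []       []      = 0
  goods V seen (R ∷ Rs) (o ∷ O) =
    ⟦ hit i (strong b D (V ⊔ need Rs O)) o seen R ⟧ + goods (next V o R) (cnt i R + seen) Rs O

  -- Pairs of rows in both of which the pick is an early i.
  pairs : ℕ → (Rs : Rows) → Vec ℕ (length Rs) → ℕ
  pairs seen []       []      = 0
  pairs seen (R ∷ Rs) (o ∷ O) =
    ⟦ hit i (early b) o seen R ⟧ * hits (cnt i R + seen) Rs O + pairs (cnt i R + seen) Rs O

  bad : ℕ → (Rs : Rows) → Vec ℕ (length Rs) → ℕ
  bad V []       []      = 0
  bad V (R ∷ Rs) (o ∷ O) = badAt (V ⊔ need Rs O) R + bad (next V o R) Rs O

  squares : (Rs : Rows) → Vec ℕ (length Rs) → ℕ
  squares []       []      = 0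
  squares (R ∷ Rs) (o ∷ O) = at G o R * at G o R + squares Rs O

  goods-≤-hits : ∀ V seen Rs O → goods V seen Rs O ≤ hits seen Rs O
  goods-≤-hits V seen []       []      = z≤n
  goods-≤-hits V seen (R ∷ Rs) (o ∷ O) = +-mono-≤ (strong⇒early _ o seen R) (goods-≤-hits _ _ Rs O)

  -- Bonferroni's inequality for a fixed choice of offsets: every good pick after the first forms a
  -- pair with the first.
  goods-≤ : ∀ V seen Rs O → goods V seen Rs O ≤ ⟦ success V seen Rs O ⟧ + pairs seen Rs O
  goods-≤ V seen []       []      = z≤n
  goods-≤ V seen (R ∷ Rs) (o ∷ O)
    with hit i (strong b D (V ⊔ need Rs O)) o seen R | strong⇒early (V ⊔ need Rs O) o seen R
  ... | false | _  = ≤-trans (goods-≤ _ _ Rs O) (+-monoʳ-≤ ⟦ success _ _ Rs O ⟧ (m≤n+m _ _))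
  ... | true  | le with hit i (early b) o seen R | le
  ...   | true | _ = s≤s (≤-trans (≤≡-trans (goods-≤-hits _ _ Rs O) (sym (+-identityʳ _))) (m≤m+n _ _))

  -- The threshold of a row depends on earlier picks through `V` and on later ones through `need`,
  -- never on the pick of the row itself. With all other picks fixed, that pick is still uniform,
  -- and all early positions except `badAt` many are good.
  ∑-goods : ∀ V seen Rs → Tot seen Rs * X Rs ≤ L * ∑ᵒ Rs (goods V seen Rs) + ∑ᵒ Rs (bad V Rs)
  ∑-goods V seen []       = z≤n
  ∑-goods V seen (R ∷ Rs) = begin
    (t + t′) * (L * x) ≡⟨ expand t t′ L x ⟩
    L * (x * t) + L * (t′ * x) ≡⟨ cong₂ _+_ (cong (L *_) (sym (∑-offsets-const L (length Rs) t))) (sym (∑<-const L (t′ * x))) ⟩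
    L * ∑ᵒ Rs (λ _ → t) + ∑< L (λ _ → t′ * x) ≤⟨ +-mono-≤ (*-monoʳ-≤ L (∑-mono (offsets Rs) (λ O → early-strong (V ⊔ need Rs O) seen R L)))
                                                                         (∑<-mono L (λ o → ∑-goods (next V o R) (cnt i R + seen) Rs)) ⟩
    L * ∑ᵒ Rs (λ O → ∑< L (g O) + β O) + ∑< L (λ o → L * g′ o + b′ o)
      ≡⟨ cong₂ (λ u v → L * u + v) (∑-+ (offsets Rs) _ _) (trans (∑<-+ L _ _) (cong (_+ ∑< L b′) (∑<-*ˡ L L g′))) ⟩
    L * (∑ᵒ Rs (λ O → ∑< L (g O)) + ∑ᵒ Rs β) + (L * ∑< L g′ + ∑< L b′)
      ≡⟨ regroup L (∑ᵒ Rs (λ O → ∑< L (g O))) (∑ᵒ Rs β) (∑< L g′) (∑< L b′) ⟩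
    L * (∑ᵒ Rs (λ O → ∑< L (g O)) + ∑< L g′) + (L * ∑ᵒ Rs β + ∑< L b′)
      ≡⟨ cong₂ (λ u v → L * (u + ∑< L g′) + (v + ∑< L b′)) (sym (∑<-∑ L (offsets Rs) (λ o O → g O o))) (sym (∑<-const L _)) ⟩
    L * (∑< L (λ o → ∑ᵒ Rs (λ O → g O o)) + ∑< L g′) + (∑< L (λ _ → ∑ᵒ Rs β) + ∑< L b′)
      ≡⟨ cong₂ (λ u v → L * u + v) (sym (∑ᵒ-∷ R Rs (goods V seen (R ∷ Rs)) (λ o O → g O o) (λ o → goods (next V o R) (cnt i R + seen) Rs) (λ _ _ → refl)))
                                   (sym (∑ᵒ-∷ R Rs (bad V (R ∷ Rs)) (λ _ → β) (λ o → bad (next V o R) Rs) (λ _ _ → refl))) ⟩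
    L * ∑ᵒ (R ∷ Rs) (goods V seen (R ∷ Rs)) + ∑ᵒ (R ∷ Rs) (bad V (R ∷ Rs)) ∎
    where
    open ≤-Reasoning
    x  = X Rs
    t  = ∑< L (λ o → ⟦ hit i (early b) o seen R ⟧)
    t′ = Tot (cnt i R + seen) Rs
    g : Vec ℕ (length Rs) → ℕ → ℕ
    g O o = ⟦ hit i (strong b D (V ⊔ need Rs O)) o seen R ⟧
    β : Vec ℕ (length Rs) → ℕ
    β O = badAt (V ⊔ need Rs O) R
    g′ b′ : ℕ → ℕ
    g′ o = ∑ᵒ Rs (goods (next V o R) (cnt i R + seen) Rs)
    b′ o = ∑ᵒ Rs (bad (next V o R) Rs)
    expand : ∀ t t′ l x → (t + t′) * (l * x) ≡ l * (x * t) + l * (t′ * x)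
    expand = solve-∀
    regroup : ∀ l a b c d → l * (a + b) + (l * c + d) ≡ l * (a + c) + (l * b + d)
    regroup = solve-∀

  ∑-hits : ∀ seen Rs → L * ∑ᵒ Rs (hits seen Rs) ≡ Tot seen Rs * X Rs
  ∑-hits seen []       = *-zeroʳ L
  ∑-hits seen (R ∷ Rs) = begin
    L * ∑ᵒ (R ∷ Rs) (hits seen (R ∷ Rs))
      ≡⟨ cong (L *_) (∑ᵒ-∷ R Rs (hits seen (R ∷ Rs)) (λ o _ → e o) (λ _ → hits (cnt i R + seen) Rs) (λ _ _ → refl)) ⟩
    L * (∑< L (λ o → ∑ᵒ Rs (λ _ → e o)) + ∑< L (λ _ → s′))
      ≡⟨ cong₂ (λ u v → L * (u + v)) (trans (∑<-cong L (λ o → ∑-offsets-const L (length Rs) (e o))) (∑<-*ˡ (X Rs) L e)) (∑<-const L s′) ⟩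
    L * (X Rs * t + L * s′) ≡⟨ regroup L (X Rs) t s′ ⟩
    t * (L * X Rs) + L * (L * s′) ≡⟨ cong (λ z → t * (L * X Rs) + L * z) (∑-hits _ Rs) ⟩
    t * (L * X Rs) + L * (t′ * X Rs) ≡⟨ collect t t′ L (X Rs) ⟩
    (t + t′) * (L * X Rs) ∎
    where
    open ≡-Reasoning
    e : ℕ → ℕ
    e o = ⟦ hit i (early b) o seen R ⟧
    t  = ∑< L e
    t′ = Tot (cnt i R + seen) Rs
    s′ = ∑ᵒ Rs (hits (cnt i R + seen) Rs)
    regroup : ∀ l x t s → l * (x * t + l * s) ≡ t * (l * x) + l * (l * s)
    regroup = solve-∀
    collect : ∀ t t′ l x → t * (l * x) + l * (t′ * x) ≡ (t + t′) * (l * x)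
    collect = solve-∀

  -- Picks in different rows are independent, so the expectation is a sum of products over pairs of
  -- rows. Using `t ≤ t * t` within each row leaves T * (T - 1) instead of T ^ 2 for the total T,
  -- which handles even rows of length 1.
  ∑-pairs : ∀ seen Rs → 2 * (L * L) * ∑ᵒ Rs (pairs seen Rs) + Tot seen Rs * X Rs ≤ Tot seen Rs * Tot seen Rs * X Rs
  ∑-pairs seen []       = ≤-reflexive (trans (+-identityʳ _) (*-zeroʳ (2 * (L * L))))
  ∑-pairs seen (R ∷ Rs) = begin
    2 * (L * L) * ∑ᵒ (R ∷ Rs) (pairs seen (R ∷ Rs)) + (t + t′) * (L * x)
      ≡⟨ cong (λ z → 2 * (L * L) * z + (t + t′) * (L * x))
           (∑ᵒ-∷ R Rs (pairs seen (R ∷ Rs)) (λ o O → e o * hits (cnt i R + seen) Rs O) (λ _ → pairs (cnt i R + seen) Rs) (λ _ _ → refl)) ⟩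
    2 * (L * L) * (∑< L (λ o → ∑ᵒ Rs (λ O → e o * hits (cnt i R + seen) Rs O)) + ∑< L (λ _ → p′)) + (t + t′) * (L * x)
      ≡⟨ cong₂ (λ u v → 2 * (L * L) * (u + v) + (t + t′) * (L * x))
           (trans (∑<-cong L (λ o → trans (∑-*ˡ (e o) (offsets Rs) _) (*-comm (e o) s′))) (∑<-*ˡ s′ L e)) (∑<-const L p′) ⟩
    2 * (L * L) * (s′ * t + L * p′) + (t + t′) * (L * x)
      ≡⟨ regroup L s′ t p′ t′ x ⟩
    2 * L * t * (L * s′) + L * (2 * (L * L) * p′ + t′ * x) + t * (L * x)
      ≤⟨ +-mono-≤ (+-mono-≤ (≤-reflexive (cong (2 * L * t *_) (∑-hits _ Rs))) (*-monoʳ-≤ L (∑-pairs _ Rs))) (*-monoˡ-≤ (L * x) (m≤m*m t)) ⟩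
    2 * L * t * (t′ * x) + L * (t′ * t′ * x) + t * t * (L * x)
      ≡⟨ collect L t t′ x ⟩
    (t + t′) * (t + t′) * (L * x) ∎
    where
    open ≤-Reasoning
    e : ℕ → ℕ
    e o = ⟦ hit i (early b) o seen R ⟧
    x  = X Rs
    t  = ∑< L e
    t′ = Tot (cnt i R + seen) Rs
    s′ = ∑ᵒ Rs (hits (cnt i R + seen) Rs)
    p′ = ∑ᵒ Rs (pairs (cnt i R + seen) Rs)
    m≤m*m : ∀ m → m ≤ m * m
    m≤m*m zero    = z≤n
    m≤m*m (suc m) = m≤m*n (suc m) (suc m)
    regroup : ∀ l s t p u x → 2 * (l * l) * (s * t + l * p) + (t + u) * (l * x) ≡
                              2 * l * t * (l * s) + l * (2 * (l * l) * p + u * x) + t * (l * x)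
    regroup = solve-∀
    collect : ∀ l t u x → 2 * l * t * (u * x) + l * (u * u * x) + t * t * (l * x) ≡ (t + u) * (t + u) * (l * x)
    collect = solve-∀

  costs : (Rs : Rows) → Vec ℕ (length Rs) → ℕ
  costs Rs O = length Rs * (3 * (U * U)) + 2 * (D * D * squares Rs O)

  -- A potential argument: `need` pays for the rows in which i falls behind later
  -- challengers, V + V² / 2U for those in which it cannot oust the champion.
  bad-bound : ∀ V Rs O → 2 * U * (D * bad V Rs O + need Rs O) ≤ 2 * U * V + V * V + costs Rs O
  bad-bound V []       []      = ≡≤-trans (trans (cong (λ z → 2 * U * (z + 0)) (*-zeroʳ D)) (*-zeroʳ (2 * U))) z≤n
  bad-bound V (R ∷ Rs) (o ∷ O) = begin
    2 * U * (D * (c + bd) + (U + (M ∸ D * h))) ≡⟨ regroup U D c bd (M ∸ D * h) ⟩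
    2 * U * ((D * c + (M ∸ D * h)) + U) + 2 * U * (D * bd)
      ≤⟨ +-monoˡ-≤ _ (*-monoʳ-≤ (2 * U) (+-monoˡ-≤ U below)) ⟩
    2 * U * (V + (a + v) + U) + 2 * U * (D * bd) ≡⟨ regroup′ U D V a v bd ⟩
    2 * U * (V + a + U) + 2 * U * (D * bd + v) ≤⟨ +-monoʳ-≤ _ (bad-bound V′ Rs O) ⟩
    2 * U * (V + a + U) + (2 * U * V′ + V′ * V′ + K) ≤⟨ +-monoʳ-≤ (2 * U * (V + a + U)) (+-monoˡ-≤ K potential) ⟩
    2 * U * (V + a + U) + (V * V + a * a + K) ≡⟨ expand U V a K ⟩
    2 * U * V + V * V + (2 * (U * a) + 2 * (U * U) + a * a + K)
      ≤⟨ +-monoʳ-≤ (2 * U * V + V * V) (+-monoˡ-≤ K (+-monoˡ-≤ (a * a) (+-monoˡ-≤ (2 * (U * U)) (am-gm U a)))) ⟩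
    2 * U * V + V * V + ((U * U + a * a) + 2 * (U * U) + a * a + K)
      ≡⟨ cong (2 * U * V + V * V +_) (collect U D (at G o R) (length Rs) (squares Rs O)) ⟩
    2 * U * V + V * V + costs (R ∷ Rs) (o ∷ O) ∎
    where
    open ≤-Reasoning
    h  = cnt i R
    a  = D * at G o R
    v  = need Rs O
    M  = a ⊔ v
    V′ = next V o R
    c  = badAt (V ⊔ v) R
    bd = bad V′ Rs O
    K  = costs Rs O
    -- Either the gain of i in this row covers `M`, and the bad positions are charged to `V` and the
    -- later need; or i falls short, and even `h` bad positions plus the shortfall amount only to
    -- `M`.
    below : D * c + (M ∸ D * h) ≤ V + (a + v)
    below with ≤-total M (D * h)
    ... | inj₁ M≤ rewrite m≤n⇒m∸n≡0 M≤ = ≡≤-trans (+-identityʳ _)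
                    (≤-trans (badAt-≤ (V ⊔ v) R) (≤-trans (m⊔n≤m+n V v) (+-monoʳ-≤ V (m≤n+m v a))))
    ... | inj₂ ≤M = ≤-trans (+-monoˡ-≤ (M ∸ D * h) (*-monoʳ-≤ D (badAt-≤-cnt (V ⊔ v) R)))
                   (≡≤-trans (m+[n∸m]≡n ≤M) (≤-trans (m⊔n≤m+n a v) (m≤n+m (a + v) V)))
    am-gm : ∀ x y → 2 * (x * y) ≤ x * x + y * y
    am-gm x y with ≤-total x y
    ... | inj₁ x≤y with m≤n⇒∃[o]m+o≡n x≤y
    ...   | d , refl = ≤≡-trans (m≤m+n _ (d * d)) (sq x d)
      where
      sq : ∀ x d → 2 * (x * (x + d)) + d * d ≡ x * x + (x + d) * (x + d)
      sq = solve-∀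
    am-gm x y | inj₂ y≤x with m≤n⇒∃[o]m+o≡n y≤x
    ...   | d , refl = ≤≡-trans (m≤m+n _ (d * d)) (sq y d)
      where
      sq : ∀ y d → 2 * ((y + d) * y) + d * d ≡ (y + d) * (y + d) + y * y
      sq = solve-∀
    -- Completing the square: with `U * U` added, the left side is the square of the larger of `V`
    -- and `a`.
    potential : 2 * U * V′ + V′ * V′ ≤ V * V + a * a
    potential with ≤-total (V ⊔ a) U
    ... | inj₁ ≤U rewrite m≤n⇒m∸n≡0 ≤U = ≡≤-trans (trans (+-identityʳ _) (*-zeroʳ (2 * U))) z≤n
    ... | inj₂ U≤ = begin
      2 * U * V′ + V′ * V′ ≤⟨ m≤m+n _ (U * U) ⟩
      2 * U * V′ + V′ * V′ + U * U ≡⟨ sq U V′ ⟩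
      (U + V′) * (U + V′) ≡⟨ cong (λ z → z * z) (m+[n∸m]≡n U≤) ⟩
      (V ⊔ a) * (V ⊔ a) ≤⟨ max-sq V a ⟩
      V * V + a * a ∎
      where
      sq : ∀ u v → 2 * u * v + v * v + u * u ≡ (u + v) * (u + v)
      sq = solve-∀
      max-sq : ∀ x y → (x ⊔ y) * (x ⊔ y) ≤ x * x + y * y
      max-sq x y with ⊔-sel x y
      ... | inj₁ e rewrite e = m≤m+n _ _
      ... | inj₂ e rewrite e = m≤n+m _ _
    regroup : ∀ u d c b m → 2 * u * (d * (c + b) + (u + m)) ≡ 2 * u * ((d * c + m) + u) + 2 * u * (d * b)
    regroup = solve-∀
    regroup′ : ∀ u d v a w b → 2 * u * (v + (a + w) + u) + 2 * u * (d * b) ≡ 2 * u * (v + a + u) + 2 * u * (d * b + w)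
    regroup′ = solve-∀
    expand : ∀ u v a k → 2 * u * (v + a + u) + (v * v + a * a + k) ≡
                         2 * u * v + v * v + (2 * (u * a) + 2 * (u * u) + a * a + k)
    expand = solve-∀
    collect : ∀ u d g l s → (u * u + (d * g) * (d * g)) + 2 * (u * u) + (d * g) * (d * g) + (l * (3 * (u * u)) + 2 * (d * d * s)) ≡
                            (1 + l) * (3 * (u * u)) + 2 * (d * d * (g * g + s))
    collect = solve-∀

  ∑-at : ∀ R l (F : Fin n → ℕ) → ∑< l (λ o → at F o R) ≤ ∑ R F
  ∑-at R        zero    F = z≤n
  ∑-at []       (suc l) F = ∑-at [] l F
  ∑-at (x ∷ xs) (suc l) F = +-monoʳ-≤ (F x) (∑-at xs l F)

  at-square : ∀ o R → at G o R * at G o R ≡ at (λ p → G p * G p) o R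
  at-square o       []       = refl
  at-square zero    (x ∷ xs) = refl
  at-square (suc o) (x ∷ xs) = at-square o xs

  -- Each position is picked with probability `1 / L`. The sum over positions meets z once per
  -- occurrence, which raises the square to a cubic moment.
  ∑-squares : ∀ Rs → L * ∑ᵒ Rs (squares Rs) ≤ X Rs * ∑ (concat Rs) (λ p → G p * G p)
  ∑-squares []       = ≡≤-trans (*-zeroʳ L) z≤n
  ∑-squares (R ∷ Rs) = begin
    L * ∑ᵒ (R ∷ Rs) (squares (R ∷ Rs))
      ≡⟨ cong (L *_) (∑ᵒ-∷ R Rs (squares (R ∷ Rs)) (λ o _ → e o) (λ _ → squares Rs) (λ _ _ → refl)) ⟩
    L * (∑< L (λ o → ∑ᵒ Rs (λ _ → e o)) + ∑< L (λ _ → s′))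
      ≡⟨ cong₂ (λ u v → L * (u + v)) (trans (∑<-cong L (λ o → ∑-offsets-const L (length Rs) (e o))) (∑<-*ˡ (X Rs) L e)) (∑<-const L s′) ⟩
    L * (X Rs * ∑< L e + L * s′)
      ≤⟨ *-monoʳ-≤ L (+-mono-≤ (*-monoʳ-≤ (X Rs) (≡≤-trans (∑<-cong L (λ o → at-square o R)) (∑-at R L _))) (∑-squares Rs)) ⟩
    L * (X Rs * ∑ R G² + X Rs * ∑ (concat Rs) G²)
      ≡⟨ collect L (X Rs) _ _ ⟩
    L * X Rs * (∑ R G² + ∑ (concat Rs) G²)
      ≡⟨ cong (L * X Rs *_) (sym (∑-++ R (concat Rs) G²)) ⟩
    X (R ∷ Rs) * ∑ (concat (R ∷ Rs)) G² ∎
    where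
    open ≤-Reasoning
    G² : Fin n → ℕ
    G² p = G p * G p
    e : ℕ → ℕ
    e o = at G o R * at G o R
    s′ = ∑ᵒ Rs (squares Rs)
    collect : ∀ l x a b → l * (x * a + x * b) ≡ l * x * (a + b)
    collect = solve-∀

module _ (i : Fin n) (G : Fin n → ℕ) (b D U L : ℕ) where
  open Window i G b D U
  open Offsets i G b D U L

  bad-single : ∀ Rs → 1 ≤ D → length Rs ≤ 1 → ∑ᵒ Rs (bad 0 Rs) ≡ 0
  bad-single Rs 1≤D short =
    trans (∑-cong (offsets Rs) (go Rs short)) (trans (∑-const (offsets Rs) 0) (*-zeroʳ (length (offsets Rs))))
    where
    go : ∀ Rs → length Rs ≤ 1 → ∀ O → bad 0 Rs O ≡ 0
    go []       short []       = refl
    go (R ∷ []) short (o ∷ []) =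
      trans (+-identityʳ _) (n≤0⇒n≡0 (*-cancelˡ-≤ D {{>-nonZero 1≤D}} (≤-trans (badAt-≤ 0 R) z≤n)))
    go (R ∷ R′ ∷ Rs) (s≤s ()) O

  -- Measured in units of `H / L`, the bad positions cost at most 1/8 in expectation and the pairs
  -- at most 1/4; the remaining 5/8 is rounded down to 1/2.
  ∑-success : ∀ H seen Rs → 1 ≤ L → Tot seen Rs ≡ H → 2 * H ≤ L + 2 →
              8 * ∑ᵒ Rs (bad 0 Rs) ≤ H * X Rs →
              H * X Rs ≤ 2 * L * ∑ᵒ Rs (λ O → ⟦ success 0 seen Rs O ⟧)
  ∑-success H seen Rs 1≤L refl 2H≤ few = *-cancelˡ-≤ 4 (begin
    4 * (H * x) ≤⟨ +-cancelʳ-≤ (4 * (H * x)) _ _ (begin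
      4 * (H * x) + 4 * (H * x) ≡⟨ double (H * x) ⟩
      8 * (H * x) ≤⟨ *-monoʳ-≤ 8 (∑-goods 0 seen Rs) ⟩
      8 * (L * ∑ᵒ Rs (goods 0 seen Rs) + B) ≤⟨ *-monoʳ-≤ 8 (+-monoˡ-≤ B (*-monoʳ-≤ L goods≤)) ⟩
      8 * (L * (S + p) + B) ≡⟨ expand L S p B ⟩
      8 * (L * S) + 2 * (4 * (L * p)) + 8 * B ≤⟨ +-mono-≤ (+-monoʳ-≤ (8 * (L * S)) (*-monoʳ-≤ 2 pairs≤)) few ⟩
      8 * (L * S) + 2 * (H * x) + H * x ≤⟨ m≤m+n _ (H * x) ⟩
      8 * (L * S) + 2 * (H * x) + H * x + H * x ≡⟨ collect (L * S) (H * x) ⟩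
      8 * (L * S) + 4 * (H * x) ∎) ⟩
    8 * (L * S) ≡⟨ rescale L S ⟩
    4 * (2 * L * S) ∎)
    where
    open ≤-Reasoning
    x = X Rs
    S = ∑ᵒ Rs (λ O → ⟦ success 0 seen Rs O ⟧)
    p = ∑ᵒ Rs (pairs seen Rs)
    B = ∑ᵒ Rs (bad 0 Rs)
    goods≤ : ∑ᵒ Rs (goods 0 seen Rs) ≤ S + p
    goods≤ = ≤≡-trans (∑-mono (offsets Rs) (goods-≤ 0 seen Rs)) (∑-+ (offsets Rs) _ _)
    pairs≤ : 4 * (L * p) ≤ H * x
    pairs≤ = *-cancelˡ-≤ L {{>-nonZero 1≤L}} (+-cancelʳ-≤ (2 * (H * x)) _ _ (begin
      L * (4 * (L * p)) + 2 * (H * x) ≡⟨ e₁ L p (H * x) ⟩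
      2 * (2 * (L * L) * p + H * x) ≤⟨ *-monoʳ-≤ 2 (∑-pairs seen Rs) ⟩
      2 * (H * H * x) ≡⟨ e₂ H x ⟩
      2 * H * (H * x) ≤⟨ *-monoˡ-≤ (H * x) 2H≤ ⟩
      (L + 2) * (H * x) ≡⟨ *-distribʳ-+ (H * x) L 2 ⟩
      L * (H * x) + 2 * (H * x) ∎))
      where
      e₁ : ∀ l p y → l * (4 * (l * p)) + 2 * y ≡ 2 * (2 * (l * l) * p + y)
      e₁ = solve-∀
      e₂ : ∀ h x → 2 * (h * h * x) ≡ 2 * h * (h * x)
      e₂ = solve-∀
    double : ∀ y → 4 * y + 4 * y ≡ 8 * y
    double = solve-∀
    expand : ∀ l s p b → 8 * (l * (s + p) + b) ≡ 8 * (l * s) + 2 * (4 * (l * p)) + 8 * b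
    expand = solve-∀
    collect : ∀ s y → 8 * s + 2 * y + y + y ≡ 8 * s + 4 * y
    collect = solve-∀
    rescale : ∀ l s → 8 * (l * s) ≡ 4 * (2 * l * s)
    rescale = solve-∀

module _ (i : Fin n) (G : Fin n → ℕ) (b P H L : ℕ) where
  open Window i G b (16 * P) H
  open Offsets i G b (16 * P) H L

  -- With `D = 16 * P` and `U = H`, the penalties of all P rows together are worth `H / 16`
  -- occurrences. In `bad-bound` they contribute `3 * P * H ^ 2`, while `spread` limits the squares
  -- to `P * H ^ 2`; the sum is exactly what the claim allows.
  bad-few : ∀ Rs → 1 ≤ L → 1 ≤ H → 1 ≤ P → length Rs ≤ P →
            (32 * P) * (32 * P) * ∑ (concat Rs) (λ p → G p * G p) ≤ 2 * (H * H) * (P * L) →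
            8 * ∑ᵒ Rs (bad 0 Rs) ≤ H * X Rs
  bad-few Rs 1≤L 1≤H 1≤P rows≤ spread = *-cancelˡ-≤ (4 * (H * P * L)) {{>-nonZero 4HPL>0}} (begin
    4 * (H * P * L) * (8 * B) ≡⟨ e₁ H P L B ⟩
    L * (2 * H * (16 * P * B)) ≤⟨ *-monoʳ-≤ L summed ⟩
    L * (x * (P * (3 * (H * H))) + 2 * (16 * P * (16 * P) * S))
      ≡⟨ e₂ L x P H S ⟩
    3 * (H * H) * P * L * x + 2 * (16 * P * (16 * P)) * (L * S)
      ≤⟨ +-monoʳ-≤ (3 * (H * H) * P * L * x) (*-monoʳ-≤ (2 * (16 * P * (16 * P))) (∑-squares Rs)) ⟩
    3 * (H * H) * P * L * x + 2 * (16 * P * (16 * P)) * (x * Q)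
      ≤⟨ +-monoʳ-≤ (3 * (H * H) * P * L * x) half ⟩
    3 * (H * H) * P * L * x + H * H * (P * L) * x
      ≡⟨ e₃ H P L x ⟩
    4 * (H * P * L) * (H * x) ∎)
    where
    open ≤-Reasoning
    x = X Rs
    B = ∑ᵒ Rs (bad 0 Rs)
    S = ∑ᵒ Rs (squares Rs)
    Q = ∑ (concat Rs) (λ p → G p * G p)
    4HPL>0 : 0 < 4 * (H * P * L)
    4HPL>0 = *-mono-≤ {1} {4} (s≤s z≤n) (*-mono-≤ (*-mono-≤ 1≤H 1≤P) 1≤L)
    summed : 2 * H * (16 * P * B) ≤ x * (P * (3 * (H * H))) + 2 * (16 * P * (16 * P) * S)
    summed = begin
      2 * H * (16 * P * B) ≡⟨ sym (*-assoc (2 * H) (16 * P) B) ⟩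
      2 * H * (16 * P) * B ≡⟨ sym (∑-*ˡ (2 * H * (16 * P)) (offsets Rs) (bad 0 Rs)) ⟩
      ∑ᵒ Rs (λ O → 2 * H * (16 * P) * bad 0 Rs O) ≤⟨ ∑-mono (offsets Rs) pointwise ⟩
      ∑ᵒ Rs (λ O → P * (3 * (H * H)) + 2 * (16 * P * (16 * P)) * squares Rs O)
        ≡⟨ ∑-+ (offsets Rs) _ _ ⟩
      ∑ᵒ Rs (λ _ → P * (3 * (H * H))) + ∑ᵒ Rs (λ O → 2 * (16 * P * (16 * P)) * squares Rs O)
        ≡⟨ cong₂ _+_ (∑-offsets-const L (length Rs) _) (∑-*ˡ (2 * (16 * P * (16 * P))) (offsets Rs) (squares Rs)) ⟩
      x * (P * (3 * (H * H))) + 2 * (16 * P * (16 * P)) * S ≡⟨ cong (x * (P * (3 * (H * H))) +_) (*-assoc 2 (16 * P * (16 * P)) S) ⟩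
      x * (P * (3 * (H * H))) + 2 * (16 * P * (16 * P) * S) ∎
      where
      pointwise : ∀ O → 2 * H * (16 * P) * bad 0 Rs O ≤ P * (3 * (H * H)) + 2 * (16 * P * (16 * P)) * squares Rs O
      pointwise O = begin
        2 * H * (16 * P) * bad 0 Rs O ≡⟨ *-assoc (2 * H) (16 * P) (bad 0 Rs O) ⟩
        2 * H * (16 * P * bad 0 Rs O) ≤⟨ *-monoʳ-≤ (2 * H) (m≤m+n _ (need Rs O)) ⟩
        2 * H * (16 * P * bad 0 Rs O + need Rs O) ≤⟨ bad-bound 0 Rs O ⟩
        2 * H * 0 + 0 + costs Rs O ≡⟨ cong (λ z → z + 0 + costs Rs O) (*-zeroʳ (2 * H)) ⟩
        length Rs * (3 * (H * H)) + 2 * (16 * P * (16 * P) * squares Rs O)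
          ≤⟨ +-mono-≤ (*-monoˡ-≤ (3 * (H * H)) rows≤) (≤-reflexive (sym (*-assoc 2 (16 * P * (16 * P)) (squares Rs O)))) ⟩
        P * (3 * (H * H)) + 2 * (16 * P * (16 * P)) * squares Rs O ∎
    half : 2 * (16 * P * (16 * P)) * (x * Q) ≤ H * H * (P * L) * x
    half = *-cancelˡ-≤ 2 (begin
      2 * (2 * (16 * P * (16 * P)) * (x * Q)) ≡⟨ e₄ P x Q ⟩
      (32 * P) * (32 * P) * Q * x ≤⟨ *-monoˡ-≤ x spread ⟩
      2 * (H * H) * (P * L) * x ≡⟨ e₅ H P L x ⟩
      2 * (H * H * (P * L) * x) ∎)
      where
      e₄ : ∀ p x q → 2 * (2 * (16 * p * (16 * p)) * (x * q)) ≡ (32 * p) * (32 * p) * q * x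
      e₄ = solve-∀
      e₅ : ∀ h p l x → 2 * (h * h) * (p * l) * x ≡ 2 * (h * h * (p * l) * x)
      e₅ = solve-∀
    e₁ : ∀ h p l b → 4 * (h * p * l) * (8 * b) ≡ l * (2 * h * (16 * p * b))
    e₁ = solve-∀
    e₂ : ∀ l x p h s → l * (x * (p * (3 * (h * h))) + 2 * (16 * p * (16 * p) * s)) ≡
                       3 * (h * h) * p * l * x + 2 * (16 * p * (16 * p)) * (l * s)
    e₂ = solve-∀
    e₃ : ∀ h p l x → 3 * (h * h) * p * l * x + h * h * (p * l) * x ≡ 4 * (h * p * l) * (h * x)
    e₃ = solve-∀

-- Moments of the stream

-- Interpolation of moments: on the left, the smaller of `H` and `y` may be replaced by the larger.
square-split : ∀ H y k → y * y * H ^ k ≤ H ^ (2 + k) + y ^ (2 + k)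
square-split H y k with ≤-total y H
... | inj₁ y≤H = begin
  y * y * H ^ k ≤⟨ *-monoˡ-≤ (H ^ k) (*-mono-≤ y≤H y≤H) ⟩
  H * H * H ^ k ≡⟨ *-assoc H H (H ^ k) ⟩
  H ^ (2 + k) ≤⟨ m≤m+n _ _ ⟩
  H ^ (2 + k) + y ^ (2 + k) ∎
  where open ≤-Reasoning
... | inj₂ H≤y = begin
  y * y * H ^ k ≤⟨ *-monoʳ-≤ (y * y) (^-monoˡ-≤ k H≤y) ⟩
  y * y * y ^ k ≡⟨ *-assoc y y (y ^ k) ⟩
  y ^ (2 + k) ≤⟨ m≤n+m _ _ ⟩
  H ^ (2 + k) + y ^ (2 + k) ∎
  where open ≤-Reasoning

-- The potential asks for squares, heaviness controls the moment of order `2 + k`. Comparing every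
-- `W * G p` with `H` links the two at the price of a factor 2.
∑-squares-bound : ∀ (xs : List (Fin n)) (G : Fin n → ℕ) k W H τ → 1 ≤ H → length xs ≤ τ →
                  W ^ (2 + k) * ∑ xs (λ p → G p ^ (2 + k)) ≤ H ^ (2 + k) * τ →
                  W * W * ∑ xs (λ p → G p * G p) ≤ 2 * (H * H) * τ
∑-squares-bound xs G k W H τ 1≤H len moment = *-cancelʳ-≤ _ _ (H ^ k) {{m^n≢0 H k {{>-nonZero 1≤H}}}} (begin
  W * W * ∑ xs (λ p → G p * G p) * H ^ k ≡⟨ cong (_* H ^ k) (sym (∑-*ˡ (W * W) xs _)) ⟩
  ∑ xs (λ p → W * W * (G p * G p)) * H ^ k ≡⟨ sym (∑-*ʳ xs _ (H ^ k)) ⟩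
  ∑ xs (λ p → W * W * (G p * G p) * H ^ k) ≤⟨ ∑-mono xs (λ p → ≡≤-trans (cong (_* H ^ k) (shuffle W (G p))) (square-split H (W * G p) k)) ⟩
  ∑ xs (λ p → H ^ (2 + k) + (W * G p) ^ (2 + k)) ≡⟨ ∑-+ xs _ _ ⟩
  ∑ xs (λ _ → H ^ (2 + k)) + ∑ xs (λ p → (W * G p) ^ (2 + k))
    ≡⟨ cong₂ _+_ (∑-const xs _) (trans (∑-cong xs (λ p → *-^ W (G p) (2 + k))) (∑-*ˡ (W ^ (2 + k)) xs _)) ⟩
  length xs * H ^ (2 + k) + W ^ (2 + k) * ∑ xs (λ p → G p ^ (2 + k))
    ≤⟨ +-mono-≤ (*-monoˡ-≤ (H ^ (2 + k)) len) moment ⟩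
  τ * H ^ (2 + k) + H ^ (2 + k) * τ ≡⟨ collect τ H (H ^ k) ⟩
  2 * (H * H) * τ * H ^ k ∎)
  where
  open ≤-Reasoning
  shuffle : ∀ w g → w * w * (g * g) ≡ w * g * (w * g)
  shuffle = solve-∀
  collect : ∀ t h x → t * (h * (h * x)) + h * (h * x) * t ≡ 2 * (h * h) * t * x
  collect = solve-∀

∑-tabulate : ∀ {m k} (g : Fin m → Fin k) (H : Fin k → ℕ) → ∑ (List.tabulate g) H ≡ ∑ (allFin m) (H ∘ g)
∑-tabulate {m} g H = trans (cong (λ l → ∑ l H) (sym (map-tabulate id g))) (∑-map g (allFin m) H)

∑-point : ∀ {m} (x : Fin m) (F : Fin m → ℕ) → ∑ (allFin m) (λ z → ⟦ does (x Fin.≟ z) ⟧ * F z) ≡ F x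
∑-point {suc m} Fin.zero F = trans (cong (F Fin.zero + 0 +_) (trans (∑-tabulate Fin.suc (λ z → ⟦ does (Fin.zero Fin.≟ z) ⟧ * F z))
  (trans (∑-const (allFin m) 0) (*-zeroʳ (length (allFin m)))))) (trans (+-identityʳ _) (+-identityʳ _))
∑-point {suc m} (Fin.suc x) F = trans (∑-tabulate Fin.suc (λ z → ⟦ does (Fin.suc x Fin.≟ z) ⟧ * F z)) (∑-point x (F ∘ Fin.suc))

∑-cnt : ∀ (xs : List (Fin n)) (F : Fin n → ℕ) → ∑ xs F ≡ ∑ (allFin n) (λ z → cnt z xs * F z)
∑-cnt {n} []       F = sym (trans (∑-const (allFin n) 0) (*-zeroʳ (length (allFin n))))
∑-cnt {n} (x ∷ xs) F = sym (begin
  ∑ (allFin n) (λ z → (⟦ does (x Fin.≟ z) ⟧ + cnt z xs) * F z)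
    ≡⟨ ∑-cong (allFin n) (λ z → *-distribʳ-+ (F z) ⟦ does (x Fin.≟ z) ⟧ (cnt z xs)) ⟩
  ∑ (allFin n) (λ z → ⟦ does (x Fin.≟ z) ⟧ * F z + cnt z xs * F z)
    ≡⟨ ∑-+ (allFin n) _ _ ⟩
  ∑ (allFin n) (λ z → ⟦ does (x Fin.≟ z) ⟧ * F z) + ∑ (allFin n) (λ z → cnt z xs * F z)
    ≡⟨ cong₂ _+_ (∑-point x F) (sym (∑-cnt xs F)) ⟩
  F x + ∑ xs F ∎)
  where
  open ≡-Reasoning

-- Coins of a slot

-- At the start of a row of 2 ^ a elements, contest and draw the next position.
data Instr : Set where
  go  : Instr
  row : (fresh : Bool) (a D U : ℕ) → Instr

empty : Fin n → Slot n
empty i₀ = slot i₀ 0 0 i₀ 0 0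

module Chance (i₀ : Fin n) (A : ℕ) where

  step : Instr → Vec Bool A → Fin n → Slot n → Slot n
  step go                c p s = tick p s
  step (row fresh a D U) c p s = tick p (start (fromBits a c) (contest D U (if fresh then empty i₀ else s)))

  -- 2 ^ (A * length xs) times the expectation of φ after the run on xs from time t.
  W : (ℕ → Instr) → ℕ → List (Fin n) → (Slot n → ℕ) → Slot n → ℕ
  W σ t []       φ s = φ s
  W σ t (p ∷ xs) φ s = ∑ (bitBlocks A) (λ c → W σ (suc t) xs φ (step (σ t) c p s))

  β : ℕ
  β = 2 ^ A

  ∑-bitBlocks-const : ∀ c → ∑ (bitBlocks A) (λ _ → c) ≡ β * c
  ∑-bitBlocks-const c =
    trans (∑-const (bitBlocks A) c) (cong (_* c) (length-vectors (true ∷ false ∷ []) A))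

  W-++ : ∀ σ t xs ys φ s → W σ t (xs ++ ys) φ s ≡ W σ t xs (W σ (length xs + t) ys φ) s
  W-++ σ t []       ys φ s = refl
  W-++ σ t (p ∷ xs) ys φ s = ∑-cong (bitBlocks A) λ c →
    trans (W-++ σ (suc t) xs ys φ _)
          (cong (λ u → W σ (suc t) xs (W σ u ys φ) (step (σ t) c p s)) (+-suc (length xs) t))

  W-≥ : ∀ σ t xs {φ} {c} s → (∀ s → c ≤ φ s) → β ^ length xs * c ≤ W σ t xs φ s
  W-≥ σ t []       {φ} {c} s le = ≡≤-trans (+-identityʳ c) (le s)
  W-≥ σ t (p ∷ xs) {φ} {c} s le = begin
    β * β ^ length xs * c ≡⟨ *-assoc β _ c ⟩
    β * (β ^ length xs * c) ≡⟨ sym (∑-bitBlocks-const _) ⟩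
    ∑ (bitBlocks A) (λ _ → β ^ length xs * c) ≤⟨ ∑-mono (bitBlocks A) (λ c → W-≥ σ (suc t) xs _ le) ⟩
    W σ t (p ∷ xs) φ s ∎
    where open ≤-Reasoning

  W-+ : ∀ σ t xs (φ ψ : Slot n → ℕ) s → W σ t xs φ s + W σ t xs ψ s ≡ W σ t xs (λ s → φ s + ψ s) s
  W-+ σ t []       φ ψ s = refl
  W-+ σ t (p ∷ xs) φ ψ s = trans (sym (∑-+ (bitBlocks A) _ _)) (∑-cong (bitBlocks A) λ c → W-+ σ (suc t) xs φ ψ _)

  W-one : ∀ σ t xs {φ : Slot n → ℕ} s → (∀ s → φ s ≡ 1) → W σ t xs φ s ≡ β ^ length xs
  W-one σ t []       s one = one s
  W-one σ t (p ∷ xs) s one = trans (∑-cong (bitBlocks A) (λ c → W-one σ (suc t) xs _ one)) (∑-bitBlocks-const _)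

  GoOn : (ℕ → Instr) → ℕ → ℕ → Set
  GoOn σ t zero    = ⊤
  GoOn σ t (suc l) = σ t ≡ go × GoOn σ (suc t) l

  W-go : ∀ σ t xs φ s → GoOn σ t (length xs) → W σ t xs φ s ≡ β ^ length xs * φ (ticks xs s)
  W-go σ t []       φ s _        = sym (+-identityʳ _)
  W-go σ t (p ∷ xs) φ s (eq , g) rewrite eq =
    trans (∑-cong (bitBlocks A) (λ c → W-go σ (suc t) xs φ (tick p s) g))
          (trans (∑-bitBlocks-const _) (sym (*-assoc β _ _)))

  data RowsAt (σ : ℕ → Instr) (a D U : ℕ) : ℕ → Bool → List (List (Fin n)) → Set where
    []  : ∀ {t fresh} → RowsAt σ a D U t fresh []
    _∷_ : ∀ {t fresh p R Rs} → σ t ≡ row fresh a D U × GoOn σ (suc t) (length R) →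
          RowsAt σ a D U (length R + suc t) false Rs → RowsAt σ a D U t fresh ((p ∷ R) ∷ Rs)

  module _ (i : Fin n) (G : Fin n → ℕ) (b D U : ℕ) (σ : ℕ → Instr) (a : ℕ) (a≤A : a ≤ A) where
    open Window i G b D U
    open Offsets i G b D U (2 ^ a)

    reset : Bool → Slot n → Slot n
    reset fresh s = if fresh then empty i₀ else s

    W-row : ∀ t fresh p R φ s → σ t ≡ row fresh a D U → GoOn σ (suc t) (length R) →
            2 ^ a * W σ t (p ∷ R) φ s ≡
            β ^ length (p ∷ R) * ∑< (2 ^ a) (λ o → φ (rowRun o (p ∷ R) (contest D U (reset fresh s))))
    W-row t fresh p R φ s eq g rewrite eq = begin
      2 ^ a * ∑ (bitBlocks A) (λ c → W σ (suc t) R φ (tick p (start (fromBits a c) S)))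
        ≡⟨ cong (2 ^ a *_) (∑-cong (bitBlocks A) (λ c → W-go σ (suc t) R φ _ g)) ⟩
      2 ^ a * ∑ (bitBlocks A) (λ c → β ^ length R * F (fromBits a c))
        ≡⟨ cong (2 ^ a *_) (∑-*ˡ (β ^ length R) (bitBlocks A) _) ⟩
      2 ^ a * (β ^ length R * ∑ (bitBlocks A) (F ∘ fromBits a))
        ≡⟨ swap (2 ^ a) (β ^ length R) _ ⟩
      β ^ length R * (2 ^ a * ∑ (bitBlocks A) (F ∘ fromBits a))
        ≡⟨ cong (β ^ length R *_) (∑-fromBits a≤A F) ⟩
      β ^ length R * (β * ∑< (2 ^ a) F)
        ≡⟨ swap′ (β ^ length R) β _ ⟩
      β * β ^ length R * ∑< (2 ^ a) F ∎
      where
      open ≡-Reasoning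
      S = contest D U (reset fresh s)
      F : ℕ → ℕ
      F o = φ (rowRun o (p ∷ R) S)
      swap : ∀ x y z → x * (y * z) ≡ y * (x * z)
      swap = solve-∀
      swap′ : ∀ x y z → x * (y * z) ≡ y * x * z
      swap′ = solve-∀

    -- Only the coins at the first element of a row influence the slot, and they encode a uniform
    -- offset. So the average over coins becomes an average over offset vectors.
    W-rows : ∀ {t fresh} Rs φ s → RowsAt σ a D U t fresh Rs →
             X Rs * W σ t (concat Rs) φ s ≡
             β ^ length (concat Rs) * ∑ᵒ Rs (λ O → φ (rowsRun Rs O (if List.null Rs then s else reset fresh s)))
    W-rows []             φ s []             = cong (_+ 0) (sym (+-identityʳ (φ s)))
    W-rows {t} {fresh} ((p ∷ R) ∷ Rs) φ s ((eq , g) ∷ rows) = begin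
      2 ^ a * X Rs * W σ t ((p ∷ R) ++ concat Rs) φ s
        ≡⟨ cong (2 ^ a * X Rs *_) (W-++ σ t (p ∷ R) (concat Rs) φ s) ⟩
      2 ^ a * X Rs * W σ t (p ∷ R) ψ s
        ≡⟨ swap (2 ^ a) (X Rs) _ ⟩
      X Rs * (2 ^ a * W σ t (p ∷ R) ψ s)
        ≡⟨ cong (X Rs *_) (W-row t fresh p R ψ s eq g) ⟩
      X Rs * (β ^ length (p ∷ R) * ∑< (2 ^ a) (λ o → ψ (S o)))
        ≡⟨ swap′ (X Rs) (β ^ length (p ∷ R)) _ ⟩
      β ^ length (p ∷ R) * (X Rs * ∑< (2 ^ a) (λ o → ψ (S o)))
        ≡⟨ cong (β ^ length (p ∷ R) *_) (sym (∑<-*ˡ (X Rs) (2 ^ a) _)) ⟩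
      β ^ length (p ∷ R) * ∑< (2 ^ a) (λ o → X Rs * ψ (S o))
        ≡⟨ cong (β ^ length (p ∷ R) *_) (∑<-cong (2 ^ a) later) ⟩
      β ^ length (p ∷ R) * ∑< (2 ^ a) (λ o → β ^ length (concat Rs) * ∑ᵒ Rs (λ O → φ (rowsRun Rs O (S o))))
        ≡⟨ cong (β ^ length (p ∷ R) *_) (∑<-*ˡ (β ^ length (concat Rs)) (2 ^ a) _) ⟩
      β ^ length (p ∷ R) * (β ^ length (concat Rs) * ∑< (2 ^ a) (λ o → ∑ᵒ Rs (λ O → φ (rowsRun Rs O (S o)))))
        ≡⟨ sym (*-assoc (β ^ length (p ∷ R)) _ _) ⟩
      β ^ length (p ∷ R) * β ^ length (concat Rs) * ∑< (2 ^ a) (λ o → ∑ᵒ Rs (λ O → φ (rowsRun Rs O (S o))))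
        ≡⟨ cong₂ _*_ (sym (trans (cong (β ^_) (length-++ (p ∷ R))) (^-distribˡ-+-* β (length (p ∷ R)) _)))
                     (sym (∑-offsets-suc (2 ^ a) (length Rs) _)) ⟩
      β ^ length (concat ((p ∷ R) ∷ Rs)) * ∑ᵒ ((p ∷ R) ∷ Rs) (λ O → φ (rowsRun ((p ∷ R) ∷ Rs) O (reset fresh s))) ∎
      where
      open ≡-Reasoning
      ψ : Slot n → ℕ
      ψ = W σ (length (p ∷ R) + t) (concat Rs) φ
      S : ℕ → Slot n
      S o = rowRun o (p ∷ R) (contest D U (reset fresh s))
      unreset : ∀ {b} {s : Slot n} → (if b then s else s) ≡ s
      unreset {true}  = refl
      unreset {false} = refl
      later : ∀ o → X Rs * ψ (S o) ≡ β ^ length (concat Rs) * ∑ᵒ Rs (λ O → φ (rowsRun Rs O (S o)))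
      later o = trans (cong (λ u → X Rs * W σ u (concat Rs) φ (S o)) (sym (+-suc (length R) t)))
               (trans (W-rows Rs φ (S o) rows)
                      (cong (β ^ length (concat Rs) *_) (∑-cong (offsets Rs) (λ O → cong (λ s → φ (rowsRun Rs O s)) unreset))))
      swap : ∀ x y z → x * y * z ≡ y * (x * z)
      swap = solve-∀
      swap′ : ∀ x y z → x * (y * z) ≡ y * (x * z)
      swap′ = solve-∀

    bump-found : ∀ p c {seen} → 1 ≤ c → seen ≤ c + b →
                 1 ≤ bump i p c × ⟦ does (p Fin.≟ i) ⟧ + seen ≤ bump i p c + b
    bump-found p (suc c) 1≤c le = ≤-trans 1≤c (m≤n+m (suc c) δ) , ≤≡-trans (+-monoʳ-≤ δ le) (sym (+-assoc δ (suc c) b))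
      where
      δ = ⟦ does (p Fin.≟ i) ⟧

    tick-found : ∀ p seen s → Found seen s → Found (⟦ does (p Fin.≟ i) ⟧ + seen) (tick p s)
    tick-found p seen (slot y c α z d zero)          (inj₁ (refl , 1≤c , le))        = inj₁ (refl , bump-found p c 1≤c le)
    tick-found p seen (slot y c α z d (suc zero))    (inj₁ (refl , 1≤c , le))        = inj₁ (refl , bump-found p c 1≤c le)
    tick-found p seen (slot y c α z d (suc (suc w))) (inj₁ (refl , 1≤c , le))        = inj₁ (refl , bump-found p c 1≤c le)
    tick-found p seen (slot y c α z d zero)          (inj₂ (refl , refl , 1≤d , le)) = inj₂ (refl , refl , bump-found p d 1≤d le)

    ticks-found : ∀ xs seen s → Found seen s → Found (cnt i xs + seen) (ticks xs s)
    ticks-found []       seen s found = found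
    ticks-found (p ∷ xs) seen s found =
      subst (λ x → Found x (ticks (p ∷ xs) s)) (+-swap (cnt i xs) ⟦ does (p Fin.≟ i) ⟧ seen)
        (ticks-found xs _ (tick p s) (tick-found p seen s found))

    -- The first row of the window is fresh, so the bound holds from every state and hence whatever
    -- the coins of `pre` did. In `post` the slot only counts, which preserves `Found`.
    W-found : ∀ pre Rs post φ s N H → 1 ≤ H → length Rs ≢ 0 →
              (∀ s → Found (cnt i post + (cnt i (concat Rs) + cnt i pre)) s → φ s ≡ 1) →
              Dominates Rs → 1 ≤ D →
              RowsAt σ a D U (length pre) true Rs →
              GoOn σ (length (concat Rs) + length pre) (length post) →
              H * X Rs ≤ 2 * 2 ^ a * ∑ᵒ Rs (λ O → ⟦ success 0 (cnt i pre) Rs O ⟧) →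
              2 * 2 ^ a ≤ N * H →
              β ^ length (pre ++ concat Rs ++ post) ≤ N * W σ 0 (pre ++ concat Rs ++ post) φ s
    W-found pre [] post φ s N H 1≤H ne = ⊥-elim (ne refl)
    W-found pre Rs@(_ ∷ _) post φ s N H 1≤H ne φ-one dom 1≤D rowsAt goOn succ≥ N≥ = begin
      β ^ length (pre ++ win ++ post) ≡⟨ cong (β ^_) (length-++ pre) ⟩
      β ^ (length pre + length (win ++ post)) ≡⟨ ^-distribˡ-+-* β (length pre) _ ⟩
      β ^ length pre * B ≤⟨ W-≥ σ 0 pre {c = B} s (λ s′ → main s′) ⟩
      W σ 0 pre (λ s′ → N * W σ (length pre) (win ++ post) φ s′) s
        ≡⟨ W-*ˡ σ 0 pre N s ⟩
      N * W σ 0 pre (W σ (length pre) (win ++ post) φ) s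
        ≡⟨ cong (λ u → N * W σ 0 pre (W σ u (win ++ post) φ) s) (sym (+-identityʳ (length pre))) ⟩
      N * W σ 0 pre (W σ (length pre + 0) (win ++ post) φ) s
        ≡⟨ cong (N *_) (sym (W-++ σ 0 pre (win ++ post) φ s)) ⟩
      N * W σ 0 (pre ++ win ++ post) φ s ∎
      where
      open ≤-Reasoning
      win = concat Rs
      B = β ^ length (win ++ post)
      Sc = ∑ᵒ Rs (λ O → ⟦ success 0 (cnt i pre) Rs O ⟧)
      W-*ˡ : ∀ σ t xs c {φ : Slot n → ℕ} s → W σ t xs (λ s → c * φ s) s ≡ c * W σ t xs φ s
      W-*ˡ σ t []       c s = refl
      W-*ˡ σ t (p ∷ xs) c s = trans (∑-cong (bitBlocks A) (λ _ → W-*ˡ σ (suc t) xs c _)) (∑-*ˡ c (bitBlocks A) _)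
      -- The contest at the first row is between two empty registers; the score is 0 in either case,
      -- so the bound can start at `V = 0`.
      initially : Bounded 0 Rs (contest D U (empty i₀))
      initially with D * 0 <? D * 0 + U * 1
      ... | yes _ = inj₁ refl
      ... | no  _ = inj₁ refl
      wins : ∀ O → β ^ length post * ⟦ success 0 (cnt i pre) Rs O ⟧ ≤
                   W σ (length win + length pre) post φ (rowsRun Rs O (empty i₀))
      wins O with success 0 (cnt i pre) Rs O in eq
      ... | false = ≡≤-trans (*-zeroʳ (β ^ length post)) z≤n
      ... | true  = ≤-reflexive (sym (trans (W-go σ _ post φ _ goOn)
                      (cong (β ^ length post *_) (φ-one _ (ticks-found post _ _
                        (success⇒found 1≤D Rs O 0 (cnt i pre) (empty i₀) dom initially eq))))))
      core : ∀ s′ → X Rs * W σ (length pre) (win ++ post) φ s′ ≥ B * Sc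
      core s′ = begin
        B * Sc ≡⟨ cong (_* Sc) (trans (cong (β ^_) (length-++ win)) (^-distribˡ-+-* β (length win) _)) ⟩
        β ^ length win * β ^ length post * Sc ≡⟨ *-assoc (β ^ length win) _ Sc ⟩
        β ^ length win * (β ^ length post * Sc) ≡⟨ cong (β ^ length win *_) (sym (∑-*ˡ (β ^ length post) (offsets Rs) _)) ⟩
        β ^ length win * ∑ᵒ Rs (λ O → β ^ length post * ⟦ success 0 (cnt i pre) Rs O ⟧)
          ≤⟨ *-monoʳ-≤ (β ^ length win) (∑-mono (offsets Rs) wins) ⟩
        β ^ length win * ∑ᵒ Rs (λ O → W σ (length win + length pre) post φ (rowsRun Rs O (empty i₀)))
          ≡⟨ sym (W-rows Rs (W σ (length win + length pre) post φ) s′ rowsAt) ⟩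
        X Rs * W σ (length pre) win (W σ (length win + length pre) post φ) s′
          ≡⟨ cong (X Rs *_) (sym (W-++ σ (length pre) win post φ s′)) ⟩
        X Rs * W σ (length pre) (win ++ post) φ s′ ∎
      main : ∀ s′ → B ≤ N * W σ (length pre) (win ++ post) φ s′
      main s′ = *-cancelˡ-≤ (H * X Rs) {{>-nonZero (*-mono-≤ 1≤H (m^n>0 (2 ^ a) {{m^n≢0 2 a}} (length Rs)))}} (begin
        H * X Rs * B ≤⟨ *-monoˡ-≤ B succ≥ ⟩
        2 * 2 ^ a * Sc * B ≤⟨ *-monoˡ-≤ B (*-monoˡ-≤ Sc N≥) ⟩
        N * H * Sc * B ≡⟨ e₁ N H Sc B ⟩
        N * H * (B * Sc) ≤⟨ *-monoʳ-≤ (N * H) (core s′) ⟩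
        N * H * (X Rs * W σ (length pre) (win ++ post) φ s′)
          ≡⟨ e₂ N H (X Rs) _ ⟩
        H * X Rs * (N * W σ (length pre) (win ++ post) φ s′) ∎)
        where
        e₁ : ∀ n h s b → n * h * s * b ≡ n * h * (b * s)
        e₁ = solve-∀
        e₂ : ∀ n h x w → n * h * (x * w) ≡ h * x * (n * w)
        e₂ = solve-∀

-- Phases, rows and slot types

module Schedule (k₀ c₁ : ℕ) where

  -- Q = 2 ^ κ is 8 ^ (k - 1).  A phase e has Q ^ e elements, so that the time, the
  -- stream length and the heavy frequency are all measured in powers of Q.
  κ : ℕ
  κ = 3 * (2 + k₀)

  phaseLength : ℕ → ℕ
  phaseLength e = 2 ^ (κ * e)

  -- A factor `8 = Q ^ (1 / (k - 1))` per unit of `ρ ∸ l` is what the moment condition permits;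
  -- `2 ^ l` is given up for the smaller target and `2 ^ c₁` for constants. Truncation leaves a
  -- single row.
  rowsExp : ℕ → ℕ → ℕ
  rowsExp ρ l = 3 * (ρ ∸ l) ∸ (l + c₁)

  lenExp : ℕ → ℕ → ℕ → ℕ
  lenExp e ρ l = κ * e ∸ rowsExp ρ l

  -- `(e + l) ∸ ρ` is the scale φ of the heavy frequency, and `l + 2` accounts for the share of
  -- `2 ^ -(l + 2)`.
  targetExp : ℕ → ℕ → ℕ → ℕ
  targetExp e ρ l = κ * ((e + l) ∸ ρ) ∸ (l + 2)

  -- At least twice the ratio of row length to target count.  Since k ≥ 3, the
  -- factor 2 ^ (2 * l) is outweighed and the sum over l is O(8 ^ ((k - 2) * ρ)).
  copiesExp : ℕ → ℕ → ℕ
  copiesExp ρ l = 3 + c₁ + 2 * l + 3 * (1 + k₀) * (ρ ∸ l)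

  -- A type (ρ , l , j) is meant for streams that end in a phase Y ≡ j + l modulo
  -- l + 1, for a heavy element of frequency about 2 ^ (κ * (Y ∸ ρ)) that occurs
  -- often enough in phase Y ∸ l.
  Type : Set
  Type = ℕ × ℕ × ℕ

  Clock : Set
  Clock = ℕ × ℕ

  advance : Clock → Clock
  advance (e , pos) with suc pos <? phaseLength e
  ... | yes _ = e , suc pos
  ... | no  _ = suc e , 0

  clock : ℕ → Clock
  clock zero    = 0 , 0
  clock (suc t) = advance (clock t)

  phaseStart : ℕ → ℕ
  phaseStart zero    = 0
  phaseStart (suc e) = phaseLength e + phaseStart e

  rowInstr : Type → ℕ → Bool → Instr
  rowInstr (ρ , l , j) e fresh = row fresh (lenExp e ρ l) (16 * 2 ^ rowsExp ρ l) (2 ^ targetExp e ρ l)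

  inPhase : Type → Clock → Instr
  inPhase q (e , zero)               = rowInstr q e true
  inPhase q@(ρ , l , _) (e , suc pos) with (suc pos % 2 ^ lenExp e ρ l) {{m^n≢0 2 (lenExp e ρ l)}}
  ... | zero  = rowInstr q e false
  ... | suc _ = go

  sched : Type → Clock → Instr
  sched q@(ρ , l , j) (e , pos) with e % suc l ≟ j
  ... | yes _ = inPhase q (e , pos)
  ... | no  _ = go

  clock-invariant : ∀ t → let e , pos = clock t in t ≡ pos + phaseStart e × pos < phaseLength e
  clock-invariant zero    = refl , m^n>0 2 (κ * 0)
  clock-invariant (suc t) with clock t | clock-invariant t
  ... | e , pos | eq , lt with suc pos <? phaseLength e
  ...   | yes lt′ = cong suc eq , lt′
  ...   | no  ≮   = trans (cong suc eq) (cong (_+ phaseStart e) (≤-antisym lt (≮⇒≥ ≮))) , m^n>0 2 (κ * suc e)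

  phaseStart-mono : ∀ {e e′} → e ≤ e′ → phaseStart e ≤ phaseStart e′
  phaseStart-mono {e} {e′} e≤e′ with m≤n⇒∃[o]m+o≡n e≤e′
  ... | d , refl = go′ d
    where
    go′ : ∀ d → phaseStart e ≤ phaseStart (e + d)
    go′ zero    = ≤-reflexive (cong phaseStart (sym (+-identityʳ e)))
    go′ (suc d) = ≤≡-trans (≤-trans (go′ d) (m≤n+m _ (phaseLength (e + d)))) (cong phaseStart (sym (+-suc e d)))

  phase-lower : ∀ {t e} → phaseStart e ≤ t → e ≤ proj₁ (clock t)
  phase-lower {t} {e} le with clock t | clock-invariant t
  ... | e′ , pos | eq , lt = ≮⇒≥ λ e′<e → <⇒≱ (begin-strict
    t ≡⟨ eq ⟩
    pos + phaseStart e′ <⟨ +-monoˡ-< (phaseStart e′) lt ⟩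
    phaseStart (suc e′) ≤⟨ phaseStart-mono e′<e ⟩
    phaseStart e ∎) le
    where open ≤-Reasoning

  phase-upper : ∀ {t e} → t < phaseStart (suc e) → proj₁ (clock t) ≤ e
  phase-upper {t} {e} lt with clock t | clock-invariant t
  ... | e′ , pos | eq , _ = ≮⇒≥ λ e<e′ → <⇒≱ lt (begin
    phaseStart (suc e) ≤⟨ phaseStart-mono e<e′ ⟩
    phaseStart e′ ≤⟨ m≤n+m _ pos ⟩
    pos + phaseStart e′ ≡⟨ sym eq ⟩
    t ∎)
    where open ≤-Reasoning

  clock-at : ∀ {e pos} → pos < phaseLength e → clock (pos + phaseStart e) ≡ (e , pos)
  clock-at {e} {pos} lt = cong₂ _,_ e≡ (+-cancelʳ-≡ (phaseStart e) _ _ (sym (trans (proj₁ inv) (cong (λ x → proj₂ (clock t) + phaseStart x) e≡))))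
    where
    t = pos + phaseStart e
    inv = clock-invariant t
    e≡ : proj₁ (clock t) ≡ e
    e≡ = ≤-antisym (phase-upper {t} (+-monoˡ-< (phaseStart e) lt)) (phase-lower {t} (m≤n+m _ pos))

  private
    apart : ∀ {e e′ l} → e < e′ → e′ ≤ e + l → e′ % suc l ≢ e % suc l
    apart {e} {e′} {l} e<e′ e′≤ eq = <⇒≱ tooFar e′≤
      where
      open ≤-Reasoning
      q<q′ : e / suc l < e′ / suc l
      q<q′ = *-cancelʳ-< _ _ _ (+-cancelˡ-< (e % suc l) _ _ (begin-strict
        e % suc l + e / suc l * suc l ≡⟨ sym (m≡m%n+[m/n]*n e (suc l)) ⟩
        e <⟨ e<e′ ⟩
        e′ ≡⟨ m≡m%n+[m/n]*n e′ (suc l) ⟩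
        e′ % suc l + e′ / suc l * suc l ≡⟨ cong (_+ e′ / suc l * suc l) eq ⟩
        e % suc l + e′ / suc l * suc l ∎))
      regroup : ∀ a b c → a + b + c ≡ a + (c + b)
      regroup = solve-∀
      tooFar : e + l < e′
      tooFar = begin-strict
        e + l <⟨ +-monoʳ-< e (n<1+n l) ⟩
        e + suc l ≡⟨ cong (_+ suc l) (m≡m%n+[m/n]*n e (suc l)) ⟩
        e % suc l + e / suc l * suc l + suc l ≡⟨ regroup (e % suc l) (e / suc l * suc l) (suc l) ⟩
        e % suc l + suc (e / suc l) * suc l ≤⟨ +-mono-≤ (≤-reflexive (sym eq)) (*-monoˡ-≤ (suc l) q<q′) ⟩
        e′ % suc l + e′ / suc l * suc l ≡⟨ sym (m≡m%n+[m/n]*n e′ (suc l)) ⟩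
        e′ ∎

  sched-active : ∀ ρ l e pos → pos < phaseLength e →
                 sched (ρ , l , e % suc l) (clock (pos + phaseStart e)) ≡ inPhase (ρ , l , e % suc l) (e , pos)
  sched-active ρ l e pos lt rewrite clock-at {e} {pos} lt with e % suc l ≟ e % suc l
  ... | yes _  = refl
  ... | no  ne = contradiction refl ne

  -- The purpose of the residue: the next `l` phases lie in other classes modulo `suc l`, so the
  -- slot is not reset before the stream ends.
  sched-idle : ∀ ρ l e t → phaseStart (suc e) ≤ t → t < phaseStart (suc (e + l)) →
               sched (ρ , l , e % suc l) (clock t) ≡ go
  sched-idle ρ l e t lo hi with clock t | phase-lower {t} {suc e} lo | phase-upper {t} {e + l} hi
  ... | e′ , pos | e<e′ | e′≤ with e′ % suc l ≟ e % suc l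
  ...   | yes eq = contradiction eq (apart e<e′ e′≤)
  ...   | no  _  = refl

  module _ (ρ l e : ℕ) where
    private
      q = ρ , l , e % suc l
      L = 2 ^ lenExp e ρ l
      instance
        L≢0 : NonZero L
        L≢0 = m^n≢0 2 (lenExp e ρ l)

    sched-start : ∀ m → m * L < phaseLength e →
                  sched q (clock (m * L + phaseStart e)) ≡ rowInstr q e (m ≡ᵇ 0)
    sched-start zero    lt = sched-active ρ l e 0 lt
    sched-start (suc m) lt = trans (sched-active ρ l e (suc m * L) lt) (start-at (suc m * L) refl)
      where
      start-at : ∀ x → x ≡ suc m * L → inPhase q (e , x) ≡ rowInstr q e false
      start-at zero    eq = contradiction eq (<⇒≢ (≤-trans (m^n>0 2 (lenExp e ρ l)) (m≤m+n L (m * L))))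
      start-at (suc x) eq with (suc x % L) in r
      ... | zero  = refl
      ... | suc _ = contradiction (trans (sym r) (trans (cong (_% L) eq) ([m+kn]%n≡m%n 0 (suc m) L))) λ sx≡ →
                      contradiction (trans sx≡ (m<n⇒m%n≡m (m^n>0 2 (lenExp e ρ l)))) λ ()

    sched-go : ∀ m r → suc r < L → suc r + m * L < phaseLength e →
               sched q (clock (suc r + m * L + phaseStart e)) ≡ go
    sched-go m r r<L lt = trans (sched-active ρ l e (suc r + m * L) lt) go-at
      where
      go-at : inPhase q (e , suc r + m * L) ≡ go
      go-at with (suc (r + m * L) % L) in eq
      ... | zero  = contradiction (trans (sym eq) (trans ([m+kn]%n≡m%n (suc r) m L) (m<n⇒m%n≡m r<L))) λ ()
      ... | suc _ = refl

-- The last row may be short because the stream can end within a phase. Empty rows are never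
-- produced, as `RowsAt` demands a first element at which the row is started.
chunks : ℕ → ℕ → List (Fin n) → List (List (Fin n))
chunks ℓ zero    xs       = []
chunks ℓ (suc P) []       = []
chunks ℓ (suc P) (x ∷ xs) = (x ∷ take ℓ xs) ∷ chunks ℓ P (drop ℓ xs)

concat-chunks : ∀ ℓ P (xs : List (Fin n)) → length xs ≤ P * suc ℓ → concat (chunks ℓ P xs) ≡ xs
concat-chunks ℓ zero    []       le = refl
concat-chunks ℓ (suc P) []       le = refl
concat-chunks ℓ (suc P) (x ∷ xs) (s≤s le) = cong (x ∷_) (trans (cong (take ℓ xs ++_)
  (concat-chunks ℓ P (drop ℓ xs) (≡≤-trans (length-drop ℓ xs)
    (≤≡-trans (∸-monoˡ-≤ ℓ le) (m+n∸m≡n ℓ (P * suc ℓ))))))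
  (take++drop≡id ℓ xs))

length-chunks : ∀ ℓ P (xs : List (Fin n)) → length (chunks ℓ P xs) ≤ P
length-chunks ℓ zero    xs       = z≤n
length-chunks ℓ (suc P) []       = z≤n
length-chunks ℓ (suc P) (x ∷ xs) = s≤s (length-chunks ℓ P (drop ℓ xs))

chunks-short : ∀ ℓ P (xs : List (Fin n)) → All (λ R → length R ≤ suc ℓ) (chunks ℓ P xs)
chunks-short ℓ zero    xs       = []
chunks-short ℓ (suc P) []       = []
chunks-short ℓ (suc P) (x ∷ xs) =
  s≤s (≡≤-trans (length-take ℓ xs) (m⊓n≤m ℓ (length xs))) ∷ chunks-short ℓ P (drop ℓ xs)

module _ (i₀ : Fin n) (A : ℕ) where
  open Chance i₀ A

  goOn : ∀ (σ : ℕ → Instr) t l → (∀ u → t ≤ u → u < l + t → σ u ≡ go) → GoOn σ t l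
  goOn σ t zero    all = tt
  goOn σ t (suc l) all = all t ≤-refl (s≤s (m≤n+m t l)) ,
    goOn σ (suc t) l (λ u lo hi → all u (<⇒≤ lo) (≤≡-trans hi (+-suc l t)))

  chunks-rowsAt : ∀ (σ : ℕ → Instr) a D U ℓ t₀ M →
    (∀ m → m < M → σ (m * suc ℓ + t₀) ≡ row (m ≡ᵇ 0) a D U) →
    (∀ m r → m < M → suc r < suc ℓ → σ (suc r + m * suc ℓ + t₀) ≡ go) →
    ∀ m P xs → m + P ≤ M → RowsAt σ a D U (m * suc ℓ + t₀) (m ≡ᵇ 0) (chunks ℓ P xs)
  chunks-rowsAt σ a D U ℓ t₀ M starts goes m zero    xs       le = []
  chunks-rowsAt σ a D U ℓ t₀ M starts goes m (suc P) []       le = []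
  chunks-rowsAt σ a D U ℓ t₀ M starts goes m (suc P) (x ∷ xs) le =
    (starts m m<M , goOn σ _ _ inside) ∷ rest (≤-total ℓ (length xs))
    where
    m<M : m < M
    m<M = ≤-trans (≤≡-trans (s≤s (m≤m+n m P)) (sym (+-suc m P))) le
    t = m * suc ℓ + t₀
    row≤ : length (take ℓ xs) ≤ ℓ
    row≤ = ≡≤-trans (length-take ℓ xs) (m⊓n≤m ℓ (length xs))
    inside : ∀ u → suc t ≤ u → u < length (take ℓ xs) + suc t → σ u ≡ go
    inside u lo hi with m≤n⇒∃[o]m+o≡n lo
    ... | r , refl = trans (cong σ (shuffle r (m * suc ℓ) t₀)) (goes m r m<M (s≤s (≤-trans r< row≤)))
      where
      r< : r < length (take ℓ xs)
      r< = +-cancelʳ-< (suc t) _ _ (≡≤-trans (cong suc (+-comm r (suc t))) hi)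
      shuffle : ∀ r q t₀ → suc (q + t₀) + r ≡ suc r + q + t₀
      shuffle = solve-∀
    rest : ℓ ≤ length xs ⊎ length xs ≤ ℓ → RowsAt σ a D U (length (take ℓ xs) + suc t) false (chunks ℓ P (drop ℓ xs))
    rest (inj₁ full) = subst (λ u → RowsAt σ a D U u false (chunks ℓ P (drop ℓ xs)))
      (trans (shuffle ℓ (m * suc ℓ) t₀) (cong (_+ suc t) (sym (trans (length-take ℓ xs) (m≤n⇒m⊓n≡m full)))))
      (chunks-rowsAt σ a D U ℓ t₀ M starts goes (suc m) P (drop ℓ xs) (≡≤-trans (sym (+-suc m P)) le))
      where
      shuffle : ∀ l q t₀ → suc l + q + t₀ ≡ l + suc (q + t₀)
      shuffle = solve-∀
    rest (inj₂ short) rewrite drop-all ℓ xs short = none P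
      where
      none : ∀ P → RowsAt σ a D U (length (take ℓ xs) + suc t) false (chunks ℓ P [])
      none zero    = []
      none (suc P) = []

∑-filter-≤ : ∀ {A : Set} {P : Pred A 0ℓ} (P? : Decidable P) (xs : List A) {f g : A → ℕ} →
             (∀ x → P x → f x ≤ g x) → (∀ x → ¬ P x → f x ≡ 0) → ∑ xs f ≤ ∑ (filter P? xs) g
∑-filter-≤ P? []       on off = z≤n
∑-filter-≤ P? (x ∷ xs) {f} on off with P? x
... | yes p = +-mono-≤ (on x p) (∑-filter-≤ P? xs on off)
... | no ¬p = ≡≤-trans (cong (λ z → z + ∑ xs f) (off x ¬p)) (∑-filter-≤ P? xs on off)

others : Fin n → List (Fin n)
others i = filter (λ j → ¬? (j Fin.≟ i)) (allFin _)

rest : ℕ → List (Fin n) → Fin n → ℕ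
rest k xs i = ∑ (others i) (λ j → cnt j xs ^ k)

found? : Fin n → (f b : ℕ) → Slot n → Bool
found? i f b s = (does (Slot.champ s Fin.≟ i) ∧ (f ≤ᵇ Slot.score s + b)) ∨
                 (does (Slot.chal s Fin.≟ i) ∧ (f ≤ᵇ Slot.chalScore s + b))

≤ᵇ-complete : ∀ {a b} → a ≤ b → (a ≤ᵇ b) ≡ true
≤ᵇ-complete {a} {b} le with a ≤ᵇ b in eq
... | true  = refl
... | false = ⊥-elim (subst T eq (≤⇒≤ᵇ le))

≟-refl : ∀ (i : Fin n) → does (i Fin.≟ i) ≡ true
≟-refl i with i Fin.≟ i
... | yes _ = refl
... | no ne = contradiction refl ne

∨-true : ∀ x → (x ∨ true) ≡ true
∨-true true  = refl
∨-true false = refl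

2^-mono : ∀ {a b} → a ≤ b → 2 ^ a ≤ 2 ^ b
2^-mono = ^-monoʳ-≤ 2

-- Success of a slot in a suitable phase

module Find (k₀ c₀ : ℕ) (i₀ : Fin n) (A : ℕ) where
  open Schedule k₀ (c₀ + 7)
  open Chance i₀ A

  private
    K k : ℕ
    K = 2 + k₀
    k = suc K

  -- In expectation, at least one copy of a slot of type (ρ , l , j) finds i.
  Wins : List (Fin n) → Fin n → (b ρ l j : ℕ) → Set
  Wins xs i b ρ l j = ∀ s → β ^ length xs ≤ 2 ^ copiesExp ρ l *
    W (sched (ρ , l , j) ∘ clock) 0 xs (λ s → ⟦ found? i (cnt i xs) b s ⟧) s

  module _ (e l ρ φ : ℕ) (l≤ρ : l ≤ ρ) (φ+ρ : φ + ρ ≡ e + l) where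
    private
      r p a h : ℕ
      r = ρ ∸ l
      p = rowsExp ρ l
      a = lenExp e ρ l
      h = κ * φ ∸ (l + 2)

      φ+r : φ + r ≡ e
      φ+r = +-cancelʳ-≡ l _ _ (trans (+-assoc φ r l) (trans (cong (φ +_) (m∸n+n≡m l≤ρ)) φ+ρ))

      κe : κ * φ + κ * r ≡ κ * e
      κe = trans (sym (*-distribˡ-+ κ φ r)) (cong (κ *_) φ+r)

      p≤κr : p ≤ κ * r
      p≤κr = ≤-trans (m∸n≤m (3 * r) (l + (c₀ + 7)))
                     (*-monoˡ-≤ r {3} {κ} (≡≤-trans (sym (*-identityʳ 3)) (*-monoʳ-≤ 3 (s≤s {0} {1 + k₀} z≤n))))

      a+p : a + p ≡ κ * e
      a+p = m∸n+n≡m (≤-trans p≤κr (≤≡-trans (m≤n+m _ (κ * φ)) κe))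

      κφ≤a : κ * φ ≤ a
      κφ≤a = ≡≤-trans (sym (m+n∸n≡m (κ * φ) (κ * r)))
                     (≡≤-trans (cong (_∸ κ * r) κe) (∸-monoʳ-≤ (κ * e) p≤κr))

      target≡ : targetExp e ρ l ≡ h
      target≡ = cong (λ x → κ * x ∸ (l + 2)) (trans (cong (_∸ ρ) (sym φ+ρ)) (m+n∸n≡m φ ρ))

    rows*length : 2 ^ p * 2 ^ a ≡ phaseLength e
    rows*length = trans (sym (^-distribˡ-+-* 2 p a)) (cong (2 ^_) (trans (+-comm p a) a+p))

    -- A row has at least `Q ^ φ` elements and the target is at most a quarter of that, except where
    -- truncation makes it 1; the summand 2 covers this case.
    few-targets : 2 * 2 ^ h ≤ 2 ^ a + 2
    few-targets with h in eq
    ... | zero  = m≤n+m 2 (2 ^ a)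
    ... | suc h′ = ≤-trans (2^-mono (≤-trans suc-h≤ κφ≤a)) (m≤m+n (2 ^ a) 2)
      where
      suc-h≤ : suc (suc h′) ≤ κ * φ
      suc-h≤ = begin
        suc (suc h′) ≡⟨ cong suc (sym eq) ⟩
        suc h ≡⟨ +-comm 1 h ⟩
        h + 1 ≤⟨ +-monoʳ-≤ h (≤-trans (s≤s z≤n) (m≤n+m 2 l)) ⟩
        h + (l + 2) ≡⟨ m∸n+n≡m (<⇒≤ (m∸n≢0⇒n<m {κ * φ} {l + 2} λ h≡0 → contradiction (trans (sym eq) h≡0) λ ())) ⟩
        κ * φ ∎
        where open ≤-Reasoning

    -- `copiesExp` is the exponent of `2 * 2 ^ a / 2 ^ h` computed without truncation. Truncation in
    -- `h` and `p` only makes these larger, hence the inequalities `m≤n+m∸n`.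
    enough-copies : 2 * 2 ^ a ≤ 2 ^ copiesExp ρ l * 2 ^ h
    enough-copies = ≤≡-trans (2^-mono exps) (^-distribˡ-+-* 2 (copiesExp ρ l) h)
      where
      open ≤-Reasoning
      exps : suc a ≤ copiesExp ρ l + h
      exps = +-cancelʳ-≤ p _ _ (begin
        suc a + p ≡⟨ cong suc a+p ⟩
        suc (κ * e) ≡⟨ cong suc (sym κe) ⟩
        suc (κ * φ + κ * r) ≡⟨ e₁ (κ * φ) k₀ r ⟩
        1 + κ * φ + 3 * (1 + k₀) * r + 3 * r
          ≤⟨ +-mono-≤ (+-monoˡ-≤ (3 * (1 + k₀) * r) (+-monoʳ-≤ 1 (m≤n+m∸n (κ * φ) (l + 2)))) (m≤n+m∸n (3 * r) (l + (c₀ + 7))) ⟩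
        1 + (l + 2 + h) + 3 * (1 + k₀) * r + (l + (c₀ + 7) + p)
          ≡⟨ e₂ l h (3 * (1 + k₀) * r) (c₀ + 7) p ⟩
        copiesExp ρ l + h + p ∎)
        where
        e₁ : ∀ x k r → suc (x + 3 * (2 + k) * r) ≡ 1 + x + 3 * (1 + k) * r + 3 * r
        e₁ = solve-∀
        e₂ : ∀ l h x c p → 1 + (l + 2 + h) + x + (l + c + p) ≡ 3 + c + 2 * l + x + h + p
        e₂ = solve-∀

    -- Here `c₀ + 7` in the row exponent is spent: 5 on the factor 32, 2 on the 2 in `l + 2`, and
    -- `c₀` on the moment. What remains is that `8 ^ (K * r)` equals `Q ^ r`. For `p ≢ 0` the row
    -- exponent is not truncated, so `3 * r` can be expressed exactly.
    moment-bound : p ≢ 0 → ∀ M → M ≤ 2 ^ c₀ * 2 ^ (κ * φ * k) →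
                   (32 * 2 ^ p) ^ K * M ≤ (2 ^ h) ^ K * phaseLength e
    moment-bound p≢0 M M≤ = begin
      (32 * 2 ^ p) ^ K * M ≡⟨ cong (λ z → z ^ K * M) (sym (^-distribˡ-+-* 2 5 p)) ⟩
      (2 ^ (5 + p)) ^ K * M ≡⟨ cong (_* M) (^-*-assoc 2 (5 + p) K) ⟩
      2 ^ ((5 + p) * K) * M ≤⟨ *-monoʳ-≤ (2 ^ ((5 + p) * K)) M≤ ⟩
      2 ^ ((5 + p) * K) * (2 ^ c₀ * 2 ^ (κ * φ * k)) ≡⟨ cong (2 ^ ((5 + p) * K) *_) (sym (^-distribˡ-+-* 2 c₀ (κ * φ * k))) ⟩
      2 ^ ((5 + p) * K) * 2 ^ (c₀ + κ * φ * k) ≡⟨ sym (^-distribˡ-+-* 2 ((5 + p) * K) _) ⟩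
      2 ^ ((5 + p) * K + (c₀ + κ * φ * k)) ≤⟨ 2^-mono exps ⟩
      2 ^ (h * K + κ * e) ≡⟨ ^-distribˡ-+-* 2 (h * K) (κ * e) ⟩
      2 ^ (h * K) * phaseLength e ≡⟨ cong (_* phaseLength e) (sym (^-*-assoc 2 h K)) ⟩
      (2 ^ h) ^ K * phaseLength e ∎
      where
      open ≤-Reasoning
      3r : 3 * r ≡ l + (c₀ + 7) + p
      3r = sym (m+[n∸m]≡n (<⇒≤ (m∸n≢0⇒n<m {3 * r} {l + (c₀ + 7)} p≢0)))
      exps : (5 + p) * K + (c₀ + κ * φ * k) ≤ h * K + κ * e
      exps = begin
        (5 + p) * K + (c₀ + κ * φ * k) ≡⟨ e₁ p k₀ c₀ (κ * φ) ⟩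
        (5 + p) * K + c₀ + κ * φ + κ * φ * K ≤⟨ +-monoʳ-≤ _ (*-monoˡ-≤ K (m≤n+m∸n (κ * φ) (l + 2))) ⟩
        (5 + p) * K + c₀ + κ * φ + (l + 2 + h) * K ≤⟨ m≤m+n _ ((1 + k₀) * c₀) ⟩
        (5 + p) * K + c₀ + κ * φ + (l + 2 + h) * K + (1 + k₀) * c₀
          ≡⟨ e₂ p k₀ c₀ (κ * φ) l h ⟩
        h * K + (κ * φ + K * (l + (c₀ + 7) + p)) ≡⟨ cong (λ z → h * K + (κ * φ + K * z)) (sym 3r) ⟩
        h * K + (κ * φ + K * (3 * r)) ≡⟨ cong (λ z → h * K + (κ * φ + z)) (e₃ k₀ r) ⟩
        h * K + (κ * φ + κ * r) ≡⟨ cong (h * K +_) κe ⟩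
        h * K + κ * e ∎
        where
        e₁ : ∀ p k c x → (5 + p) * (2 + k) + (c + x * (3 + k)) ≡ (5 + p) * (2 + k) + c + x + x * (2 + k)
        e₁ = solve-∀
        e₂ : ∀ p k c x l h → (5 + p) * (2 + k) + c + x + (l + 2 + h) * (2 + k) + (1 + k) * c ≡
                             h * (2 + k) + (x + (2 + k) * (l + (c + 7) + p))
        e₂ = solve-∀
        e₃ : ∀ k r → (2 + k) * (3 * r) ≡ 3 * (2 + k) * r
        e₃ = solve-∀

    slot-finds : ∀ (i : Fin n) b pre win post → κ * e ≤ A →
      length pre ≡ phaseStart e → length win ≤ phaseLength e →
      post ≡ [] ⊎ length win ≡ phaseLength e →
      length (pre ++ win ++ post) ≤ phaseStart (suc (e + l)) →
      2 ^ h ≤ cnt i win → cnt i pre + 2 ^ h ≤ suc b →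
      rest k (pre ++ win ++ post) i ≤ 2 ^ c₀ * 2 ^ (κ * φ * k) →
      Wins (pre ++ win ++ post) i b ρ l (e % suc l)
    slot-finds i b pre win post κe≤A pre≡ win≤ post? xs≤ H≤ b≥ rest≤ s =
      subst (λ w → β ^ length (pre ++ w ++ post) ≤ 2 ^ copiesExp ρ l * W σ 0 (pre ++ w ++ post) φs s) win≡
        (W-found i G b′ D H σ a (≤-trans (m∸n≤m (κ * e) p) κe≤A) pre Rs post φs s (2 ^ copiesExp ρ l) H
          (m^n>0 2 h) rows≢0 finds dominated (≤-trans (s≤s z≤n) (*-monoʳ-≤ 16 (m^n>0 2 p))) rowsAt (after post?)
          (∑-success i G b′ D H (2 ^ a) H (cnt i pre) Rs (m^n>0 2 a) total few-targets bad≤) enough-copies)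
      where
      q = ρ , l , e % suc l
      σ = sched q ∘ clock
      xs = pre ++ win ++ post
      H = 2 ^ h
      P = 2 ^ p
      D = 16 * P
      ℓ = pred (2 ^ a)
      sucℓ : suc ℓ ≡ 2 ^ a
      sucℓ = suc-pred (2 ^ a) {{m^n≢0 2 a}}
      -- Chosen so that exactly `H` occurrences in the window are early.
      b′ = pred (cnt i pre + H)
      sucb′ : suc b′ ≡ cnt i pre + H
      sucb′ = suc-pred (cnt i pre + H) {{>-nonZero (≤-trans (m^n>0 2 h) (m≤n+m H (cnt i pre)))}}
      b′≤b : b′ ≤ b
      b′≤b = ≤-pred (≡≤-trans sucb′ b≥)
      -- The count of i is left out, so that the moment of `G` is one of the other elements only.
      G : Fin n → ℕ
      G z = if does (z Fin.≟ i) then 0 else cnt z win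
      φs : Slot n → ℕ
      φs s = ⟦ found? i (cnt i xs) b s ⟧
      Rs = chunks ℓ P win
      win≡ : concat Rs ≡ win
      win≡ = concat-chunks ℓ P win (≤≡-trans win≤ (trans (sym rows*length) (cong (P *_) (sym sucℓ))))
      open Window i G b′ D H using (Found; Dominates)
      open Offsets i G b′ D H (2 ^ a) using (Tot; Tot-⊓; ∑ᵒ; bad; X)
      rows≢0 : length Rs ≢ 0
      rows≢0 eq = contradiction (≤-trans (m^n>0 2 h) H≤) (λ lt → n≮0 (≤≡-trans lt (cong (cnt i) (trans (sym win≡) (none Rs eq)))))
        where
        none : ∀ (Rs : List (List (Fin n))) → length Rs ≡ 0 → concat Rs ≡ []
        none [] _ = refl
      seen≡ : cnt i post + (cnt i (concat Rs) + cnt i pre) ≡ cnt i xs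
      seen≡ = trans (cong (λ w → cnt i post + (cnt i w + cnt i pre)) win≡)
             (trans (shuffle (cnt i post) (cnt i win) (cnt i pre))
                    (sym (trans (cnt-++ i pre (win ++ post)) (cong (cnt i pre +_) (cnt-++ i win post)))))
        where
        shuffle : ∀ x y z → x + (y + z) ≡ z + (y + x)
        shuffle = solve-∀
      finds : ∀ s → Found (cnt i post + (cnt i (concat Rs) + cnt i pre)) s → φs s ≡ 1
      finds (slot y c α z d w) (inj₁ (refl , _ , le))
        rewrite ≟-refl i | ≤ᵇ-complete (≡≤-trans (sym seen≡) (≤-trans le (+-monoʳ-≤ c b′≤b))) = refl
      finds (slot y c α z d w) (inj₂ (refl , _ , _ , le))
        rewrite ≟-refl i | ≤ᵇ-complete (≡≤-trans (sym seen≡) (≤-trans le (+-monoʳ-≤ d b′≤b)))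
              | ∨-true (does (y Fin.≟ i) ∧ (cnt i xs ≤ᵇ c + b)) = refl
      dominated : Dominates Rs
      dominated z z≢i rewrite win≡ with z Fin.≟ i
      ... | yes z≡i = contradiction z≡i z≢i
      ... | no  _   = ≤-refl
      rowsAt : RowsAt σ a D H (length pre) true Rs
      rowsAt rewrite pre≡ = subst (λ L → RowsAt σ a D H (0 * L + phaseStart e) true Rs) sucℓ
        (chunks-rowsAt i₀ A σ a D H ℓ (phaseStart e) P starts goes 0 P win ≤-refl)
        where
        inside : ∀ {m x} → m < P → x < suc ℓ → x + m * suc ℓ < phaseLength e
        inside {m} {x} m<P x<L = ≤-trans (+-monoˡ-≤ (m * suc ℓ) x<L)
          (≤≡-trans (*-monoˡ-≤ (suc ℓ) m<P) (trans (cong (P *_) sucℓ) rows*length))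
        starts : ∀ m → m < P → σ (m * suc ℓ + phaseStart e) ≡ row (m ≡ᵇ 0) a D H
        starts m m<P = trans (trans (cong (λ L → σ (m * L + phaseStart e)) sucℓ)
          (sched-start ρ l e m (subst (λ L → m * L < phaseLength e) sucℓ (inside {m} {0} m<P (s≤s z≤n)))))
          (cong (λ x → row (m ≡ᵇ 0) a D (2 ^ x)) target≡)
        goes : ∀ m r → m < P → suc r < suc ℓ → σ (suc r + m * suc ℓ + phaseStart e) ≡ go
        goes m r m<P r<ℓ = trans (cong (λ L → σ (suc r + m * L + phaseStart e)) sucℓ)
          (sched-go ρ l e m r (subst (suc r <_) sucℓ r<ℓ)
            (subst (λ L → suc r + m * L < phaseLength e) sucℓ (inside {m} {suc r} m<P r<ℓ)))
      after : post ≡ [] ⊎ length win ≡ phaseLength e → GoOn σ (length (concat Rs) + length pre) (length post)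
      after (inj₁ post≡[]) = subst (λ ys → GoOn σ (length (concat Rs) + length pre) (length ys)) (sym post≡[]) tt
      after (inj₂ full)    = subst (λ t → GoOn σ t (length post)) (sym (cong₂ _+_ (trans (cong length win≡) full) pre≡))
        (goOn i₀ A σ (phaseStart (suc e)) (length post)
          (λ u lo hi → sched-idle ρ l e u lo (≤-trans hi end)))
        where
        end : length post + phaseStart (suc e) ≤ phaseStart (suc (e + l))
        end = ≡≤-trans (trans (+-comm (length post) _) (trans (cong (λ x → x + phaseStart e + length post) (sym full))
                (trans (shuffle (length win) (phaseStart e) (length post)) (trans (cong (_+ (length win + length post)) (sym pre≡))
                  (trans (cong (length pre +_) (sym (length-++ win))) (sym (length-++ pre))))))) xs≤
          where
          shuffle : ∀ x y z → x + y + z ≡ y + (x + z)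
          shuffle = solve-∀
      total : Tot (cnt i pre) Rs ≡ H
      total = trans (Tot-⊓ (cnt i pre) Rs (subst (λ L → All (λ R → length R ≤ L) Rs) sucℓ (chunks-short ℓ P win)))
             (trans (cong₂ (λ w x → cnt i w ⊓ (x ∸ cnt i pre)) win≡ sucb′)
             (trans (cong (cnt i win ⊓_) (m+n∸m≡n (cnt i pre) H)) (m≥n⇒m⊓n≡n H≤)))
      -- Summing over positions instead of elements supplies one more factor of the count, which
      -- turns the exponent `K` into `k`.
      moment : ∑ win (λ z → G z ^ K) ≤ 2 ^ c₀ * 2 ^ (κ * φ * k)
      moment = ≤-trans (≡≤-trans (∑-cnt win (λ z → G z ^ K))
        (∑-filter-≤ (λ j → ¬? (j Fin.≟ i)) (allFin n) on off)) rest≤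
        where
        cnt-win≤ : ∀ z → cnt z win ≤ cnt z xs
        cnt-win≤ z = ≤-trans (≤≡-trans (m≤m+n _ (cnt z post)) (sym (cnt-++ z win post)))
                             (≤≡-trans (m≤n+m _ (cnt z pre)) (sym (cnt-++ z pre (win ++ post))))
        on : ∀ z → z ≢ i → cnt z win * G z ^ K ≤ cnt z xs ^ k
        on z z≢i with z Fin.≟ i
        ... | yes z≡i = contradiction z≡i z≢i
        ... | no  _   = ^-monoˡ-≤ k (cnt-win≤ z)
        off : ∀ z → ¬ (z ≢ i) → cnt z win * G z ^ K ≡ 0
        off z ¬¬ with z Fin.≟ i
        ... | yes _   = *-zeroʳ (cnt z win)
        ... | no  z≢i = contradiction z≢i ¬¬
      bad≤ : 8 * ∑ᵒ Rs (bad 0 Rs) ≤ H * X Rs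
      bad≤ with p ≟ 0
      ... | yes p≡0 = ≡≤-trans (cong (8 *_) (bad-single i G b′ D H (2 ^ a) Rs
              (≤-trans (s≤s z≤n) (*-monoʳ-≤ 16 (m^n>0 2 p)))
              (≤≡-trans (length-chunks ℓ P win) (cong (2 ^_) p≡0)))) z≤n
      ... | no  p≢0 = bad-few i G b′ P H (2 ^ a) Rs (m^n>0 2 a) (m^n>0 2 h) (m^n>0 2 p) (length-chunks ℓ P win)
        (≡≤-trans (cong (λ w → 32 * P * (32 * P) * ∑ w (λ z → G z * G z)) win≡)
        (≤≡-trans (∑-squares-bound win G k₀ (32 * P) H (phaseLength e) (m^n>0 2 h) win≤ (moment-bound p≢0 _ moment))
                 (cong (2 * (H * H) *_) (sym rows*length))))

-- The slot type that suits a heavy element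

cnt-take-+ : ∀ (i : Fin n) a b xs → cnt i (take a xs) + cnt i (take b (drop a xs)) ≡ cnt i (take (b + a) xs)
cnt-take-+ i a b xs = trans (go′ a xs) (cong (λ c → cnt i (take c xs)) (+-comm a b))
  where
  go′ : ∀ a xs → cnt i (take a xs) + cnt i (take b (drop a xs)) ≡ cnt i (take (a + b) xs)
  go′ zero    xs       = refl
  go′ (suc a) []       = cong (cnt i) (take-[] b)
  go′ (suc a) (x ∷ xs) = trans (+-assoc ⟦ does (x Fin.≟ i) ⟧ _ _) (cong (⟦ does (x Fin.≟ i) ⟧ +_) (go′ a xs))

cnt-≤-length : ∀ (i : Fin n) xs → cnt i xs ≤ length xs
cnt-≤-length i []       = z≤n
cnt-≤-length i (x ∷ xs) = +-mono-≤ (⟦⟧≤1 (does (x Fin.≟ i))) (cnt-≤-length i xs)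

n<2^n : ∀ n → n < 2 ^ n
n<2^n zero    = s≤s z≤n
n<2^n (suc n) = begin-strict
  suc n <⟨ s≤s (n<2^n n) ⟩
  1 + 2 ^ n ≤⟨ +-monoˡ-≤ (2 ^ n) (m^n>0 2 n) ⟩
  2 ^ n + 2 ^ n ≡⟨ cong (2 ^ n +_) (sym (+-identityʳ (2 ^ n))) ⟩
  2 ^ suc n ∎
  where open ≤-Reasoning

2^-cancel-< : ∀ {a b} → 2 ^ a < 2 ^ b → a < b
2^-cancel-< {a} {b} lt = ≰⇒> λ b≤a → <⇒≱ lt (2^-mono b≤a)

-- The power mean inequality up to a constant, for n ≤ R ^ k, by splitting the
-- frequencies y at R * y = f.
length-bound : ∀ (xs : List (Fin n)) i K R → 1 ≤ cnt i xs → 1 ≤ R → n ≤ R ^ suc K →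
               rest (suc K) xs i ≤ cnt i xs ^ suc K → length xs ≤ 3 * (R ^ K * cnt i xs)
length-bound {n} xs i K R f≥1 R≥1 n≤ rest≤ = begin
  length xs ≡⟨ sym (trans (∑-const xs 1) (*-identityʳ _)) ⟩
  ∑ xs (λ _ → 1) ≡⟨ ∑-cnt xs (λ _ → 1) ⟩
  ∑ (allFin n) (λ z → cnt z xs * 1) ≡⟨ ∑-cong (allFin n) split ⟩
  ∑ (allFin n) (λ z → ⟦ does (i Fin.≟ z) ⟧ * cnt z xs + away z) ≡⟨ ∑-+ (allFin n) _ away ⟩
  ∑ (allFin n) (λ z → ⟦ does (i Fin.≟ z) ⟧ * cnt z xs) + ∑ (allFin n) away
    ≤⟨ +-mono-≤ (≤-reflexive (∑-point i (λ z → cnt z xs))) (∑-filter-≤ (λ j → ¬? (j Fin.≟ i)) (allFin n) on off) ⟩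
  f + M ≤⟨ +-mono-≤ (≡≤-trans (sym (*-identityˡ f)) (*-monoˡ-≤ f (m^n>0 R {{>-nonZero R≥1}} K))) M≤ ⟩
  R ^ K * f + 2 * (R ^ K * f) ≡⟨ refl ⟩
  3 * (R ^ K * f) ∎
  where
  open ≤-Reasoning
  f = cnt i xs
  M = ∑ (others i) (λ z → cnt z xs)
  away : Fin n → ℕ
  away z = if does (i Fin.≟ z) then 0 else cnt z xs
  split : ∀ z → cnt z xs * 1 ≡ ⟦ does (i Fin.≟ z) ⟧ * cnt z xs + away z
  split z with does (i Fin.≟ z)
  ... | true  = trans (*-identityʳ _) (sym (trans (+-identityʳ _) (+-identityʳ _)))
  ... | false = *-identityʳ _
  on : ∀ z → z ≢ i → away z ≤ cnt z xs
  on z _ with does (i Fin.≟ z)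
  ... | true  = z≤n
  ... | false = ≤-refl
  off : ∀ z → ¬ (z ≢ i) → away z ≡ 0
  off z ¬¬ with i Fin.≟ z
  ... | yes _   = refl
  ... | no  i≢z = contradiction (λ z≡i → i≢z (sym z≡i)) ¬¬
  pointwise : ∀ y → R * y * f ^ K ≤ f ^ suc K + (R * y) ^ suc K
  pointwise y with ≤-total (R * y) f
  ... | inj₁ le = ≤-trans (*-monoˡ-≤ (f ^ K) le) (m≤m+n _ _)
  ... | inj₂ ge = ≤-trans (*-monoʳ-≤ (R * y) (^-monoˡ-≤ K ge)) (m≤n+m _ _)
  others≤n : length (others i) ≤ n
  others≤n = ≤≡-trans (List.length-filter (λ j → ¬? (j Fin.≟ i)) (allFin n)) (length-tabulate id)
  M≤ : M ≤ 2 * (R ^ K * f)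
  M≤ = *-cancelˡ-≤ (R * f ^ K) {{>-nonZero (*-mono-≤ R≥1 (m^n>0 f {{>-nonZero f≥1}} K))}} (begin
    R * f ^ K * M ≡⟨ sym (∑-*ˡ (R * f ^ K) (others i) _) ⟩
    ∑ (others i) (λ z → R * f ^ K * cnt z xs) ≤⟨ ∑-mono (others i) (λ z → ≡≤-trans (swap R (f ^ K) (cnt z xs)) (pointwise (cnt z xs))) ⟩
    ∑ (others i) (λ z → f ^ suc K + (R * cnt z xs) ^ suc K) ≡⟨ ∑-+ (others i) _ _ ⟩
    ∑ (others i) (λ _ → f ^ suc K) + ∑ (others i) (λ z → (R * cnt z xs) ^ suc K)
      ≡⟨ cong₂ _+_ (∑-const (others i) _) (trans (∑-cong (others i) (λ z → *-^ R (cnt z xs) (suc K))) (∑-*ˡ (R ^ suc K) (others i) _)) ⟩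
    length (others i) * f ^ suc K + R ^ suc K * rest (suc K) xs i
      ≤⟨ +-mono-≤ (*-monoˡ-≤ (f ^ suc K) (≤-trans others≤n n≤)) (*-monoʳ-≤ (R ^ suc K) rest≤) ⟩
    R ^ suc K * f ^ suc K + R ^ suc K * f ^ suc K ≡⟨ collect R (R ^ K) f (f ^ K) ⟩
    R * f ^ K * (2 * (R ^ K * f)) ∎)
    where
    swap : ∀ r x y → r * x * y ≡ r * y * x
    swap = solve-∀
    collect : ∀ r x f y → r * x * (f * y) + r * x * (f * y) ≡ r * y * (2 * (x * f))
    collect = solve-∀

module Choice (k₀ E : ℕ) (i₀ : Fin n) (A : ℕ) where
  -- `2 ^ c₀` is the loss from measuring the frequency by `Q ^ φ`: a factor `E < 2 ^ E` for
  -- `f ≤ g * E` and a factor Q for `g < Q ^ (φ + 1)`, both to the power k.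
  c₀ : ℕ
  c₀ = (E + 3 * (2 + k₀)) * (3 + k₀)

  open Schedule k₀ (c₀ + 7)
  open Chance i₀ A
  open Find k₀ c₀ i₀ A

  4≤2^κ : 4 ≤ 2 ^ κ
  4≤2^κ = 2^-mono {2} {κ} (≤-trans (m≤m+n 2 k₀) (m≤n*m (2 + k₀) 3))

  phaseLength-suc : ∀ e → phaseLength (suc e) ≡ 2 ^ κ * phaseLength e
  phaseLength-suc e = trans (cong (2 ^_) (*-suc κ e)) (^-distribˡ-+-* 2 κ (κ * e))

  -- Geometric growth with ratio at least 4. Consequently fewer than half of any `Q ^ e` occurrences
  -- can precede phase `e`.
  phaseStart-small : ∀ e → 2 * phaseStart e < phaseLength e
  phaseStart-small zero    = m^n>0 2 (κ * 0)
  phaseStart-small (suc e) = begin-strict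
    2 * (phaseLength e + phaseStart e) ≡⟨ *-distribˡ-+ 2 (phaseLength e) _ ⟩
    2 * phaseLength e + 2 * phaseStart e <⟨ +-monoʳ-< (2 * phaseLength e) (phaseStart-small e) ⟩
    2 * phaseLength e + phaseLength e ≤⟨ m≤m+n _ (phaseLength e) ⟩
    2 * phaseLength e + phaseLength e + phaseLength e ≡⟨ four (phaseLength e) ⟩
    4 * phaseLength e ≤⟨ *-monoˡ-≤ (phaseLength e) 4≤2^κ ⟩
    2 ^ κ * phaseLength e ≡⟨ sym (phaseLength-suc e) ⟩
    phaseLength (suc e) ∎
    where
    open ≤-Reasoning
    four : ∀ x → 2 * x + x + x ≡ 4 * x
    four = solve-∀

  phaseStart<phaseLength : ∀ e → phaseStart e < phaseLength e
  phaseStart<phaseLength e = ≤-<-trans (m≤m+n (phaseStart e) _) (phaseStart-small e)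

  scale : ∀ g → 1 ≤ g → Σ[ φ ∈ ℕ ] (phaseLength φ ≤ g × g < phaseLength (suc φ))
  scale g g≥1 = search g (≤-trans (n<2^n g) (2^-mono (m≤n*m g κ)))
    where
    search : ∀ N → g < phaseLength N → Σ[ φ ∈ ℕ ] (phaseLength φ ≤ g × g < phaseLength (suc φ))
    search zero    lt = contradiction (≤-trans g≥1 (≤-pred (≤≡-trans lt (cong (2 ^_) (*-zeroʳ κ))))) λ ()
    search (suc N) lt with phaseLength N ≤? g
    ... | yes le = N , le , lt
    ... | no  ≰  = search N (≰⇒> ≰)

  module _ (xs : List (Fin n)) (i : Fin n) where
    quota : ℕ → ℕ → ℕ
    quota φ l = 2 ^ (κ * φ ∸ (l + 2))

    seen : ℕ → ℕ
    seen e = cnt i (take (phaseStart e) xs)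

    -- The phase must contain its quota, and the quota must lie within the first `g` occurrences, so
    -- that a count started there misses fewer than `g`.
    Share : ℕ → ℕ → ℕ → Set
    Share g φ Y = Σ[ e ∈ ℕ ] Σ[ l ∈ ℕ ]
      (e + l ≡ Y × φ ≤ e × seen e + quota φ l ≤ seen (suc e) × seen e + quota φ l ≤ g)

    -- At least half of the first g occurrences come after phase φ begins, and the
    -- shares 2 ^ -(l + 2) of the phases Y ∸ l sum to less than one half.
    pigeonhole : ∀ g φ Y → phaseLength φ ≤ g → φ ≤ Y → g ≤ seen (suc Y) →
                 Share g φ Y
    pigeonhole g φ Y φ≤g φ≤Y g≤ = search (Y ∸ φ) φ (m+[n∸m]≡n φ≤Y) ≤-refl begun
      where
      open ≤-Reasoning
      -- Where truncation lifts the quota to 1 it may exceed the share `2 ^ -(l + 2)` of `g`;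
      -- integrality then takes the place of the estimate.
      share : ∀ l → quota φ l * 2 ^ (l + 2) ≤ g ⊎ quota φ l ≡ 1
      share l with ≤-total (l + 2) (κ * φ)
      ... | inj₁ le = inj₁ (≡≤-trans (trans (sym (^-distribˡ-+-* 2 (κ * φ ∸ (l + 2)) (l + 2))) (cong (2 ^_) (m∸n+n≡m le))) φ≤g)
      ... | inj₂ ge = inj₂ (cong (2 ^_) (m≤n⇒m∸n≡0 ge))
      begun : seen φ * 2 ^ (Y ∸ φ + 2) < g * (2 ^ (Y ∸ φ + 1) + 1)
      begun = begin-strict
        seen φ * 2 ^ (Y ∸ φ + 2) ≤⟨ *-monoˡ-≤ _ (≤-trans (cnt-≤-length i (take (phaseStart φ) xs)) (≡≤-trans (length-take (phaseStart φ) xs) (m⊓n≤m _ (length xs)))) ⟩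
        phaseStart φ * 2 ^ (Y ∸ φ + 2) ≡⟨ cong (phaseStart φ *_) (^-distribˡ-+-* 2 (Y ∸ φ) 2) ⟩
        phaseStart φ * (2 ^ (Y ∸ φ) * 4) ≡⟨ e₁ (phaseStart φ) (2 ^ (Y ∸ φ)) ⟩
        2 * phaseStart φ * (2 ^ (Y ∸ φ) * 2) <⟨ *-monoˡ-< (2 ^ (Y ∸ φ) * 2) {{>-nonZero (*-mono-≤ (m^n>0 2 (Y ∸ φ)) (s≤s {0} {1} z≤n))}} (≤-trans (phaseStart-small φ) φ≤g) ⟩
        g * (2 ^ (Y ∸ φ) * 2) ≡⟨ cong (g *_) (sym (^-distribˡ-+-* 2 (Y ∸ φ) 1)) ⟩
        g * 2 ^ (Y ∸ φ + 1) ≤⟨ *-monoʳ-≤ g (m≤m+n _ 1) ⟩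
        g * (2 ^ (Y ∸ φ + 1) + 1) ∎
        where
        e₁ : ∀ p x → p * (x * 4) ≡ 2 * p * (x * 2)
        e₁ = solve-∀
      double : ∀ l → 2 ^ (l + 1) + 2 ^ (l + 1) ≡ 2 ^ (l + 2)
      double l = trans (cong (2 ^ (l + 1) +_) (sym (+-identityʳ (2 ^ (l + 1))))) (cong (2 ^_) (sym (+-suc l 1)))
      fits : ∀ l s H → s * 2 ^ (l + 2) < g * (2 ^ (l + 1) + 1) → H * 2 ^ (l + 2) ≤ g ⊎ H ≡ 1 → s + H ≤ g
      fits l s H lt (inj₁ le) = *-cancelʳ-≤ _ _ (2 ^ (l + 2)) {{m^n≢0 2 (l + 2)}} (begin
        (s + H) * 2 ^ (l + 2) ≡⟨ *-distribʳ-+ (2 ^ (l + 2)) s H ⟩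
        s * 2 ^ (l + 2) + H * 2 ^ (l + 2) ≤⟨ +-mono-≤ (<⇒≤ lt) le ⟩
        g * (2 ^ (l + 1) + 1) + g ≡⟨ e₁ g (2 ^ (l + 1)) ⟩
        g * (2 ^ (l + 1) + 2) ≤⟨ *-monoʳ-≤ g (+-monoʳ-≤ (2 ^ (l + 1)) (2^-mono {1} {l + 1} (m≤n+m 1 l))) ⟩
        g * (2 ^ (l + 1) + 2 ^ (l + 1)) ≡⟨ cong (g *_) (double l) ⟩
        g * 2 ^ (l + 2) ∎)
        where
        e₁ : ∀ g x → g * (x + 1) + g ≡ g * (x + 2)
        e₁ = solve-∀
      fits l s H lt (inj₂ refl) = ≡≤-trans (+-comm s 1) (*-cancelʳ-< (2 ^ (l + 2)) _ _ (begin-strict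
        s * 2 ^ (l + 2) <⟨ lt ⟩
        g * (2 ^ (l + 1) + 1) ≤⟨ *-monoʳ-≤ g (+-monoʳ-≤ (2 ^ (l + 1)) (m^n>0 2 (l + 1))) ⟩
        g * (2 ^ (l + 1) + 2 ^ (l + 1)) ≡⟨ cong (g *_) (double l) ⟩
        g * 2 ^ (l + 2) ∎))
      misses : ∀ l s s′ H → s * 2 ^ (l + 2) < g * (2 ^ (l + 1) + 1) → H * 2 ^ (l + 2) ≤ g ⊎ H ≡ 1 →
               s′ < s + H → s′ * 2 ^ (l + 1) < g * (2 ^ l + 1)
      misses l s s′ H lt sh s′< = *-cancelʳ-< 2 _ _ (begin-strict
        s′ * 2 ^ (l + 1) * 2 ≡⟨ trans (*-assoc s′ _ 2) (cong (s′ *_) (trans (*-comm (2 ^ (l + 1)) 2) (cong (2 ^_) (sym (+-suc l 1))))) ⟩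
        s′ * 2 ^ (l + 2) <⟨ bound sh ⟩
        g * (2 ^ (l + 1) + 2) ≡⟨ cong (λ x → g * (x + 2)) (^-distribˡ-+-* 2 l 1) ⟩
        g * (2 ^ l * 2 + 2) ≡⟨ e₁ g (2 ^ l) ⟩
        g * (2 ^ l + 1) * 2 ∎)
        where
        e₁ : ∀ g x → g * (x * 2 + 2) ≡ g * (x + 1) * 2
        e₁ = solve-∀
        e₂ : ∀ g x → g * (x + 1) + g ≡ g * (x + 2)
        e₂ = solve-∀
        bound : H * 2 ^ (l + 2) ≤ g ⊎ H ≡ 1 → s′ * 2 ^ (l + 2) < g * (2 ^ (l + 1) + 2)
        bound (inj₁ le) = begin-strict
          s′ * 2 ^ (l + 2) ≤⟨ *-monoˡ-≤ (2 ^ (l + 2)) (<⇒≤ s′<) ⟩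
          (s + H) * 2 ^ (l + 2) ≡⟨ *-distribʳ-+ (2 ^ (l + 2)) s H ⟩
          s * 2 ^ (l + 2) + H * 2 ^ (l + 2) <⟨ +-mono-<-≤ lt le ⟩
          g * (2 ^ (l + 1) + 1) + g ≡⟨ e₂ g (2 ^ (l + 1)) ⟩
          g * (2 ^ (l + 1) + 2) ∎
        bound (inj₂ refl) = begin-strict
          s′ * 2 ^ (l + 2) ≤⟨ *-monoˡ-≤ (2 ^ (l + 2)) (≤-pred (≤≡-trans s′< (+-comm s 1))) ⟩
          s * 2 ^ (l + 2) <⟨ lt ⟩
          g * (2 ^ (l + 1) + 1) ≤⟨ *-monoʳ-≤ g (+-monoʳ-≤ (2 ^ (l + 1)) (s≤s z≤n)) ⟩
          g * (2 ^ (l + 1) + 2) ∎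
      -- Invariant: `seen e` is below `1/2 + 2 ^ -(l + 2)` of `g`. A phase that misses its quota
      -- adds less than `2 ^ -(l + 2)` of `g`, or nothing if the quota is 1, and passes the
      -- invariant on. A miss at `l = 0` would leave fewer than `g` occurrences by the end of phase
      -- `Y`.
      search : ∀ l e → e + l ≡ Y → φ ≤ e → seen e * 2 ^ (l + 2) < g * (2 ^ (l + 1) + 1) →
               Share g φ Y
      search l e eq φ≤e inv with seen e + quota φ l ≤? seen (suc e)
      ... | yes le = e , l , eq , φ≤e , le , fits l (seen e) _ inv (share l)
      search (suc l) e eq φ≤e inv | no ≰ = search l (suc e) (trans (sym (+-suc e l)) eq) (m≤n⇒m≤1+n φ≤e)
        (≤-<-trans (≤-reflexive (cong (λ z → seen (suc e) * 2 ^ z) (+-suc l 1)))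
          (<-≤-trans (misses (suc l) (seen e) _ _ inv (share (suc l)) (≰⇒> ≰))
            (≤-reflexive (cong (λ z → g * (2 ^ z + 1)) (+-comm 1 l)))))
      search zero e eq φ≤e inv | no ≰ = contradiction g≤ (<⇒≱ (subst (λ e → seen (suc e) < g) (trans (sym (+-identityʳ e)) eq)
        (*-cancelʳ-< 2 _ _ (misses 0 (seen e) _ _ inv (share 0) (≰⇒> ≰)))))

    private
      -- Limits the types that have to be provided. For `R = 8 ^ r` the power `R ^ (k - 1)` is
      -- `Q ^ r`, so the stream is no longer than `3 * E * Q ^ r * Q ^ (φ + 1)`; the constant
      -- `3 * E` is crudely absorbed by `Q ^ (3 * E)`.
      Y-bound : ∀ r g φ → 1 ≤ E → 1 ≤ cnt i xs → rest (3 + k₀) xs i ≤ cnt i xs ^ (3 + k₀) →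
                n ≤ (2 ^ (3 * r)) ^ (3 + k₀) → cnt i xs ≤ g * E → g < phaseLength (suc φ) →
                ∀ Y → phaseStart Y < length xs → Y ≤ φ + (r + 3 * E + 1)
      Y-bound r g φ 1≤E f≥1 rest≤ n≤ f≤gE g<φ zero    lt = z≤n
      Y-bound r g φ 1≤E f≥1 rest≤ n≤ f≤gE g<φ (suc Y) lt =
        ≤≡-trans (*-cancelˡ-< κ Y (3 * E + (r + suc φ)) (2^-cancel-< {κ * Y} {κ * (3 * E + (r + suc φ))} below))
                (reorder (3 * E) r φ)
        where
        open ≤-Reasoning
        shuffle : ∀ a b c → 3 * (a * (b * c)) ≡ 3 * c * (a * b)
        shuffle = solve-∀
        swap : ∀ r k → 3 * r * (2 + k) ≡ 3 * (2 + k) * r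
        swap = solve-∀
        factor : ∀ k a b c → k * a + (k * b + k * c) ≡ k * (a + (b + c))
        factor = solve-∀
        reorder : ∀ a r p → a + (r + suc p) ≡ p + (r + a + 1)
        reorder = solve-∀
        RK = (2 ^ (3 * r)) ^ (2 + k₀)
        RK≡ : RK ≡ 2 ^ (κ * r)
        RK≡ = trans (^-*-assoc 2 (3 * r) (2 + k₀)) (cong (2 ^_) (swap r k₀))
        below : 2 ^ (κ * Y) < 2 ^ (κ * (3 * E + (r + suc φ)))
        below = begin-strict
          2 ^ (κ * Y) ≤⟨ m≤m+n (2 ^ (κ * Y)) (phaseStart Y) ⟩
          phaseStart (suc Y) <⟨ lt ⟩
          length xs ≤⟨ length-bound xs i (2 + k₀) (2 ^ (3 * r)) f≥1 (m^n>0 2 (3 * r)) n≤ rest≤ ⟩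
          3 * (RK * cnt i xs) ≤⟨ *-monoʳ-≤ 3 (*-monoʳ-≤ RK (≤-trans f≤gE (*-monoˡ-≤ E (<⇒≤ g<φ)))) ⟩
          3 * (RK * (phaseLength (suc φ) * E)) ≡⟨ shuffle RK (phaseLength (suc φ)) E ⟩
          3 * E * (RK * phaseLength (suc φ)) ≤⟨ *-monoˡ-≤ (RK * phaseLength (suc φ)) (≤-trans (<⇒≤ (n<2^n (3 * E))) (2^-mono (m≤n*m (3 * E) κ))) ⟩
          2 ^ (κ * (3 * E)) * (RK * phaseLength (suc φ)) ≡⟨ cong (λ z → 2 ^ (κ * (3 * E)) * (z * phaseLength (suc φ))) RK≡ ⟩
          2 ^ (κ * (3 * E)) * (2 ^ (κ * r) * 2 ^ (κ * suc φ))
            ≡⟨ cong (2 ^ (κ * (3 * E)) *_) (sym (^-distribˡ-+-* 2 (κ * r) (κ * suc φ))) ⟩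
          2 ^ (κ * (3 * E)) * 2 ^ (κ * r + κ * suc φ) ≡⟨ sym (^-distribˡ-+-* 2 (κ * (3 * E)) (κ * r + κ * suc φ)) ⟩
          2 ^ (κ * (3 * E) + (κ * r + κ * suc φ)) ≡⟨ cong (2 ^_) (factor κ (3 * E) r (suc φ)) ⟩
          2 ^ (κ * (3 * E + (r + suc φ))) ∎

      rest-bound : ∀ g φ → rest (3 + k₀) xs i ≤ cnt i xs ^ (3 + k₀) → cnt i xs ≤ g * E → g < phaseLength (suc φ) →
                   rest (3 + k₀) xs i ≤ 2 ^ c₀ * 2 ^ (κ * φ * (3 + k₀))
      rest-bound g φ rest≤ f≤gE g<φ = begin
        rest (3 + k₀) xs i ≤⟨ rest≤ ⟩
        cnt i xs ^ (3 + k₀) ≤⟨ ^-monoˡ-≤ (3 + k₀) (≤-trans f≤gE (*-mono-≤ (<⇒≤ g<φ) (<⇒≤ (n<2^n E)))) ⟩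
        (2 ^ (κ * suc φ) * 2 ^ E) ^ (3 + k₀) ≡⟨ cong (_^ (3 + k₀)) (sym (^-distribˡ-+-* 2 (κ * suc φ) E)) ⟩
        (2 ^ (κ * suc φ + E)) ^ (3 + k₀) ≡⟨ ^-*-assoc 2 (κ * suc φ + E) (3 + k₀) ⟩
        2 ^ ((κ * suc φ + E) * (3 + k₀)) ≡⟨ cong (2 ^_) (expand κ φ E (3 + k₀)) ⟩
        2 ^ ((E + κ) * (3 + k₀) + κ * φ * (3 + k₀)) ≡⟨ ^-distribˡ-+-* 2 c₀ (κ * φ * (3 + k₀)) ⟩
        2 ^ c₀ * 2 ^ (κ * φ * (3 + k₀)) ∎
        where
        open ≤-Reasoning
        expand : ∀ κ φ E k → (κ * suc φ + E) * k ≡ (E + κ) * k + κ * φ * k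
        expand = solve-∀

      located : ∀ b φ e l ρ → l ≤ ρ → φ + ρ ≡ e + l → κ * e ≤ A →
                phaseStart e < length xs → length xs ≤ phaseStart (suc (e + l)) →
                seen e + quota φ l ≤ seen (suc e) → seen e + quota φ l ≤ suc b →
                rest (3 + k₀) xs i ≤ 2 ^ c₀ * 2 ^ (κ * φ * (3 + k₀)) →
                Wins xs i b ρ l (e % suc l)
      located b φ e l ρ l≤ρ φ+ρ κe≤A e<m m≤ share≤ fits≤ rest≤ =
        subst (λ ys → Wins ys i b ρ l (e % suc l)) xs≡
          (slot-finds e l ρ φ l≤ρ φ+ρ i b pre win post κe≤A
            (trans (length-take (phaseStart e) xs) (m≤n⇒m⊓n≡m (<⇒≤ e<m)))
            (≡≤-trans (length-take (phaseLength e) tail) (m⊓n≤m (phaseLength e) (length tail)))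
            post?
            (≡≤-trans (cong length xs≡) m≤)
            H≤ fits≤
            (≡≤-trans (cong (λ ys → rest (3 + k₀) ys i) xs≡) rest≤))
        where
        pre win post tail : List (Fin n)
        pre  = take (phaseStart e) xs
        tail = drop (phaseStart e) xs
        win  = take (phaseLength e) tail
        post = drop (phaseLength e) tail
        xs≡ : pre ++ win ++ post ≡ xs
        xs≡ = trans (cong (pre ++_) (take++drop≡id (phaseLength e) tail)) (take++drop≡id (phaseStart e) xs)
        post? : post ≡ [] ⊎ length win ≡ phaseLength e
        post? with ≤-total (phaseLength e) (length tail)
        ... | inj₁ le = inj₂ (trans (length-take (phaseLength e) tail) (m≤n⇒m⊓n≡m le))
        ... | inj₂ ge = inj₁ (drop-all (phaseLength e) tail ge)
        H≤ : quota φ l ≤ cnt i win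
        H≤ = +-cancelˡ-≤ (seen e) _ _ (≤≡-trans share≤
          (sym (cnt-take-+ i (phaseStart e) (phaseLength e) xs)))

      last-phase : 1 ≤ length xs → Σ[ Y ∈ ℕ ] (phaseStart Y < length xs × length xs ≤ phaseStart (suc Y))
      last-phase m≥1 with length xs | m≥1
      ... | suc m | _ with clock m | clock-invariant m
      ...   | Y , pos | eq , lt = Y , s≤s (≤≡-trans (m≤n+m _ pos) (sym eq)) ,
                                  ≤-trans (s≤s (≤-reflexive eq)) (+-monoˡ-≤ (phaseStart Y) lt)

    HeavySlot : ℕ → Set
    HeavySlot r = Σ[ ρ ∈ ℕ ] Σ[ l ∈ ℕ ] Σ[ j ∈ ℕ ] Σ[ b ∈ ℕ ]
      (l ≤ ρ × j ≤ l × ρ ≤ r + 3 * E + 1 × b * E < cnt i xs × Wins xs i b ρ l j)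

    heavy-slot : ∀ r → 1 ≤ E → 1 ≤ cnt i xs → rest (3 + k₀) xs i ≤ cnt i xs ^ (3 + k₀) →
      n ≤ (2 ^ (3 * r)) ^ (3 + k₀) → (∀ e → phaseStart e < length xs → κ * e ≤ A) → HeavySlot r
    heavy-slot r 1≤E f≥1 rest≤ n≤ A≥ =
      conclude (scale g (s≤s z≤n)) (last-phase (≤-trans f≥1 (cnt-≤-length i xs)))
      where
      open ≤-Reasoning
      f b g : ℕ
      f = cnt i xs
      instance
        E≢0 : NonZero E
        E≢0 = >-nonZero 1≤E
      b = pred f / E
      g = suc b
      sucf : suc (pred f) ≡ f
      sucf = suc-pred f {{>-nonZero f≥1}}
      bE<f : b * E < f
      bE<f = ≤≡-trans (s≤s (m/n*n≤m (pred f) E)) sucf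
      f≤gE : f ≤ g * E
      f≤gE = begin
        f ≡⟨ sym sucf ⟩
        suc (pred f) ≡⟨ cong suc (m≡m%n+[m/n]*n (pred f) E) ⟩
        suc (pred f % E) + b * E ≤⟨ +-monoˡ-≤ (b * E) (m%n<n (pred f) E) ⟩
        g * E ∎
      g≤f : g ≤ f
      g≤f = ≤-<-trans (m≤m*n b E) bE<f
      finish : ∀ φ Y → g < phaseLength (suc φ) → phaseStart Y < length xs → length xs ≤ phaseStart (suc Y) → φ ≤ Y →
               Share g φ Y → HeavySlot r
      finish φ Y g<φ Y<m m≤Y φ≤Y (e , l , refl , φ≤e , share≤ , fits≤) =
        Y ∸ φ , l , e % suc l , b , l≤ρ , ≤-pred (m%n<n e (suc l)) ,
        ≤≡-trans (∸-monoˡ-≤ φ (Y-bound r g φ 1≤E f≥1 rest≤ n≤ f≤gE g<φ Y Y<m)) (m+n∸m≡n φ _) ,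
        bE<f ,
        located b φ e l (Y ∸ φ) l≤ρ (m+[n∸m]≡n φ≤Y) (A≥ e e<m) e<m m≤Y share≤ fits≤ (rest-bound g φ rest≤ f≤gE g<φ)
        where
        e<m : phaseStart e < length xs
        e<m = ≤-<-trans (phaseStart-mono (m≤m+n e l)) Y<m
        l≤ρ : l ≤ Y ∸ φ
        l≤ρ = +-cancelˡ-≤ φ _ _ (≤≡-trans (+-monoˡ-≤ l φ≤e) (sym (m+[n∸m]≡n φ≤Y)))
      conclude : Σ[ φ ∈ ℕ ] (phaseLength φ ≤ g × g < phaseLength (suc φ)) →
                 Σ[ Y ∈ ℕ ] (phaseStart Y < length xs × length xs ≤ phaseStart (suc Y)) → HeavySlot r
      conclude (φ , φ≤g , g<φ) (Y , Y<m , m≤Y) = finish φ Y g<φ Y<m m≤Y φ≤Y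
        (pigeonhole g φ Y φ≤g φ≤Y (≤≡-trans g≤f (cong (cnt i) (sym (take-all _ xs m≤Y)))))
        where
        φ≤Y : φ ≤ Y
        φ≤Y = ≤-pred (*-cancelˡ-< κ φ (suc Y) (2^-cancel-< {κ * φ} {κ * suc Y} (begin-strict
          phaseLength φ ≤⟨ φ≤g ⟩
          g ≤⟨ ≤-trans g≤f (≤-trans (cnt-≤-length i xs) m≤Y) ⟩
          phaseStart (suc Y) <⟨ phaseStart<phaseLength (suc Y) ⟩
          phaseLength (suc Y) ∎)))

-- Independent slots

∏ : {A : Set} → List A → (A → ℕ) → ℕ
∏ []       f = 1
∏ (x ∷ xs) f = f x * ∏ xs f

∏-++ : {A : Set} (xs ys : List A) (f : A → ℕ) → ∏ (xs ++ ys) f ≡ ∏ xs f * ∏ ys f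
∏-++ []       ys f = sym (+-identityʳ _)
∏-++ (x ∷ xs) ys f = trans (cong (f x *_) (∏-++ xs ys f)) (sym (*-assoc (f x) _ _))

∏-replicate : {A : Set} (N : ℕ) (x : A) (f : A → ℕ) → ∏ (replicate N x) f ≡ f x ^ N
∏-replicate zero    x f = refl
∏-replicate (suc N) x f = cong (f x *_) (∏-replicate N x f)

∏-≤ : {A : Set} (xs : List A) {f : A → ℕ} {B : ℕ} → (∀ x → f x ≤ B) → ∏ xs f ≤ B ^ length xs
∏-≤ []       le = ≤-refl
∏-≤ (x ∷ xs) le = *-mono-≤ (le x) (∏-≤ xs le)

bernoulli : ∀ M t → M ^ suc t + suc t * M ^ t ≤ suc M ^ suc t
bernoulli M zero    = ≤-reflexive (e M)
  where
  e : ∀ M → M * 1 + (1 + 0) ≡ suc M * 1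
  e = solve-∀
bernoulli M (suc t) = begin
  M * (M * M ^ t) + suc (suc t) * (M * M ^ t) ≤⟨ m≤m+n _ (suc t * M ^ t) ⟩
  M * (M * M ^ t) + suc (suc t) * (M * M ^ t) + suc t * M ^ t ≡⟨ e M t (M ^ t) ⟩
  suc M * (M * M ^ t + suc t * M ^ t) ≤⟨ *-monoʳ-≤ (suc M) (bernoulli M t) ⟩
  suc M * suc M ^ suc t ∎
  where
  open ≤-Reasoning
  e : ∀ M t x → M * (M * x) + suc (suc t) * (M * x) + suc t * x ≡ suc M * (M * x + suc t * x)
  e = solve-∀

-- This is (1 - 1/N) ^ N ≤ 1/2: the first two terms of the binomial expansion of `(M + 1) ^ N` are
-- each at least `M ^ N` when `N = M + 1`.
halving : ∀ N w B → 1 ≤ N → N * w + B ≤ N * B → 2 * w ^ N ≤ B ^ N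
halving (suc M) w B _ le = *-cancelˡ-≤ (N ^ N) {{m^n≢0 N N}} (begin
  N ^ N * (2 * w ^ N) ≡⟨ e (N ^ N) (w ^ N) ⟩
  2 * (N ^ N * w ^ N) ≡⟨ cong (2 *_) (sym (*-^ N w N)) ⟩
  2 * (N * w) ^ N ≤⟨ *-monoʳ-≤ 2 (^-monoˡ-≤ N Nw≤) ⟩
  2 * (M * B) ^ N ≡⟨ cong (2 *_) (*-^ M B N) ⟩
  2 * (M ^ N * B ^ N) ≡⟨ sym (*-assoc 2 (M ^ N) _) ⟩
  2 * M ^ N * B ^ N ≤⟨ *-monoˡ-≤ (B ^ N) twice ⟩
  N ^ N * B ^ N ∎)
  where
  open ≤-Reasoning
  N = suc M
  e : ∀ x y → x * (2 * y) ≡ 2 * (x * y)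
  e = solve-∀
  Nw≤ : N * w ≤ M * B
  Nw≤ = +-cancelˡ-≤ B _ _ (≡≤-trans (+-comm B (N * w)) le)
  twice : 2 * M ^ N ≤ N ^ N
  twice = ≤-trans (+-monoʳ-≤ (M ^ N) (≡≤-trans (+-identityʳ _) (*-monoˡ-≤ (M ^ M) (n≤1+n M)))) (bernoulli M M)

copied : {A : Set} (N : A → ℕ) → List A → List A
copied N []       = []
copied N (q ∷ qs) = replicate (N q) q ++ copied N qs

-- The copies of `q` alone bring the factor 1/2; all other slots are bounded trivially.
∏-copied : ∀ {A : Set} (N : A → ℕ) (qs : List A) {q} (w : A → ℕ) B → (∀ q → w q ≤ B) → q ∈ qs →
           1 ≤ N q → N q * w q + B ≤ N q * B → 2 * ∏ (copied N qs) w ≤ B ^ length (copied N qs)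
∏-copied N (q ∷ qs) w B w≤ q∈ 1≤N le = begin
  2 * ∏ (replicate (N q) q ++ copied N qs) w ≡⟨ cong (2 *_) (trans (∏-++ (replicate (N q) q) _ w) (cong (_* ∏ (copied N qs) w) (∏-replicate (N q) q w))) ⟩
  2 * (w q ^ N q * ∏ (copied N qs) w) ≤⟨ here-or-there q∈ ⟩
  B ^ N q * B ^ length (copied N qs) ≡⟨ sym (^-distribˡ-+-* B (N q) _) ⟩
  B ^ (N q + length (copied N qs)) ≡⟨ cong (B ^_) (sym (trans (length-++ (replicate (N q) q)) (cong (_+ length (copied N qs)) (length-replicate (N q))))) ⟩
  B ^ length (replicate (N q) q ++ copied N qs) ∎
  where
  open ≤-Reasoning
  swap : ∀ x y → 2 * (x * y) ≡ x * (2 * y)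
  swap = solve-∀
  here-or-there : _ ∈ (q ∷ qs) → 2 * (w q ^ N q * ∏ (copied N qs) w) ≤ B ^ N q * B ^ length (copied N qs)
  here-or-there (here refl) = ≡≤-trans (sym (*-assoc 2 (w q ^ N q) _))
    (*-mono-≤ (halving (N q) (w q) B 1≤N le) (∏-≤ (copied N qs) w≤))
  here-or-there (there q∈qs) = ≡≤-trans (swap (w q ^ N q) _)
    (*-mono-≤ (^-monoˡ-≤ (N q) (w≤ q)) (∏-copied N qs w B w≤ q∈qs 1≤N le))

module Bank (k₀ c₁ : ℕ) (i₀ : Fin n) (A : ℕ) where
  open Schedule k₀ c₁
  open Chance i₀ A

  Slots : List Type → Set
  Slots qs = Vec (Slot n) (length qs)

  stepAll : Clock → (qs : List Type) → Vec Bool (length qs * A) → Fin n → Slots qs → Slots qs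
  stepAll clk []       cs p []       = []
  stepAll clk (q ∷ qs) cs p (s ∷ ss) =
    step (sched q clk) (Vec.take A cs) p s ∷ stepAll clk qs (Vec.drop A cs) p ss

  runAll : ∀ {m} → ℕ → (qs : List Type) → Vec (Vec Bool (length qs * A)) m → Vec (Fin n) m → Slots qs → Slots qs
  runAll t qs []       []      ss = ss
  runAll t qs (c ∷ cs) (p ∷ D) ss = runAll (suc t) qs cs D (stepAll (clock t) qs c p ss)

  -- For an indicator `φ` of failure, the indicator that every slot fails.
  prod : (Slot n → ℕ) → (qs : List Type) → Slots qs → ℕ
  prod φ []       []       = 1
  prod φ (q ∷ qs) (s ∷ ss) = φ s * prod φ qs ss

  prodW : ℕ → List (Fin n) → (Slot n → ℕ) → (qs : List Type) → Slots qs → ℕ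
  prodW t xs φ []       []       = 1
  prodW t xs φ (q ∷ qs) (s ∷ ss) = W (sched q ∘ clock) t xs φ s * prodW t xs φ qs ss

  prodW-[] : ∀ t φ qs ss → prodW t [] φ qs ss ≡ prod φ qs ss
  prodW-[] t φ []       []       = refl
  prodW-[] t φ (q ∷ qs) (s ∷ ss) = cong (φ s *_) (prodW-[] t φ qs ss)

  -- Independence: the coins of a step fall into disjoint blocks, one per slot, so the sum of the
  -- product is the product of the sums.
  prodW-step : ∀ t p xs φ qs ss →
    ∑ (bitBlocks (length qs * A)) (λ c → prodW (suc t) xs φ qs (stepAll (clock t) qs c p ss)) ≡
    prodW t (p ∷ xs) φ qs ss
  prodW-step t p xs φ []       []       = refl
  prodW-step t p xs φ (q ∷ qs) (s ∷ ss) = begin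
    ∑ (bitBlocks (A + length qs * A)) (λ c → F (Vec.take A c) (Vec.drop A c))
      ≡⟨ ∑-vectors-+ (true ∷ false ∷ []) A (length qs * A) F ⟩
    ∑ (bitBlocks A) (λ u → ∑ (bitBlocks (length qs * A)) (F u))
      ≡⟨ ∑-cong (bitBlocks A) (λ u → trans (∑-*ˡ (w u) (bitBlocks (length qs * A)) _) (cong (w u *_) (prodW-step t p xs φ qs ss))) ⟩
    ∑ (bitBlocks A) (λ u → w u * prodW t (p ∷ xs) φ qs ss)
      ≡⟨ ∑-*ʳ (bitBlocks A) w _ ⟩
    prodW t (p ∷ xs) φ (q ∷ qs) (s ∷ ss) ∎
    where
    open ≡-Reasoning
    w : Vec Bool A → ℕ
    w u = W (sched q ∘ clock) (suc t) xs φ (step (sched q (clock t)) u p s)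
    F : Vec Bool A → Vec Bool (length qs * A) → ℕ
    F u v = w u * prodW (suc t) xs φ qs (stepAll (clock t) qs v p ss)

  ∑-runAll : ∀ {m} t φ qs (D : Vec (Fin n) m) ss →
    ∑ (vectors (bitBlocks (length qs * A)) m) (λ cs → prod φ qs (runAll t qs cs D ss)) ≡
    prodW t (Vec.toList D) φ qs ss
  ∑-runAll t φ qs []      ss = trans (+-identityʳ _) (sym (prodW-[] t φ qs ss))
  ∑-runAll t φ qs (p ∷ D) ss = trans (∑-vectors-suc (bitBlocks (length qs * A)) _ _)
    (trans (∑-cong (bitBlocks (length qs * A)) (λ c → ∑-runAll (suc t) φ qs D (stepAll (clock t) qs c p ss)))
           (prodW-step t p (Vec.toList D) φ qs ss))

  initial : (qs : List Type) → Slots qs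
  initial qs = Vec.replicate (length qs) (empty i₀)

  prodW-initial : ∀ t xs φ qs → prodW t xs φ qs (initial qs) ≡ ∏ qs (λ q → W (sched q ∘ clock) t xs φ (empty i₀))
  prodW-initial t xs φ []       = refl
  prodW-initial t xs φ (q ∷ qs) = cong (W (sched q ∘ clock) t xs φ (empty i₀) *_) (prodW-initial t xs φ qs)

  better : Fin n × ℕ → Fin n × ℕ → Fin n × ℕ
  better (y , c) (z , d) = if c ≤ᵇ d then (z , d) else (y , c)

  best : (qs : List Type) → Slots qs → Fin n × ℕ
  best []       []                          = i₀ , 0
  best (q ∷ qs) (slot y c α z d w ∷ ss) = better (y , c) (better (z , d) (best qs ss))

  Counted : List (Fin n) → Fin n × ℕ → Set
  Counted xs (y , c) = c ≤ cnt y xs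

  better-counted : ∀ xs u v → Counted xs u → Counted xs v → Counted xs (better u v)
  better-counted xs (y , c) (z , d) cu cv with c ≤ᵇ d
  ... | true  = cv
  ... | false = cu

  better-≥ˡ : ∀ u v → proj₂ u ≤ proj₂ (better u v)
  better-≥ˡ (y , c) (z , d) with c ≤ᵇ d in eq
  ... | true  = ≤ᵇ-sound {c} {d} eq
  ... | false = ≤-refl

  better-≥ʳ : ∀ u v → proj₂ v ≤ proj₂ (better u v)
  better-≥ʳ (y , c) (z , d) with c ≤ᵇ d in eq
  ... | true  = ≤-refl
  ... | false = <⇒≤ (≰⇒> λ le → subst T eq (≤⇒≤ᵇ le))

  Sound : (Fin n → ℕ) → Slot n → Set
  Sound κ (slot y c α z d w) = c ≤ κ y × d ≤ κ z

  AllSlots : (Slot n → Set) → (qs : List Type) → Slots qs → Set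
  AllSlots P []       []       = ⊤
  AllSlots P (q ∷ qs) (s ∷ ss) = P s × AllSlots P qs ss

  allSlots-map : ∀ {P Q : Slot n → Set} qs ss → (∀ s → P s → Q s) → AllSlots P qs ss → AllSlots Q qs ss
  allSlots-map []       []       f _        = tt
  allSlots-map (q ∷ qs) (s ∷ ss) f (p , ps) = f s p , allSlots-map qs ss f ps

  allSlots-initial : ∀ {P : Slot n → Set} qs → P (empty i₀) → AllSlots P qs (initial qs)
  allSlots-initial []       p = tt
  allSlots-initial (q ∷ qs) p = p , allSlots-initial qs p

  allSlots-step : ∀ {P Q : Slot n → Set} clk qs cs p ss → (∀ q c s → P s → Q (step (sched q clk) c p s)) →
                  AllSlots P qs ss → AllSlots Q qs (stepAll clk qs cs p ss)
  allSlots-step clk []       cs p []       f _        = tt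
  allSlots-step clk (q ∷ qs) cs p (s ∷ ss) f (x , xs) =
    f q (Vec.take A cs) s x , allSlots-step clk qs (Vec.drop A cs) p ss f xs

  bump-≤ : ∀ (y p : Fin n) c → bump y p c ≤ ⟦ does (p Fin.≟ y) ⟧ + c
  bump-≤ y p zero    = z≤n
  bump-≤ y p (suc c) = ≤-refl

  tick-sound : ∀ κ p s → Sound κ s → Sound (λ y → ⟦ does (p Fin.≟ y) ⟧ + κ y) (tick p s)
  tick-sound κ p (slot y c α z d zero)          (cs , ds) =
    ≤-trans (bump-≤ y p c) (+-monoʳ-≤ ⟦ does (p Fin.≟ y) ⟧ cs) , ≤-trans (bump-≤ z p d) (+-monoʳ-≤ ⟦ does (p Fin.≟ z) ⟧ ds)
  tick-sound κ p (slot y c α z d (suc zero))    (cs , ds) =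
    ≤-trans (bump-≤ y p c) (+-monoʳ-≤ ⟦ does (p Fin.≟ y) ⟧ cs) ,
    ≡≤-trans (sym (cong ⟦_⟧ (≟-refl p))) (m≤m+n _ (κ p))
  tick-sound κ p (slot y c α z d (suc (suc w))) (cs , ds) =
    ≤-trans (bump-≤ y p c) (+-monoʳ-≤ ⟦ does (p Fin.≟ y) ⟧ cs) , ≤-trans (bump-≤ z p d) (+-monoʳ-≤ ⟦ does (p Fin.≟ z) ⟧ ds)

  contest-sound : ∀ κ D U s → Sound κ s → Sound κ (contest D U s)
  contest-sound κ D U (slot y c α z d w) (cs , ds) with D * c <? D * d + U * suc α
  ... | yes _ = ds , ds
  ... | no  _ = cs , ds

  start-sound : ∀ κ o s → Sound κ s → Sound κ (start o s)
  start-sound κ o (slot y c α z d w) (cs , ds) = cs , z≤n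

  step-sound : ∀ κ p I c s → Sound κ s → Sound (λ y → ⟦ does (p Fin.≟ y) ⟧ + κ y) (step I c p s)
  step-sound κ p go                  c s snd = tick-sound κ p s snd
  step-sound κ p (row true  a D U) c s snd = tick-sound κ p (start (fromBits a c) (contest D U (empty i₀))) (start-sound κ (fromBits a c) (contest D U (empty i₀)) (contest-sound κ D U (empty i₀) (z≤n , z≤n)))
  step-sound κ p (row false a D U) c s snd = tick-sound κ p (start (fromBits a c) (contest D U s)) (start-sound κ (fromBits a c) (contest D U s) (contest-sound κ D U s snd))

  runAll-sound : ∀ {m} κ t qs cs (D : Vec (Fin n) m) ss → AllSlots (Sound κ) qs ss →
                 AllSlots (Sound (λ y → cnt y (Vec.toList D) + κ y)) qs (runAll t qs cs D ss)
  runAll-sound κ t qs []       []      ss snd = snd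
  runAll-sound κ t qs (c ∷ cs) (p ∷ D) ss snd =
    allSlots-map qs _ shift
      (runAll-sound (λ y → ⟦ does (p Fin.≟ y) ⟧ + κ y) (suc t) qs cs D _
        (allSlots-step (clock t) qs c p ss (λ q b s → step-sound κ p (sched q (clock t)) b s) snd))
    where
    shift : ∀ s → Sound (λ y → cnt y (Vec.toList D) + (⟦ does (p Fin.≟ y) ⟧ + κ y)) s →
            Sound (λ y → cnt y (Vec.toList (p ∷ D)) + κ y) s
    shift (slot y c α z d w) (cs , ds) =
      ≤≡-trans cs (+-swap (cnt y (Vec.toList D)) _ (κ y)) , ≤≡-trans ds (+-swap (cnt z (Vec.toList D)) _ (κ z))

  best-counted : ∀ xs qs ss → AllSlots (Sound (λ y → cnt y xs + 0)) qs ss → Counted xs (best qs ss)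
  best-counted xs []       []                      _                 = z≤n
  best-counted xs (q ∷ qs) (slot y c α z d w ∷ ss) ((cs , ds) , snd) =
    better-counted xs (y , c) (better (z , d) (best qs ss)) (≤≡-trans cs (+-identityʳ _))
      (better-counted xs (z , d) (best qs ss) (≤≡-trans ds (+-identityʳ _)) (best-counted xs qs ss snd))

  misses? : Fin n → (f b : ℕ) → Slot n → ℕ
  misses? i f b s = ⟦ not (found? i f b s) ⟧

  found-score : ∀ i f b (s : Slot n) → found? i f b s ≡ true → f ≤ Slot.score s + b ⊎ f ≤ Slot.chalScore s + b
  found-score i f b (slot y c α z d w) eq
    with does (y Fin.≟ i) | does (z Fin.≟ i) | f ≤ᵇ c + b in e₁ | f ≤ᵇ d + b in e₂
  ... | _     | _     | true  | _     = inj₁ (≤ᵇ-sound {f} e₁)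
  ... | _     | _     | false | true  = inj₂ (≤ᵇ-sound {f} e₂)
  ... | false | false | false | false = contradiction eq λ ()
  ... | false | true  | false | false = contradiction eq λ ()
  ... | true  | false | false | false = contradiction eq λ ()
  ... | true  | true  | false | false = contradiction eq λ ()

  -- Only the size of the largest count is concluded. It may come from another slot than the
  -- successful one; that it belongs to i follows later from heaviness.
  found-best : ∀ i f b qs ss → prod (misses? i f b) qs ss ≡ 0 → f ≤ proj₂ (best qs ss) + b
  found-best i f b []       []       ()
  found-best i f b (q ∷ qs) (s@(slot y c α z d w) ∷ ss) eq with found? i f b s in found
  ... | false = ≤-trans (found-best i f b qs ss (trans (sym (+-identityʳ _)) eq))
                  (+-monoˡ-≤ b (≤-trans (better-≥ʳ (z , d) (best qs ss)) (better-≥ʳ (y , c) _)))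
  ... | true with found-score i f b s found
  ...   | inj₁ le = ≤-trans le (+-monoˡ-≤ b (better-≥ˡ (y , c) _))
  ...   | inj₂ le = ≤-trans le (+-monoˡ-≤ b (≤-trans (better-≥ˡ (z , d) (best qs ss)) (better-≥ʳ (y , c) _)))

-- Encoding of the state and the algorithm

toBits : (w : ℕ) → ℕ → Vec Bool w
toBits zero    x = []
toBits (suc w) x with 2 ^ w ≤? x
... | yes _ = true ∷ toBits w (x ∸ 2 ^ w)
... | no  _ = false ∷ toBits w x

fromBits-toBits : ∀ w {x} → x < 2 ^ w → fromBits w (toBits w x) ≡ x
fromBits-toBits zero    {x} lt = sym (n≤0⇒n≡0 (≤-pred lt))
fromBits-toBits (suc w) {x} lt with 2 ^ w ≤? x
... | yes le = trans (cong (2 ^ w +_) (fromBits-toBits w (≤≡-trans (∸-monoˡ-< lt le) (trans (m+n∸m≡n (2 ^ w) _) (+-identityʳ _)))))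
                     (m+[n∸m]≡n le)
... | no ≰   = fromBits-toBits w (≰⇒> ≰)

fromBits-< : ∀ a {A} (v : Vec Bool A) → fromBits a v < 2 ^ a
fromBits-< zero    v           = s≤s z≤n
fromBits-< (suc a) []          = m^n>0 2 (suc a)
fromBits-< (suc a) (true ∷ v)  = <-≤-trans (+-monoʳ-< (2 ^ a) (fromBits-< a v)) (≤-reflexive (cong (2 ^ a +_) (sym (+-identityʳ _))))
fromBits-< (suc a) (false ∷ v) = <-≤-trans (fromBits-< a v) (m≤m+n (2 ^ a) _)

take-++ : ∀ {X : Set} {a b} (u : Vec X a) (v : Vec X b) → Vec.take a (u Vec.++ v) ≡ u
take-++ []      v = refl
take-++ (x ∷ u) v = cong (x ∷_) (take-++ u v)

drop-++ : ∀ {X : Set} {a b} (u : Vec X a) (v : Vec X b) → Vec.drop a (u Vec.++ v) ≡ v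
drop-++ []      v = refl
drop-++ (x ∷ u) v = drop-++ u v

module _ {X : Set} {a : ℕ} (enc : X → Vec Bool a) (dec : Vec Bool a → X) where

  encode : ∀ {S} → Vec X S → Vec Bool (S * a)
  encode []       = []
  encode (x ∷ xs) = enc x Vec.++ encode xs

  decode : ∀ S → Vec Bool (S * a) → Vec X S
  decode zero    v = []
  decode (suc S) v = dec (Vec.take a v) ∷ decode S (Vec.drop a v)

  decode-encode : ∀ {P : X → Set} → (∀ x → P x → dec (enc x) ≡ x) →
                  ∀ {S} (xs : Vec X S) → VAll.All P xs → decode S (encode xs) ≡ xs
  decode-encode ok []       VAll.[]       = refl
  decode-encode ok (x ∷ xs) (p VAll.∷ ps) = cong₂ _∷_
    (trans (cong dec (take-++ (enc x) (encode xs))) (ok x p))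
    (trans (cong (decode _) (drop-++ (enc x) (encode xs))) (decode-encode ok xs ps))

module Memory (i₀ : Fin n) (w : ℕ) where

  toFin : ℕ → Fin n
  toFin x with x <? n
  ... | yes lt = fromℕ< lt
  ... | no  _  = i₀

  toFin-toℕ : ∀ (y : Fin n) → toFin (toℕ y) ≡ y
  toFin-toℕ y with toℕ y <? n
  ... | yes lt = Fin.fromℕ<-toℕ y lt
  ... | no  ≮  = contradiction (Fin.toℕ<n y) ≮

  fields : Slot n → Vec ℕ 6
  fields (slot y c α z d w) = toℕ y ∷ c ∷ α ∷ toℕ z ∷ d ∷ w ∷ []

  fromFields : Vec ℕ 6 → Slot n
  fromFields (y ∷ c ∷ α ∷ z ∷ d ∷ w ∷ []) = slot (toFin y) c α (toFin z) d w

  encodeNats : ∀ {S} → Vec ℕ S → Vec Bool (S * w)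
  encodeNats = encode (toBits w) (fromBits w)

  decodeNats : ∀ S → Vec Bool (S * w) → Vec ℕ S
  decodeNats = decode (toBits w) (fromBits w)

  decodeNats-encodeNats : ∀ {S} (xs : Vec ℕ S) → VAll.All (_< 2 ^ w) xs → decodeNats S (encodeNats xs) ≡ xs
  decodeNats-encodeNats = decode-encode (toBits w) (fromBits w) (λ x → fromBits-toBits w)

  encodeSlot : Slot n → Vec Bool (6 * w)
  encodeSlot s = encodeNats (fields s)

  decodeSlot : Vec Bool (6 * w) → Slot n
  decodeSlot v = fromFields (decodeNats 6 v)

  Small : Slot n → Set
  Small s = VAll.All (_< 2 ^ w) (fields s)

  decodeSlot-encodeSlot : ∀ s → Small s → decodeSlot (encodeSlot s) ≡ s
  decodeSlot-encodeSlot s@(slot y c α z d w) small = trans (cong fromFields (decodeNats-encodeNats (fields s) small))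
    (cong₂ (λ y z → slot y c α z d w) (toFin-toℕ y) (toFin-toℕ z))

  encodeState : ∀ {S} → ℕ × ℕ → Vec (Slot n) S → Vec Bool (2 * w + S * (6 * w))
  encodeState (e , pos) ss = encodeNats (e ∷ pos ∷ []) Vec.++ encode encodeSlot decodeSlot ss

  pairUp : Vec ℕ 2 → ℕ × ℕ
  pairUp (e ∷ pos ∷ []) = e , pos

  decodeClock : ∀ S → Vec Bool (2 * w + S * (6 * w)) → ℕ × ℕ
  decodeClock S v = pairUp (decodeNats 2 (Vec.take (2 * w) v))

  decodeSlots : ∀ S → Vec Bool (2 * w + S * (6 * w)) → Vec (Slot n) S
  decodeSlots S v = decode encodeSlot decodeSlot S (Vec.drop (2 * w) v)

  decodeClock-encodeState : ∀ {S} e pos (ss : Vec (Slot n) S) → e < 2 ^ w → pos < 2 ^ w →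
                            decodeClock S (encodeState (e , pos) ss) ≡ (e , pos)
  decodeClock-encodeState e pos ss e< pos< = cong pairUp
    (trans (cong (decodeNats 2) (take-++ (encodeNats (e ∷ pos ∷ [])) _))
           (decodeNats-encodeNats (e ∷ pos ∷ []) (e< VAll.∷ (pos< VAll.∷ VAll.[]))))

  decodeSlots-encodeState : ∀ {S} clk (ss : Vec (Slot n) S) → VAll.All Small ss →
                            decodeSlots S (encodeState clk ss) ≡ ss
  decodeSlots-encodeState {S} (e , pos) ss small =
    trans (cong (decode encodeSlot decodeSlot S) (drop-++ (encodeNats (e ∷ pos ∷ [])) _))
          (decode-encode encodeSlot decodeSlot decodeSlot-encodeSlot ss small)

module Algorithm (k₀ c₁ : ℕ) (i₀ : Fin n) (A : ℕ) (qs : List (ℕ × ℕ × ℕ)) where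
  open Schedule k₀ c₁
  open Chance i₀ A
  open Bank k₀ c₁ i₀ A
  open Memory i₀ (suc A)

  private
    S : ℕ
    S = length qs

  present : Fin n × ℕ → Output n
  present (y , c) = y , ℤ.+ c ℚ./ 1

  answer : ∀ {m} → Vec (Vec Bool (S * A)) m → Vec (Fin n) m → Fin n × ℕ
  answer cs D = best qs (runAll 0 qs cs D (initial qs))

  answer-counted : ∀ {m} (D : Vec (Fin n) m) (cs : Vec (Vec Bool (S * A)) m) → Counted (Vec.toList D) (answer cs D)
  answer-counted D cs = best-counted (Vec.toList D) qs _
    (runAll-sound (λ _ → 0) 0 qs cs D (initial qs) (allSlots-initial qs (z≤n , z≤n)))

  module Counting {M : ℕ} (D : Vec (Fin n) M) (r : Vec (Vec Bool (S * A)) (2 + M) → Output n)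
                  (r≡ : ∀ c₀ c₁ cs → r (c₀ ∷ c₁ ∷ cs) ≡ present (answer cs D)) where
    private
      R total : ℕ
      R = S * A
      total = (2 ^ R) ^ (2 + M)

      ∑-tapes : (f : Vec (Vec Bool R) (2 + M) → ℕ) → ∑ (tapes R (2 + M)) f ≡
                ∑ (bitBlocks R) (λ c₀ → ∑ (bitBlocks R) (λ c₁ → ∑ (vectors (bitBlocks R) M) (λ cs → f (c₀ ∷ c₁ ∷ cs))))
      ∑-tapes f = trans (∑-vectors-suc (bitBlocks R) (suc M) f)
                        (∑-cong (bitBlocks R) (λ c₀ → ∑-vectors-suc (bitBlocks R) M (λ v → f (c₀ ∷ v))))

      length-bitBlocks : length (bitBlocks R) ≡ 2 ^ R
      length-bitBlocks = length-vectors (true ∷ false ∷ []) R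

      length-tapes : length (tapes R (2 + M)) ≡ total
      length-tapes = trans (length-vectors (bitBlocks R) (2 + M)) (cong (_^ (2 + M)) length-bitBlocks)

    always : {P : Pred (Output n) 0ℓ} (P? : Decidable P) →
             (∀ cs → P (present (answer cs D))) →
             length (filter (λ ω → P? (r ω)) (tapes R (2 + M))) ≡ total
    always {P} P? holds = trans (length-filter (λ ω → P? (r ω)) (tapes R (2 + M)))
      (trans (∑-cong (tapes R (2 + M)) one) (trans (∑-const (tapes R (2 + M)) 1) (trans (*-identityʳ _) length-tapes)))
      where
      one : ∀ ω → ⟦ does (P? (r ω)) ⟧ ≡ 1
      one (c₀ ∷ c₁ ∷ cs) with P? (r (c₀ ∷ c₁ ∷ cs))
      ... | yes _ = refl
      ... | no ¬p = contradiction (subst P (sym (r≡ c₀ c₁ cs)) (holds cs)) ¬p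

    -- A tape on which the output fails `P` is one on which every slot fails, and these are counted
    -- by a product over the slots.
    often : {P : Pred (Output n) 0ℓ} (P? : Decidable P) (φ : Slot n → ℕ) →
            (∀ cs → prod φ qs (runAll 0 qs cs D (initial qs)) ≡ 0 → P (present (answer cs D))) →
            2 * ∏ qs (λ q → W (sched q ∘ clock) 0 (Vec.toList D) φ (empty i₀)) ≤ (β ^ M) ^ S →
            total ≤ 2 * length (filter (λ ω → P? (r ω)) (tapes R (2 + M)))
    often {P} P? φ holds rare = +-cancelʳ-≤ total _ _ (begin
      total + total ≡⟨ cong (total +_) (sym (+-identityʳ total)) ⟩
      2 * total ≡⟨ cong (2 *_) (sym (trans (trans (∑-cong (tapes R (2 + M)) complement) (∑-const (tapes R (2 + M)) 1)) (trans (*-identityʳ _) length-tapes))) ⟩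
      2 * ∑ (tapes R (2 + M)) (λ ω → yes? ω + no? ω) ≡⟨ cong (2 *_) (∑-+ (tapes R (2 + M)) yes? no?) ⟩
      2 * (∑ (tapes R (2 + M)) yes? + ∑ (tapes R (2 + M)) no?) ≡⟨ *-distribˡ-+ 2 (∑ (tapes R (2 + M)) yes?) _ ⟩
      2 * ∑ (tapes R (2 + M)) yes? + 2 * ∑ (tapes R (2 + M)) no?
        ≤⟨ +-mono-≤ (≤-reflexive (cong (2 *_) (sym (length-filter (λ ω → P? (r ω)) (tapes R (2 + M)))))) no-rare ⟩
      2 * length (filter (λ ω → P? (r ω)) (tapes R (2 + M))) + total ∎)
      where
      open ≤-Reasoning
      yes? no? : Vec (Vec Bool R) (2 + M) → ℕ
      yes? ω = ⟦ does (P? (r ω)) ⟧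
      no? ω = ⟦ not (does (P? (r ω))) ⟧
      complement : ∀ ω → yes? ω + no? ω ≡ 1
      complement ω with does (P? (r ω))
      ... | true  = refl
      ... | false = refl
      final : Vec (Vec Bool R) M → ℕ
      final cs = prod φ qs (runAll 0 qs cs D (initial qs))
      no≤ : ∀ c₀ c₁ cs → no? (c₀ ∷ c₁ ∷ cs) ≤ final cs
      no≤ c₀ c₁ cs with final cs | holds cs | P? (r (c₀ ∷ c₁ ∷ cs))
      ... | suc _ | _     | yes _ = z≤n
      ... | suc _ | _     | no  _ = s≤s z≤n
      ... | zero  | holds | yes _ = z≤n
      ... | zero  | holds | no ¬p = contradiction (subst P (sym (r≡ c₀ c₁ cs)) (holds refl)) ¬p
      Π : ℕ
      Π = ∏ qs (λ q → W (sched q ∘ clock) 0 (Vec.toList D) φ (empty i₀))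
      no-rare : 2 * ∑ (tapes R (2 + M)) no? ≤ total
      no-rare = begin
        2 * ∑ (tapes R (2 + M)) no?
          ≡⟨ cong (2 *_) (∑-tapes no?) ⟩
        2 * ∑ (bitBlocks R) (λ c₀ → ∑ (bitBlocks R) (λ c₁ → ∑ (vectors (bitBlocks R) M) (λ cs → no? (c₀ ∷ c₁ ∷ cs))))
          ≤⟨ *-monoʳ-≤ 2 (∑-mono (bitBlocks R) (λ c₀ → ∑-mono (bitBlocks R) (λ c₁ → ∑-mono (vectors (bitBlocks R) M) (no≤ c₀ c₁)))) ⟩
        2 * ∑ (bitBlocks R) (λ _ → ∑ (bitBlocks R) (λ _ → ∑ (vectors (bitBlocks R) M) final))
          ≡⟨ cong (2 *_) (trans (∑-const (bitBlocks R) _) (cong₂ _*_ length-bitBlocks (trans (∑-const (bitBlocks R) _) (cong₂ _*_ length-bitBlocks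
               (trans (∑-runAll 0 φ qs D (initial qs)) (prodW-initial 0 (Vec.toList D) φ qs)))))) ⟩
        2 * (2 ^ R * (2 ^ R * Π)) ≡⟨ shuffle (2 ^ R) Π ⟩
        2 ^ R * (2 ^ R * (2 * Π)) ≤⟨ *-monoʳ-≤ (2 ^ R) (*-monoʳ-≤ (2 ^ R) (≤≡-trans rare powers)) ⟩
        total ∎
        where
        shuffle : ∀ r p → 2 * (r * (r * p)) ≡ r * (r * (2 * p))
        shuffle = solve-∀
        reorder : ∀ a m s → a * m * s ≡ s * a * m
        reorder = solve-∀
        powers : (β ^ M) ^ S ≡ (2 ^ R) ^ M
        powers = trans (cong (_^ S) (^-*-assoc 2 A M)) (trans (^-*-assoc 2 (A * M) S)
                   (trans (cong (2 ^_) (reorder A M S)) (sym (^-*-assoc 2 R M))))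

  algorithm : StreamingAlgorithm n
  algorithm = record
    { memory = 2 * suc A + S * (6 * suc A)
    ; coins  = S * A
    ; init   = λ _ → encodeState (clock 0) (initial qs)
    ; update = λ c p v → encodeState (advance (decodeClock S v)) (stepAll (decodeClock S v) qs c p (decodeSlots S v))
    ; output = λ _ v → present (best qs (decodeSlots S v))
    }

  open StreamingAlgorithm algorithm using (process; run)

  -- Counts and ages are bounded by the time. The delay, one more than an offset, can equal `2 ^ A`,
  -- which is why each field gets `suc A` bits.
  Fits : ℕ → ℕ → Slot n → Set
  Fits a b (slot y c α z d w) = c ≤ a × α ≤ b × d ≤ a × w ≤ 2 ^ A

  Legal : Instr → Set
  Legal go              = ⊤
  Legal (row f a D U) = a ≤ A

  sched-legal : ∀ q clk → κ * proj₁ clk ≤ A → Legal (sched q clk)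
  sched-legal q@(ρ , l , j) (e , pos) le with e % suc l ≟ j
  ... | no  _ = tt
  ... | yes _ = inPhase-legal pos
    where
    short : lenExp e ρ l ≤ A
    short = ≤-trans (m∸n≤m (κ * e) (rowsExp ρ l)) le
    inPhase-legal : ∀ pos → Legal (inPhase q (e , pos))
    inPhase-legal zero = short
    inPhase-legal (suc pos) with (suc pos % 2 ^ lenExp e ρ l) {{m^n≢0 2 (lenExp e ρ l)}}
    ... | zero  = short
    ... | suc _ = tt

  tick-fits : ∀ {a b} p s → Fits a b s → Fits (suc a) b (tick p s)
  tick-fits {a} {b} p (slot y c α z d w) (cs , as , ds , ws) = go′ w ws
    where
    bumped : ∀ y c → c ≤ a → bump y p c ≤ suc a
    bumped y c c≤ = ≤-trans (bump-≤ y p c) (+-mono-≤ (⟦⟧≤1 (does (p Fin.≟ y))) c≤)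
    go′ : ∀ w → w ≤ 2 ^ A → Fits (suc a) b (tick p (slot y c α z d w))
    go′ zero          ws = bumped y c cs , as , bumped z d ds , z≤n
    go′ (suc zero)    ws = bumped y c cs , as , s≤s z≤n , z≤n
    go′ (suc (suc w)) ws = bumped y c cs , as , bumped z d ds , <⇒≤ ws

  contest-fits : ∀ {a b} D U s → Fits a b s → Fits a (suc b) (contest D U s)
  contest-fits D U (slot y c α z d w) (cs , as , ds , ws) with D * c <? D * d + U * suc α
  ... | yes _ = ds , z≤n , ds , ws
  ... | no  _ = cs , s≤s as , ds , ws

  start-fits : ∀ {a b} o s → o < 2 ^ A → Fits a b s → Fits a b (start o s)
  start-fits o (slot y c α z d w) o< (cs , as , _ , _) = cs , as , z≤n , o<

  step-fits : ∀ {t} I c p s → Legal I → Fits t t s → Fits (suc t) (suc t) (step I c p s)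
  step-fits go c p s@(slot y x α z d w) _ (cs , as , ds , ws) = tick-fits p s (cs , m≤n⇒m≤1+n as , ds , ws)
  step-fits {t} (row true a D U) c p s a≤A fits =
    tick-fits p (start (fromBits a c) (contest D U (empty i₀)))
      (start-fits (fromBits a c) (contest D U (empty i₀)) (<-≤-trans (fromBits-< a c) (2^-mono a≤A))
        (contest-fits {t} {t} D U (empty i₀) (z≤n , z≤n , z≤n , z≤n)))
  step-fits {t} (row false a D U) c p s a≤A fits =
    tick-fits p (start (fromBits a c) (contest D U s))
      (start-fits (fromBits a c) (contest D U s) (<-≤-trans (fromBits-< a c) (2^-mono a≤A)) (contest-fits {t} {t} D U s fits))

  module _ (n≤ : n ≤ 2 ^ A) where

    2^A<2^sucA : 2 ^ A < 2 ^ suc A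
    2^A<2^sucA = ^-monoʳ-< 2 ≤-refl {A} {suc A} ≤-refl

    fits⇒small : ∀ {t} → t ≤ 2 ^ A → ∀ s → Fits t t s → Small s
    fits⇒small t≤ (slot y c α z d w) (cs , as , ds , ws) =
      id< y VAll.∷ (below (≤-trans cs t≤) VAll.∷ (below (≤-trans as t≤) VAll.∷ (id< z VAll.∷
        (below (≤-trans ds t≤) VAll.∷ (below ws VAll.∷ VAll.[])))))
      where
      below : ∀ {x} → x ≤ 2 ^ A → x < 2 ^ suc A
      below le = ≤-<-trans le 2^A<2^sucA
      id< : ∀ (y : Fin n) → toℕ y < 2 ^ suc A
      id< y = <-trans (<-≤-trans (Fin.toℕ<n y) n≤) 2^A<2^sucA

    allSmall : ∀ {t} → t ≤ 2 ^ A → ∀ qs ss → AllSlots (Fits t t) qs ss → VAll.All Small ss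
    allSmall t≤ []       []       _        = VAll.[]
    allSmall t≤ (q ∷ qs) (s ∷ ss) (f , fs) = fits⇒small t≤ s f VAll.∷ allSmall t≤ qs ss fs

    phase≤phaseStart : ∀ e → e ≤ phaseStart e
    phase≤phaseStart zero    = z≤n
    phase≤phaseStart (suc e) = +-mono-≤ (m^n>0 2 (κ * e)) (phase≤phaseStart e)

    clock-≤ : ∀ t → proj₁ (clock t) ≤ t × proj₂ (clock t) ≤ t
    clock-≤ t with clock t | clock-invariant t
    ... | e , pos | eq , _ = ≤≡-trans (≤-trans (phase≤phaseStart e) (m≤n+m _ pos)) (sym eq) ,
                             ≤≡-trans (m≤m+n pos _) (sym eq)

    decode-clock : ∀ t → t ≤ 2 ^ A → ∀ (ss : Vec (Slot n) S) → decodeClock S (encodeState (clock t) ss) ≡ clock t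
    decode-clock t t≤ ss = decodeClock-encodeState (proj₁ (clock t)) (proj₂ (clock t)) ss
      (≤-<-trans (≤-trans (proj₁ (clock-≤ t)) t≤) 2^A<2^sucA) (≤-<-trans (≤-trans (proj₂ (clock-≤ t)) t≤) 2^A<2^sucA)

    module _ (M : ℕ) (M≤ : M ≤ 2 ^ A) (legal : ∀ t → t < M → κ * proj₁ (clock t) ≤ A) where

      -- As long as no field overflows, decoding inverts encoding, and the algorithm on bits
      -- retraces the run on slots.
      simulate : ∀ {m} t (cs : Vec (Vec Bool (S * A)) m) (D : Vec (Fin n) m) ss → m + t ≤ M → AllSlots (Fits t t) qs ss →
                 decodeSlots S (process cs D (encodeState (clock t) ss)) ≡ runAll t qs cs D ss
      simulate t []       []      ss le fits = decodeSlots-encodeState (clock t) ss (allSmall (≤-trans le M≤) qs ss fits)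
      simulate {suc m} t (c ∷ cs) (p ∷ D) ss le fits =
        trans (cong (λ v → decodeSlots S (process cs D v)) updated)
              (simulate (suc t) cs D (stepAll (clock t) qs c p ss) (≡≤-trans (+-suc m t) le)
                (allSlots-step (clock t) qs c p ss
                  (λ q b s → step-fits (sched q (clock t)) b p s
                    (sched-legal q (clock t) (legal t (≤-trans (s≤s (m≤n+m t m)) le)))) fits))
        where
        t≤ : t ≤ 2 ^ A
        t≤ = ≤-trans (≤-trans (m≤n+m t (suc m)) le) M≤
        v = encodeState (clock t) ss
        updated : encodeState (advance (decodeClock S v)) (stepAll (decodeClock S v) qs c p (decodeSlots S v)) ≡
                  encodeState (clock (suc t)) (stepAll (clock t) qs c p ss)
        updated = cong₂ (λ clk ss → encodeState (advance clk) (stepAll clk qs c p ss))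
          (decode-clock t t≤ ss) (decodeSlots-encodeState (clock t) ss (allSmall t≤ qs ss fits))

      run-answer : (D : Stream n M) (c₀ c₁ : Vec Bool (S * A)) (cs : Vec (Vec Bool (S * A)) M) →
                   run D (c₀ ∷ c₁ ∷ cs) ≡ present (answer cs D)
      run-answer D c₀ c₁ cs = cong (λ ss → present (best qs ss))
        (simulate 0 cs D (initial qs) (≤-reflexive (+-identityʳ M)) (allSlots-initial qs (z≤n , z≤n , z≤n , z≤n)))

-- Space

n<2^[1+log] : ∀ n → n < 2 ^ suc ⌊log₂ n ⌋
n<2^[1+log] n = ≰⇒> λ le → 1+n≰n (≡≤-trans (sym (⌊log₂[2^n]⌋≡n (suc ⌊log₂ n ⌋))) (⌊log₂⌋-mono-≤ le))

1≤log : ∀ {n} → 2 ≤ n → 1 ≤ ⌊log₂ n ⌋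
1≤log le = ≡≤-trans (sym (⌊log₂[2^n]⌋≡n 1)) (⌊log₂⌋-mono-≤ le)

2^log≤n : ∀ n → 1 ≤ n → 2 ^ ⌊log₂ n ⌋ ≤ n
2^log≤n = <-rec (λ n → 1 ≤ n → 2 ^ ⌊log₂ n ⌋ ≤ n) go′
  where
  open ≤-Reasoning
  go′ : ∀ n → (∀ {m} → m < n → 1 ≤ m → 2 ^ ⌊log₂ m ⌋ ≤ m) → 1 ≤ n → 2 ^ ⌊log₂ n ⌋ ≤ n
  go′ (suc zero) rec _ = ≤-refl
  go′ n@(suc (suc n₀)) rec _ = begin
    2 ^ ⌊log₂ n ⌋ ≡⟨ cong (2 ^_) (sym (trans (cong suc (⌊log₂⌊n/2⌋⌋≡⌊log₂n⌋∸1 n)) (m+[n∸m]≡n (1≤log {n} (s≤s (s≤s z≤n)))))) ⟩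
    2 * 2 ^ ⌊log₂ ⌊ n /2⌋ ⌋ ≤⟨ *-monoʳ-≤ 2 (rec (⌊n/2⌋<n (suc n₀)) (s≤s z≤n)) ⟩
    2 * ⌊ n /2⌋ ≡⟨ cong (⌊ n /2⌋ +_) (+-identityʳ _) ⟩
    ⌊ n /2⌋ + ⌊ n /2⌋ ≤⟨ +-monoʳ-≤ ⌊ n /2⌋ (⌊n/2⌋≤⌈n/2⌉ n) ⟩
    ⌊ n /2⌋ + ⌈ n /2⌉ ≡⟨ ⌊n/2⌋+⌈n/2⌉≡n n ⟩
    n ∎

∑-concatMap : {A B : Set} (f : A → List B) (xs : List A) (g : B → ℕ) →
              ∑ (List.concatMap f xs) g ≡ ∑ xs (λ x → ∑ (f x) g)
∑-concatMap f []       g = refl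
∑-concatMap f (x ∷ xs) g = trans (∑-++ (f x) (List.concatMap f xs) g) (cong (∑ (f x) g +_) (∑-concatMap f xs g))

length-copied : {A : Set} (N : A → ℕ) (qs : List A) → length (copied N qs) ≡ ∑ qs N
length-copied N []       = refl
length-copied N (q ∷ qs) = trans (length-++ (replicate (N q) q)) (cong₂ _+_ (length-replicate (N q)) (length-copied N qs))

typesFor : ℕ → ℕ → List (ℕ × ℕ × ℕ)
typesFor ρ l = map (λ j → ρ , l , j) (upTo (suc l))

typesOf : ℕ → List (ℕ × ℕ × ℕ)
typesOf ρ = List.concatMap (typesFor ρ) (upTo (suc ρ))

types : ℕ → List (ℕ × ℕ × ℕ)
types M = List.concatMap typesOf (upTo (suc M))

∈-types : ∀ {M ρ l j} → ρ ≤ M → l ≤ ρ → j ≤ l → (ρ , l , j) ∈ types M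
∈-types {M} {ρ} {l} {j} ρ≤M l≤ρ j≤l =
  ∈-concat⁺′ (∈-concat⁺′ (∈-map⁺ (λ j → ρ , l , j) (∈-upTo⁺ (s≤s j≤l)))
                         (∈-map⁺ (typesFor ρ) (∈-upTo⁺ (s≤s l≤ρ))))
             (∈-map⁺ typesOf (∈-upTo⁺ (s≤s ρ≤M)))

∑-types : ∀ M (g : ℕ × ℕ × ℕ → ℕ) (N : ℕ → ℕ → ℕ) → (∀ ρ l j → g (ρ , l , j) ≡ N ρ l) →
          ∑ (types M) g ≡ ∑< (suc M) (λ ρ → ∑< (suc ρ) (λ l → suc l * N ρ l))
∑-types M g N g≡ = begin
  ∑ (types M) g ≡⟨ ∑-concatMap typesOf (upTo (suc M)) g ⟩
  ∑ (upTo (suc M)) (λ ρ → ∑ (typesOf ρ) g) ≡⟨ ∑-upTo (suc M) (λ ρ → ∑ (typesOf ρ) g) ⟩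
  ∑< (suc M) (λ ρ → ∑ (typesOf ρ) g) ≡⟨ ∑<-cong (suc M) inner ⟩
  ∑< (suc M) (λ ρ → ∑< (suc ρ) (λ l → suc l * N ρ l)) ∎
  where
  open ≡-Reasoning
  innermost : ∀ ρ l → ∑ (typesFor ρ l) g ≡ suc l * N ρ l
  innermost ρ l = begin
    ∑ (typesFor ρ l) g ≡⟨ ∑-map (λ j → ρ , l , j) (upTo (suc l)) g ⟩
    ∑ (upTo (suc l)) (λ j → g (ρ , l , j)) ≡⟨ ∑-cong (upTo (suc l)) (g≡ ρ l) ⟩
    ∑ (upTo (suc l)) (λ _ → N ρ l) ≡⟨ ∑-const (upTo (suc l)) (N ρ l) ⟩
    length (upTo (suc l)) * N ρ l ≡⟨ cong (_* N ρ l) (length-upTo (suc l)) ⟩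
    suc l * N ρ l ∎
  inner : ∀ ρ → ∑ (typesOf ρ) g ≡ ∑< (suc ρ) (λ l → suc l * N ρ l)
  inner ρ = begin
    ∑ (typesOf ρ) g ≡⟨ ∑-concatMap (typesFor ρ) (upTo (suc ρ)) g ⟩
    ∑ (upTo (suc ρ)) (λ l → ∑ (typesFor ρ l) g) ≡⟨ ∑-upTo (suc ρ) (λ l → ∑ (typesFor ρ l) g) ⟩
    ∑< (suc ρ) (λ l → ∑ (typesFor ρ l) g) ≡⟨ ∑<-cong (suc ρ) (innermost ρ) ⟩
    ∑< (suc ρ) (λ l → suc l * N ρ l) ∎

module Geometric (B : ℕ) (8≤B : 8 ≤ B) where
  open ≤-Reasoning

  term : ℕ → ℕ → ℕ
  term ρ l = 4 ^ l * B ^ (ρ ∸ l)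

  plain weighted : ℕ → ℕ
  plain    ρ = ∑< (suc ρ) (term ρ)
  weighted ρ = ∑< (suc ρ) (λ l → suc l * term ρ l)

  plain-≤ : ∀ ρ → plain ρ ≤ 2 * B ^ ρ
  plain-≤ zero    = s≤s z≤n
  plain-≤ (suc ρ) = begin
    B ^ suc ρ + 0 + ∑< (suc ρ) (λ l → 4 * 4 ^ l * B ^ (ρ ∸ l))
      ≡⟨ cong₂ _+_ (+-identityʳ (B ^ suc ρ)) (trans (∑<-cong (suc ρ) (λ l → *-assoc 4 (4 ^ l) (B ^ (ρ ∸ l)))) (∑<-*ˡ 4 (suc ρ) (term ρ))) ⟩
    B ^ suc ρ + 4 * plain ρ ≤⟨ +-monoʳ-≤ (B ^ suc ρ) (*-monoʳ-≤ 4 (plain-≤ ρ)) ⟩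
    B ^ suc ρ + 4 * (2 * B ^ ρ) ≡⟨ cong (B ^ suc ρ +_) (sym (*-assoc 4 2 (B ^ ρ))) ⟩
    B ^ suc ρ + 8 * B ^ ρ ≤⟨ +-monoʳ-≤ (B ^ suc ρ) (*-monoˡ-≤ (B ^ ρ) 8≤B) ⟩
    B ^ suc ρ + B ^ suc ρ ≡⟨ cong (B ^ suc ρ +_) (sym (+-identityʳ (B ^ suc ρ))) ⟩
    2 * B ^ suc ρ ∎

  -- The ratio 4 / B is at most 1/2, and 4 is the sum of (l + 1) * 2 ^ -l. Shifting l by one splits
  -- the weight `suc (suc l)` into `suc l` and 1, hence the companion bound for `plain`.
  weighted-≤ : ∀ ρ → weighted ρ ≤ 4 * B ^ ρ
  weighted-≤ zero    = s≤s z≤n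
  weighted-≤ (suc ρ) = begin
    1 * (1 * B ^ suc ρ) + ∑< (suc ρ) (λ l → suc (suc l) * (4 * 4 ^ l * B ^ (ρ ∸ l)))
      ≡⟨ cong₂ _+_ (trans (*-identityˡ (1 * B ^ suc ρ)) (*-identityˡ (B ^ suc ρ))) (trans (∑<-cong (suc ρ) (λ l → e₁ l (4 ^ l) (B ^ (ρ ∸ l))))
           (trans (∑<-*ˡ 4 (suc ρ) (λ l → suc l * term ρ l + term ρ l)) (cong (4 *_) (∑<-+ (suc ρ) (λ l → suc l * term ρ l) (term ρ))))) ⟩
    B ^ suc ρ + 4 * (weighted ρ + plain ρ) ≤⟨ +-monoʳ-≤ (B ^ suc ρ) (*-monoʳ-≤ 4 (+-mono-≤ (weighted-≤ ρ) (plain-≤ ρ))) ⟩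
    B ^ suc ρ + 4 * (4 * B ^ ρ + 2 * B ^ ρ) ≡⟨ e₂ (B ^ suc ρ) (B ^ ρ) ⟩
    B ^ suc ρ + 3 * (8 * B ^ ρ) ≤⟨ +-monoʳ-≤ (B ^ suc ρ) (*-monoʳ-≤ 3 (*-monoˡ-≤ (B ^ ρ) 8≤B)) ⟩
    B ^ suc ρ + 3 * B ^ suc ρ ≡⟨ refl ⟩
    4 * B ^ suc ρ ∎
    where
    e₁ : ∀ l x y → suc (suc l) * (4 * x * y) ≡ 4 * (suc l * (x * y) + x * y)
    e₁ = solve-∀
    e₂ : ∀ b x → b + 4 * (4 * x + 2 * x) ≡ b + 3 * (8 * x)
    e₂ = solve-∀

  powers-≤ : ∀ M → 1 + ∑< (suc M) (λ ρ → B ^ ρ) ≤ 2 * B ^ M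
  powers-≤ zero    = ≤-refl
  powers-≤ (suc M) = begin
    1 + (1 + ∑< (suc M) (λ ρ → B * B ^ ρ)) ≡⟨ cong (2 +_) (∑<-*ˡ B (suc M) (λ ρ → B ^ ρ)) ⟩
    2 + B * ∑< (suc M) (λ ρ → B ^ ρ) ≤⟨ +-monoˡ-≤ _ (≤-trans (s≤s (s≤s z≤n)) (≤≡-trans 8≤B (sym (*-identityʳ B)))) ⟩
    B * 1 + B * ∑< (suc M) (λ ρ → B ^ ρ) ≡⟨ sym (*-distribˡ-+ B 1 _) ⟩
    B * (1 + ∑< (suc M) (λ ρ → B ^ ρ)) ≤⟨ *-monoʳ-≤ B (powers-≤ M) ⟩
    B * (2 * B ^ M) ≡⟨ e B (B ^ M) ⟩
    2 * (B * B ^ M) ∎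
    where
    e : ∀ b x → b * (2 * x) ≡ 2 * (b * x)
    e = solve-∀

  total-≤ : ∀ M → ∑< (suc M) weighted ≤ 8 * B ^ M
  total-≤ M = begin
    ∑< (suc M) weighted ≤⟨ ∑<-mono (suc M) weighted-≤ ⟩
    ∑< (suc M) (λ ρ → 4 * B ^ ρ) ≡⟨ ∑<-*ˡ 4 (suc M) (λ ρ → B ^ ρ) ⟩
    4 * ∑< (suc M) (λ ρ → B ^ ρ) ≤⟨ *-monoʳ-≤ 4 (≤-trans (n≤1+n _) (powers-≤ M)) ⟩
    4 * (2 * B ^ M) ≡⟨ sym (*-assoc 4 2 (B ^ M)) ⟩
    8 * B ^ M ∎

module Space (k₀ E c : ℕ) where
  k : ℕ
  k = 3 + k₀

  c₁ : ℕ
  c₁ = (E + 3 * (2 + k₀)) * (3 + k₀) + 7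

  open Schedule k₀ c₁

  copies : Type → ℕ
  copies (ρ , l , _) = 2 ^ copiesExp ρ l

  -- `L / (3 * k) + 1` is an r with `n ≤ (8 ^ r) ^ k`; the rest is the slack of `Y-bound`.
  maxType : ℕ → ℕ
  maxType L = L / (3 * k) + 1 + 3 * E + 1

  bank : ℕ → List Type
  bank L = copied copies (types (maxType L))

  -- 2 ^ width exceeds n, the stream length and the length of each phase reached.
  width : ℕ → ℕ
  width L = c + suc L * c + κ + suc L

  widthFactor slackExp constant : ℕ
  widthFactor = suc (c + 2 * c + κ + 2)
  slackExp = 3 * k * (3 * E + 2)
  constant = widthFactor * 2 ^ (9 + c₁) * 2 ^ slackExp

  private
    B : ℕ
    B = 2 ^ (3 * (1 + k₀))

    8≤B : 8 ≤ B
    8≤B = 2^-mono {3} {3 * (1 + k₀)} (m≤m*n 3 (1 + k₀))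

  length-bank : ∀ L → length (bank L) ≤ 2 ^ (6 + c₁) * B ^ maxType L
  length-bank L = begin
    length (bank L)
      ≡⟨ trans (length-copied copies (types M)) (∑-types M copies (λ ρ l → 2 ^ copiesExp ρ l) (λ _ _ _ → refl)) ⟩
    ∑< (suc M) (λ ρ → ∑< (suc ρ) (λ l → suc l * 2 ^ copiesExp ρ l))
      ≡⟨ ∑<-cong (suc M) (λ ρ → trans (∑<-cong (suc ρ) (λ l → trans (cong (suc l *_) (split ρ l)) (swap (suc l) (2 ^ (3 + c₁)) (4 ^ l * B ^ (ρ ∸ l))))) (∑<-*ˡ (2 ^ (3 + c₁)) (suc ρ) (λ l → suc l * (4 ^ l * B ^ (ρ ∸ l))))) ⟩
    ∑< (suc M) (λ ρ → 2 ^ (3 + c₁) * weighted ρ) ≡⟨ ∑<-*ˡ (2 ^ (3 + c₁)) (suc M) weighted ⟩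
    2 ^ (3 + c₁) * ∑< (suc M) weighted ≤⟨ *-monoʳ-≤ (2 ^ (3 + c₁)) (total-≤ M) ⟩
    2 ^ (3 + c₁) * (8 * B ^ M) ≡⟨ trans (sym (*-assoc (2 ^ (3 + c₁)) 8 (B ^ M))) (cong (_* B ^ M) (trans (*-comm (2 ^ (3 + c₁)) 8) (sym (^-distribˡ-+-* 2 3 (3 + c₁))))) ⟩
    2 ^ (6 + c₁) * B ^ M ∎
    where
    open ≤-Reasoning
    open Geometric B 8≤B
    M = maxType L
    swap : ∀ a b c → a * (b * c) ≡ b * (a * c)
    swap = solve-∀
    split : ∀ ρ l → 2 ^ copiesExp ρ l ≡ 2 ^ (3 + c₁) * (4 ^ l * B ^ (ρ ∸ l))
    split ρ l = trans (cong (2 ^_) (+-assoc (3 + c₁) (2 * l) (3 * (1 + k₀) * (ρ ∸ l))))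
      (trans (^-distribˡ-+-* 2 (3 + c₁) (2 * l + 3 * (1 + k₀) * (ρ ∸ l)))
      (cong (2 ^ (3 + c₁) *_) (trans (^-distribˡ-+-* 2 (2 * l) (3 * (1 + k₀) * (ρ ∸ l)))
        (cong₂ _*_ (sym (^-*-assoc 2 2 l)) (sym (^-*-assoc 2 (3 * (1 + k₀)) (ρ ∸ l)))))))

  width-≤ : ∀ L → 1 ≤ L → suc (width L) ≤ widthFactor * L
  width-≤ (suc L) _ = ≤-trans (m≤m+n (suc (width (suc L))) (slack L)) (≤-reflexive (e c κ L))
    where
    slack : ℕ → ℕ
    slack L = L * (1 + 2 * c + κ + 1) + c * 0
    e : ∀ c κ L → suc (c + suc (suc L) * c + κ + suc (suc L)) + (L * (1 + 2 * c + κ + 1) + c * 0) ≡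
                  suc (c + 2 * c + κ + 2) * suc L
    e = solve-∀

  maxType-≤ : ∀ L → 3 * k * maxType L ≤ L + slackExp
  maxType-≤ L = begin
    3 * k * (L / (3 * k) + 1 + 3 * E + 1) ≡⟨ e (3 * k) (L / (3 * k)) E ⟩
    L / (3 * k) * (3 * k) + slackExp ≤⟨ +-monoˡ-≤ slackExp (m/n*n≤m L (3 * k)) ⟩
    L + slackExp ∎
    where
    open ≤-Reasoning
    e : ∀ x y E → x * (y + 1 + 3 * E + 1) ≡ y * x + x * (3 * E + 2)
    e = solve-∀

  -- `B ^ M` is `2 ^ (3 * (k - 2) * M)`, and `3 * k * M` exceeds `L` by at most a constant, so the
  -- k-th power of the number of slots is `n ^ (k - 2)` up to a constant. The logarithm enters only
  -- through the width of a field.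
  space : ∀ n → 2 ≤ n → let L = ⌊log₂ n ⌋ in
          SpaceBound k constant n (2 * suc (width L) + length (bank L) * (6 * suc (width L)))
  space n 2≤n = begin
    (2 * w + S * (6 * w)) ^ k ≤⟨ ^-monoˡ-≤ k memory≤ ⟩
    (widthFactor * 2 ^ (9 + c₁) * L * B ^ M) ^ k ≡⟨ *-^ (widthFactor * 2 ^ (9 + c₁) * L) (B ^ M) k ⟩
    (widthFactor * 2 ^ (9 + c₁) * L) ^ k * (B ^ M) ^ k ≤⟨ *-monoʳ-≤ ((widthFactor * 2 ^ (9 + c₁) * L) ^ k) blocks≤ ⟩
    (widthFactor * 2 ^ (9 + c₁) * L) ^ k * ((2 ^ slackExp) ^ k * n ^ (1 + k₀))
      ≡⟨ sym (*-assoc ((widthFactor * 2 ^ (9 + c₁) * L) ^ k) ((2 ^ slackExp) ^ k) (n ^ (1 + k₀))) ⟩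
    (widthFactor * 2 ^ (9 + c₁) * L) ^ k * (2 ^ slackExp) ^ k * n ^ (1 + k₀)
      ≡⟨ cong (_* n ^ (1 + k₀)) (trans (sym (*-^ (widthFactor * 2 ^ (9 + c₁) * L) (2 ^ slackExp) k)) (cong (_^ k) (swap (widthFactor * 2 ^ (9 + c₁)) L (2 ^ slackExp)))) ⟩
    (constant * L) ^ k * n ^ (1 + k₀) ∎
    where
    open ≤-Reasoning
    L M w S : ℕ
    L = ⌊log₂ n ⌋
    M = maxType L
    w = suc (width L)
    S = length (bank L)
    swap : ∀ a b c → a * b * c ≡ a * c * b
    swap = solve-∀
    memory≤ : 2 * w + S * (6 * w) ≤ widthFactor * 2 ^ (9 + c₁) * L * B ^ M
    memory≤ = begin
      2 * w + S * (6 * w) ≤⟨ +-mono-≤ (m≤n*m (2 * w) S′ {{>-nonZero S′≥1}}) (*-monoˡ-≤ (6 * w) (length-bank L)) ⟩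
      S′ * (2 * w) + S′ * (6 * w) ≡⟨ e₁ S′ w ⟩
      w * (8 * S′) ≤⟨ *-monoˡ-≤ (8 * S′) (width-≤ L (1≤log 2≤n)) ⟩
      widthFactor * L * (8 * S′) ≡⟨ cong (widthFactor * L *_) (trans (sym (*-assoc 8 (2 ^ (6 + c₁)) (B ^ M))) (cong (_* B ^ M) (sym (^-distribˡ-+-* 2 3 (6 + c₁))))) ⟩
      widthFactor * L * (2 ^ (9 + c₁) * B ^ M) ≡⟨ e₂ widthFactor L (2 ^ (9 + c₁)) (B ^ M) ⟩
      widthFactor * 2 ^ (9 + c₁) * L * B ^ M ∎
      where
      S′ = 2 ^ (6 + c₁) * B ^ M
      S′≥1 : 1 ≤ S′
      S′≥1 = *-mono-≤ (m^n>0 2 (6 + c₁)) (m^n>0 B {{>-nonZero (≤-trans (s≤s z≤n) 8≤B)}} M)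
      e₁ : ∀ s w → s * (2 * w) + s * (6 * w) ≡ w * (8 * s)
      e₁ = solve-∀
      e₂ : ∀ a l x y → a * l * (x * y) ≡ a * x * l * y
      e₂ = solve-∀
    blocks≤ : (B ^ M) ^ k ≤ (2 ^ slackExp) ^ k * n ^ (1 + k₀)
    blocks≤ = begin
      (B ^ M) ^ k ≡⟨ trans (cong (_^ k) (^-*-assoc 2 (3 * (1 + k₀)) M)) (^-*-assoc 2 (3 * (1 + k₀) * M) k) ⟩
      2 ^ (3 * (1 + k₀) * M * k) ≡⟨ cong (2 ^_) (e k₀ M k) ⟩
      2 ^ (3 * k * M * (1 + k₀)) ≤⟨ 2^-mono (*-monoˡ-≤ (1 + k₀) (maxType-≤ L)) ⟩
      2 ^ ((L + slackExp) * (1 + k₀)) ≡⟨ sym (^-*-assoc 2 (L + slackExp) (1 + k₀)) ⟩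
      (2 ^ (L + slackExp)) ^ (1 + k₀) ≡⟨ cong (_^ (1 + k₀)) (trans (cong (2 ^_) (+-comm L slackExp)) (^-distribˡ-+-* 2 slackExp L)) ⟩
      (2 ^ slackExp * 2 ^ L) ^ (1 + k₀) ≡⟨ *-^ (2 ^ slackExp) (2 ^ L) (1 + k₀) ⟩
      (2 ^ slackExp) ^ (1 + k₀) * (2 ^ L) ^ (1 + k₀) ≤⟨ *-mono-≤ (^-monoʳ-≤ (2 ^ slackExp) {{m^n≢0 2 slackExp}} (m≤n+m (1 + k₀) 2)) (^-monoˡ-≤ (1 + k₀) (2^log≤n n (<⇒≤ 2≤n))) ⟩
      (2 ^ slackExp) ^ k * n ^ (1 + k₀) ∎
      where
      e : ∀ k₀ M k → 3 * (1 + k₀) * M * k ≡ 3 * k * M * (1 + k₀)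
      e = solve-∀

-- The guarantee

freq≡cnt : ∀ {n m} (D : Stream n m) i → freq D i ≡ cnt i (Vec.toList D)
freq≡cnt []      i = refl
freq≡cnt (p ∷ D) i with does (p Fin.≟ i)
... | true  = cong suc (freq≡cnt D i)
... | false = freq≡cnt D i

restMoment≡rest : ∀ {n m} k (D : Stream n m) i → restMoment k D i ≡ rest k (Vec.toList D) i
restMoment≡rest k D i = ∑-cong (others i) (λ j → cong (_^ k) (freq≡cnt D j))

^-loss : ∀ y b t → (y + b) ^ suc t ≤ y ^ suc t + suc t * b * (y + b) ^ t
^-loss y b zero    = ≤-reflexive (e y b)
  where
  e : ∀ y b → (y + b) * 1 ≡ y * 1 + (b + 0) * 1
  e = solve-∀
^-loss y b (suc t) = begin
  (y + b) * (y + b) ^ suc t ≡⟨ *-distribʳ-+ ((y + b) ^ suc t) y b ⟩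
  y * (y + b) ^ suc t + b * (y + b) ^ suc t ≤⟨ +-monoˡ-≤ (b * (y + b) ^ suc t) (*-monoʳ-≤ y (^-loss y b t)) ⟩
  y * (y ^ suc t + suc t * b * (y + b) ^ t) + b * (y + b) ^ suc t
    ≤⟨ m≤m+n _ (suc t * b * b * (y + b) ^ t) ⟩
  y * (y ^ suc t + suc t * b * (y + b) ^ t) + b * (y + b) ^ suc t + suc t * b * b * (y + b) ^ t
    ≡⟨ e y b t (y ^ suc t) ((y + b) ^ t) ⟩
  y ^ suc (suc t) + suc (suc t) * b * (y + b) ^ suc t ∎
  where
  open ≤-Reasoning
  e : ∀ y b t z x → y * (z + suc t * b * x) + b * ((y + b) * x) + suc t * b * b * x ≡ y * z + suc (suc t) * b * ((y + b) * x)
  e = solve-∀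

-- The loss of first order, `suc t * b * f ^ t`, is at most half of `f ^ suc t`.
half-power : ∀ f x b t → f ≤ x + b → 2 * suc t * b ≤ f → f ^ suc t ≤ 2 * x ^ suc t
half-power f x b t f≤ small with m≤n⇒∃[o]m+o≡n b≤f
  where
  b≤f : b ≤ f
  b≤f = ≤-trans (m≤n*m b (2 * suc t)) small
... | y , refl = +-cancelʳ-≤ ((b + y) ^ suc t) _ _ (begin
  (b + y) ^ suc t + (b + y) ^ suc t ≡⟨ cong (λ z → z ^ suc t + z ^ suc t) (+-comm b y) ⟩
  (y + b) ^ suc t + (y + b) ^ suc t ≡⟨ cong ((y + b) ^ suc t +_) (sym (+-identityʳ _)) ⟩
  2 * (y + b) ^ suc t ≤⟨ *-monoʳ-≤ 2 (^-loss y b t) ⟩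
  2 * (y ^ suc t + suc t * b * (y + b) ^ t) ≡⟨ e (y ^ suc t) t b ((y + b) ^ t) ⟩
  2 * y ^ suc t + 2 * suc t * b * (y + b) ^ t ≤⟨ +-mono-≤ (*-monoʳ-≤ 2 (^-monoˡ-≤ (suc t) y≤x)) (*-monoˡ-≤ ((y + b) ^ t) small) ⟩
  2 * x ^ suc t + (b + y) * (y + b) ^ t ≡⟨ cong (λ z → 2 * x ^ suc t + (b + y) * z ^ t) (+-comm y b) ⟩
  2 * x ^ suc t + (b + y) ^ suc t ∎)
  where
  open ≤-Reasoning
  y≤x : y ≤ x
  y≤x = +-cancelˡ-≤ b _ _ (≤≡-trans f≤ (+-comm x b))
  e : ∀ z t b x → 2 * (z + suc t * b * x) ≡ 2 * z + 2 * suc t * b * x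
  e = solve-∀

-- Rational numbers

fromNat : ℕ → ℚ
fromNat c = ℤ.+ c ℚ./ 1

toℚᵘ-fromNat : ∀ c → ℚ.toℚᵘ (fromNat c) ℚᵘ.≃ mkℚᵘ (ℤ.+ c) 0
toℚᵘ-fromNat c = ℚ.toℚᵘ-fromℚᵘ (mkℚᵘ (ℤ.+ c) 0)

fromNat-mono : ∀ {c d} → c ≤ d → fromNat c ℚ.≤ fromNat d
fromNat-mono {c} {d} le = ℚ.toℚᵘ-cancel-≤ (ℚᵘ.≤-respˡ-≃ (ℚᵘ.≃-sym (toℚᵘ-fromNat c))
  (ℚᵘ.≤-respʳ-≃ (ℚᵘ.≃-sym (toℚᵘ-fromNat d)) (ℚᵘ.*≤* (ℤ.*-monoʳ-≤-nonNeg (ℤ.+ 1) (ℤ.+≤+ le)))))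

fromNat-+ : ∀ c d → fromNat (c + d) ≡ fromNat c ℚ.+ fromNat d
fromNat-+ c d = ℚ.toℚᵘ-injective (ℚᵘ.≃-trans (toℚᵘ-fromNat (c + d)) (ℚᵘ.≃-trans
  (ℚᵘ.*≡* (cong (ℤ._* ℤ.+ 1) (trans (ℤ.pos-+ c d) (sym (cong₂ ℤ._+_ (ℤ.*-identityʳ (ℤ.+ c)) (ℤ.*-identityʳ (ℤ.+ d)))))))
  (ℚᵘ.≃-sym (ℚᵘ.≃-trans (ℚ.toℚᵘ-homo-+ (fromNat c) (fromNat d)) (ℚᵘ.+-cong (toℚᵘ-fromNat c) (toℚᵘ-fromNat d))))))

denominator : ℚ → ℕ
denominator ε = suc (ℚ.ℚ.denominator-1 ε)

-- A positive rational is at least the reciprocal of its denominator.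
fromNat-≤-* : ∀ ε b f → 0ℚ ℚ.< ε → b * denominator ε ≤ f → fromNat b ℚ.≤ ε ℚ.* fromNat f
fromNat-≤-* ε@(ℚ.mkℚ (ℤ.+ zero) d _)   b f (ℚ.*<* (ℤ.+<+ ()))
fromNat-≤-* ε@(ℚ.mkℚ ℤ.-[1+ a ] d _)   b f (ℚ.*<* ())
fromNat-≤-* ε@(ℚ.mkℚ (ℤ.+ (suc a)) d _) b f _ le = ℚ.toℚᵘ-cancel-≤ (ℚᵘ.≤-respˡ-≃ (ℚᵘ.≃-sym (toℚᵘ-fromNat b))
  (ℚᵘ.≤-respʳ-≃ (ℚᵘ.≃-sym (ℚᵘ.≃-trans (ℚ.toℚᵘ-homo-* ε (fromNat f)) (ℚᵘ.*-congˡ {mkℚᵘ (ℤ.+ suc a) d} (toℚᵘ-fromNat f)))) (ℚᵘ.*≤* int)))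
  where
  open ℤ.≤-Reasoning
  int : ℤ.+ b ℤ.* ℤ.+ (suc (d * 1)) ℤ.≤ (ℤ.+ suc a ℤ.* ℤ.+ f) ℤ.* ℤ.+ 1
  int = begin
    ℤ.+ b ℤ.* ℤ.+ (suc (d * 1)) ≡⟨ sym (ℤ.pos-* b (suc (d * 1))) ⟩
    ℤ.+ (b * suc (d * 1)) ≤⟨ ℤ.+≤+ (≡≤-trans (cong (λ z → b * suc z) (*-identityʳ d)) (≤-trans le (m≤n*m f (suc a)))) ⟩
    ℤ.+ (suc a * f) ≡⟨ ℤ.pos-* (suc a) f ⟩
    ℤ.+ suc a ℤ.* ℤ.+ f ≡⟨ sym (ℤ.*-identityʳ _) ⟩
    (ℤ.+ suc a ℤ.* ℤ.+ f) ℤ.* ℤ.+ 1 ∎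

scaled-≤ : ∀ ε f x b → 0ℚ ℚ.< ε → f ≤ x + b → b * denominator ε ≤ f → (1ℚ ℚ.- ε) ℚ.* fromNat f ℚ.≤ fromNat x
scaled-≤ ε f x b ε>0 f≤ b≤ = begin
  (1ℚ ℚ.- ε) ℚ.* F ≡⟨ ℚ.*-distribʳ-+ F 1ℚ (ℚ.- ε) ⟩
  1ℚ ℚ.* F ℚ.+ ℚ.- ε ℚ.* F ≡⟨ cong₂ ℚ._+_ (ℚ.*-identityˡ F) (sym (ℚ.neg-distribˡ-* ε F)) ⟩
  F ℚ.- ε ℚ.* F ≤⟨ ℚ.+-monoˡ-≤ (ℚ.- (ε ℚ.* F)) F≤ ⟩
  (X ℚ.+ ε ℚ.* F) ℚ.- ε ℚ.* F ≡⟨ ℚ.+-assoc X (ε ℚ.* F) (ℚ.- (ε ℚ.* F)) ⟩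
  X ℚ.+ (ε ℚ.* F ℚ.- ε ℚ.* F) ≡⟨ cong (X ℚ.+_) (ℚ.+-inverseʳ (ε ℚ.* F)) ⟩
  X ℚ.+ 0ℚ ≡⟨ ℚ.+-identityʳ X ⟩
  X ∎
  where
  open ℚ.≤-Reasoning
  F X : ℚ
  F = fromNat f
  X = fromNat x
  F≤ : F ℚ.≤ X ℚ.+ ε ℚ.* F
  F≤ = begin
    F ≤⟨ fromNat-mono f≤ ⟩
    fromNat (x + b) ≡⟨ fromNat-+ x b ⟩
    X ℚ.+ fromNat b ≤⟨ ℚ.+-monoʳ-≤ X (fromNat-≤-* ε b f ε>0 b≤) ⟩
    X ℚ.+ ε ℚ.* F ∎

ratio-one : ∀ a N .{{_ : NonZero N}} → a ≡ N → ℤ.+ a ℚ./ N ≡ 1ℚ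
ratio-one a (suc N) refl = ℚ.fromℚᵘ-cong {mkℚᵘ (ℤ.+ suc N) N} {mkℚᵘ (ℤ.+ 1) 0}
  (ℚᵘ.*≡* (trans (ℤ.*-identityʳ (ℤ.+ suc N)) (sym (ℤ.*-identityˡ (ℤ.+ suc N)))))

ratio-half : ∀ a N .{{_ : NonZero N}} → N ≤ 2 * a → ℚ.½ ℚ.≤ ℤ.+ a ℚ./ N
ratio-half a (suc N) le = ℚ.toℚᵘ-cancel-≤ (ℚᵘ.≤-respʳ-≃ (ℚᵘ.≃-sym (ℚ.toℚᵘ-fromℚᵘ (mkℚᵘ (ℤ.+ a) N))) (ℚᵘ.*≤* int))
  where
  open ℤ.≤-Reasoning
  int : ℤ.+ 1 ℤ.* ℤ.+ suc N ℤ.≤ ℤ.+ a ℤ.* ℤ.+ 2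
  int = begin
    ℤ.+ 1 ℤ.* ℤ.+ suc N ≡⟨ ℤ.*-identityˡ (ℤ.+ suc N) ⟩
    ℤ.+ suc N ≤⟨ ℤ.+≤+ (≤≡-trans le (*-comm 2 a)) ⟩
    ℤ.+ (a * 2) ≡⟨ ℤ.pos-* a 2 ⟩
    ℤ.+ a ℤ.* ℤ.+ 2 ∎

module Probability (k₀ c₁ : ℕ) {n : ℕ} (i₀ : Fin n) (A : ℕ) (qs : List (ℕ × ℕ × ℕ)) (n≤ : n ≤ 2 ^ A)
                   {m : ℕ} (m≤ : m ≤ 2 ^ A)
                   (legal : ∀ t → t < m → Schedule.κ k₀ c₁ * proj₁ (Schedule.clock k₀ c₁ t) ≤ A)
                   (D : Stream n m) where
  open Schedule k₀ c₁
  open Chance i₀ A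
  open Bank k₀ c₁ i₀ A
  open Algorithm k₀ c₁ i₀ A qs
  open StreamingAlgorithm algorithm using (run)
  open Counting D (run D) (run-answer n≤ m m≤ legal D)

  private
    count : {P : Pred (Output n) 0ℓ} → Decidable P → ℕ
    count P? = length (filter (λ ω → P? (run D ω)) (tapes (length qs * A) (2 + m)))

    total : ℕ
    total = (2 ^ (length qs * A)) ^ (2 + m)

  Pr-always : {P : Pred (Output n) 0ℓ} (P? : Decidable P) → (∀ cs → P (present (answer cs D))) →
              PrOutput algorithm D P? ≡ 1ℚ
  Pr-always P? holds = ratio-one (count P?) total {{m^n≢0 (2 ^ (length qs * A)) (2 + m) {{m^n≢0 2 (length qs * A)}}}} (always P? holds)

  Pr-often : {P : Pred (Output n) 0ℓ} (P? : Decidable P) (φ : Slot n → ℕ) →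
             (∀ cs → prod φ qs (runAll 0 qs cs D (initial qs)) ≡ 0 → P (present (answer cs D))) →
             2 * ∏ qs (λ q → W (sched q ∘ clock) 0 (Vec.toList D) φ (empty i₀)) ≤ (β ^ m) ^ length qs →
             ℚ.½ ℚ.≤ PrOutput algorithm D P?
  Pr-often P? φ holds rare =
    ratio-half (count P?) total {{m^n≢0 (2 ^ (length qs * A)) (2 + m) {{m^n≢0 2 (length qs * A)}}}} (often P? φ holds rare)

-- At most a fraction `1 / E` of the frequency is missed. The denominator keeps this below ε, and
-- the factor `2 * k` makes the count large enough to identify i.
precision : ℕ → ℚ → ℕ
precision k₀ ε = 2 * (3 + k₀) * denominator ε

spaceConstant : ℕ → ℚ → ℕ → ℕ
spaceConstant k₀ ε c = Space.constant k₀ (precision k₀ ε) c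

module Guarantee (k₀ c : ℕ) (ε : ℚ) (ε>0 : 0ℚ ℚ.< ε) {n : ℕ} (2≤n : 2 ≤ n) where
  k d E L : ℕ
  k = 3 + k₀
  d = ℚ.ℚ.denominator-1 ε
  E = precision k₀ ε
  L = ⌊log₂ n ⌋

  open Space k₀ E c using (c₁; bank; width; copies; maxType)

  A : ℕ
  A = width L

  i₀ : Fin n
  i₀ = fromℕ< {0} (≤-trans (s≤s z≤n) 2≤n)

  open Schedule k₀ c₁
  open Chance i₀ A
  open Bank k₀ c₁ i₀ A
  open Algorithm k₀ c₁ i₀ A (bank L) public

  n≤2^A : n ≤ 2 ^ A
  n≤2^A = ≤-trans (<⇒≤ (n<2^[1+log] n)) (2^-mono (m≤n+m (suc L) (c + suc L * c + κ)))

  module _ {m : ℕ} (m≤ : m ≤ c * n ^ c) where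

    m≤2^ : m ≤ 2 ^ (c + suc L * c)
    m≤2^ = begin
      m ≤⟨ m≤ ⟩
      c * n ^ c ≤⟨ *-mono-≤ (<⇒≤ (n<2^n c)) (^-monoˡ-≤ c (<⇒≤ (n<2^[1+log] n))) ⟩
      2 ^ c * (2 ^ suc L) ^ c ≡⟨ cong (2 ^ c *_) (^-*-assoc 2 (suc L) c) ⟩
      2 ^ c * 2 ^ (suc L * c) ≡⟨ sym (^-distribˡ-+-* 2 c (suc L * c)) ⟩
      2 ^ (c + suc L * c) ∎
      where open ≤-Reasoning

    m≤2^A : m ≤ 2 ^ A
    m≤2^A = ≤-trans m≤2^ (2^-mono (≤-trans (m≤m+n (c + suc L * c) κ) (m≤m+n (c + suc L * c + κ) (suc L))))

    -- Phase `suc e` begins only after `Q ^ e` elements, so `κ * e` is at most the logarithm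
    -- bounding the stream length; the summand `κ` of the width pays for the step to `suc e`.
    positions-fit : ∀ e → phaseStart e < m → κ * e ≤ A
    positions-fit zero    _  = ≡≤-trans (*-zeroʳ κ) z≤n
    positions-fit (suc e) lt = begin
      κ * suc e ≡⟨ *-suc κ e ⟩
      κ + κ * e ≤⟨ +-monoʳ-≤ κ (<⇒≤ (2^-cancel-< {κ * e} {c + suc L * c} (≤-trans (≤-<-trans (m≤m+n (phaseLength e) (phaseStart e)) lt) m≤2^))) ⟩
      κ + (c + suc L * c) ≡⟨ +-comm κ (c + suc L * c) ⟩
      c + suc L * c + κ ≤⟨ m≤m+n _ (suc L) ⟩
      A ∎
      where open ≤-Reasoning

    clock-fits : ∀ t → t < m → κ * proj₁ (clock t) ≤ A
    clock-fits t lt = positions-fit (proj₁ (clock t))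
      (≤-<-trans (≤≡-trans (m≤n+m _ (proj₂ (clock t))) (sym (proj₁ (clock-invariant t)))) lt)

    module _ (D : Stream n m) where
      private
        xs : List (Fin n)
        xs = Vec.toList D

      open Probability k₀ c₁ i₀ A (bank L) n≤2^A m≤2^A clock-fits D

      never-over : ∀ cs → NoOverestimate D (present (answer cs D))
      never-over cs = fromNat-mono (≤≡-trans (answer-counted D cs) (sym (freq≡cnt D (proj₁ (answer cs D)))))

      no-overestimate : PrOutput algorithm D (noOverestimate? D) ≡ 1ℚ
      no-overestimate = Pr-always (noOverestimate? D) never-over

      module _ (i : Fin n) (heavy : Heavy k D i) where
        private
          f : ℕ
          f = cnt i xs

          heavy′ : 100 * rest k xs i < f ^ k
          heavy′ = subst₂ (λ x y → 100 * x < y ^ k) (restMoment≡rest k D i) (freq≡cnt D i) heavy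

          f≥1 : 1 ≤ f
          f≥1 = n≢0⇒n>0 λ f≡0 → n≮0 (subst (λ x → 100 * rest k xs i < x ^ k) f≡0 heavy′)

          rest≤ : rest k xs i ≤ f ^ k
          rest≤ = ≤-trans (m≤n*m (rest k xs i) 100) (<⇒≤ heavy′)

          r : ℕ
          r = L / (3 * k) + 1

          n≤R : n ≤ (2 ^ (3 * r)) ^ k
          n≤R = begin
            n ≤⟨ <⇒≤ (n<2^[1+log] n) ⟩
            2 ^ suc L ≤⟨ 2^-mono log≤ ⟩
            2 ^ (3 * r * k) ≡⟨ sym (^-*-assoc 2 (3 * r) k) ⟩
            (2 ^ (3 * r)) ^ k ∎
            where
            open ≤-Reasoning
            e : ∀ x k → 3 * k + x * (3 * k) ≡ 3 * (x + 1) * k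
            e = solve-∀
            log≤ : suc L ≤ 3 * r * k
            log≤ = begin
              suc L ≡⟨ cong suc (m≡m%n+[m/n]*n L (3 * k)) ⟩
              suc (L % (3 * k)) + L / (3 * k) * (3 * k) ≤⟨ +-monoˡ-≤ (L / (3 * k) * (3 * k)) (m%n<n L (3 * k)) ⟩
              3 * k + L / (3 * k) * (3 * k) ≡⟨ e (L / (3 * k)) k ⟩
              3 * r * k ∎

        heavy-found : Choice.HeavySlot k₀ E i₀ A xs i r → ℚ.½ ℚ.≤ PrOutput algorithm D (finds? ε D i)
        heavy-found (ρ , l , j , b , l≤ρ , j≤l , ρ≤ , bE<f , wins) =
          Pr-often (finds? ε D i) φ correct rare
          where
          φ : Slot n → ℕ
          φ = misses? i f b
          ψ : Slot n → ℕ
          ψ s = ⟦ found? i f b s ⟧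
          m≡ : length xs ≡ m
          m≡ = Vec.length-toList D
          w : Type → ℕ
          w q = W (sched q ∘ clock) 0 xs φ (empty i₀)
          either : ∀ x → ⟦ not x ⟧ + ⟦ x ⟧ ≡ 1
          either true  = refl
          either false = refl
          w+ : ∀ q → w q + W (sched q ∘ clock) 0 xs ψ (empty i₀) ≡ β ^ length xs
          w+ q = trans (W-+ (sched q ∘ clock) 0 xs φ ψ (empty i₀)) (W-one (sched q ∘ clock) 0 xs (empty i₀) (λ s → either (found? i f b s)))
          w≤ : ∀ q → w q ≤ β ^ length xs
          w≤ q = ≤≡-trans (m≤m+n (w q) _) (w+ q)
          q : Type
          q = ρ , l , j
          gain : copies q * w q + β ^ length xs ≤ copies q * β ^ length xs
          gain = begin
            copies q * w q + β ^ length xs ≤⟨ +-monoʳ-≤ (copies q * w q) (wins (empty i₀)) ⟩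
            copies q * w q + copies q * W (sched q ∘ clock) 0 xs ψ (empty i₀)
              ≡⟨ sym (*-distribˡ-+ (copies q) (w q) _) ⟩
            copies q * (w q + W (sched q ∘ clock) 0 xs ψ (empty i₀)) ≡⟨ cong (copies q *_) (w+ q) ⟩
            copies q * β ^ length xs ∎
            where open ≤-Reasoning
          rare : 2 * ∏ (bank L) w ≤ (β ^ m) ^ length (bank L)
          rare = subst (λ z → 2 * ∏ (bank L) w ≤ (β ^ z) ^ length (bank L)) m≡
            (∏-copied copies (types (maxType L)) w (β ^ length xs) w≤ (∈-types ρ≤ l≤ρ j≤l) (m^n>0 2 (copiesExp ρ l)) gain)
          correct : ∀ cs → prod φ (bank L) (runAll 0 (bank L) cs D (initial (bank L))) ≡ 0 → Finds ε D i (present (answer cs D))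
          correct cs none = same , scaled
            where
            y : Fin n
            y = proj₁ (answer cs D)
            x : ℕ
            x = proj₂ (answer cs D)
            f≤ : f ≤ x + b
            f≤ = found-best i f b (bank L) _ none
            x≤ : x ≤ cnt y xs
            x≤ = answer-counted D cs
            2kb≤f : 2 * k * b ≤ f
            2kb≤f = ≤-trans (≤≡-trans (m≤m*n (2 * k * b) (suc d)) (swap (2 * k) b (suc d))) (<⇒≤ bE<f)
              where
              swap : ∀ x b d → x * b * d ≡ b * (x * d)
              swap = solve-∀
            -- A count of at least `f - b` has a k-th power of at least half of `f ^ k`, more than
            -- the entire moment of the other elements.
            same : y ≡ i
            same with y Fin.≟ i
            ... | yes eq = eq
            ... | no  ne = contradiction heavy′ (≤⇒≯ (begin
              f ^ k ≤⟨ half-power f x b (2 + k₀) f≤ 2kb≤f ⟩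
              2 * x ^ k ≤⟨ *-monoʳ-≤ 2 (≤-trans (^-monoˡ-≤ k x≤) (∑-∈ (λ z → cnt z xs ^ k) (∈-filter⁺ (λ z → ¬? (z Fin.≟ i)) (∈-allFin y) ne))) ⟩
              2 * rest k xs i ≤⟨ *-monoˡ-≤ (rest k xs i) {2} {100} (s≤s (s≤s z≤n)) ⟩
              100 * rest k xs i ∎))
              where open ≤-Reasoning
            scaled : (1ℚ ℚ.- ε) ℚ.* freqℚ D i ℚ.≤ fromNat x
            scaled = subst (λ g → (1ℚ ℚ.- ε) ℚ.* fromNat g ℚ.≤ fromNat x) (sym (freq≡cnt D i))
              (scaled-≤ ε f x b ε>0 f≤
                (≤-trans (*-monoʳ-≤ b (m≤n*m (suc d) (2 * k))) (<⇒≤ bE<f)))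

        finds-heavy : ℚ.½ ℚ.≤ PrOutput algorithm D (finds? ε D i)
        finds-heavy = heavy-found (Choice.heavy-slot k₀ E i₀ A xs i r (s≤s z≤n) f≥1 rest≤ n≤R
          (λ e lt → positions-fit e (≤≡-trans lt (Vec.length-toList D))))

  guarantee : Σ[ A ∈ StreamingAlgorithm n ]
    (SpaceBound k (spaceConstant k₀ ε c) n (StreamingAlgorithm.memory A) ×
     ((m : ℕ) (D : Stream n m) → PolynomiallyRelated c n m →
       (PrOutput A D (noOverestimate? D) ≡ 1ℚ) ×
       ((i : Fin n) → Heavy k D i → ℚ.½ ℚ.≤ PrOutput A D (finds? ε D i))))
  guarantee = algorithm , Space.space k₀ E c n 2≤n , λ m D (m≤ , _) → no-overestimate m≤ D , finds-heavy m≤ D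

theorem3p7 : (k : ℕ) → 3 ≤ k →
    (ε : ℚ) → 0ℚ ℚ.< ε → ε ℚ.< 1ℚ →
    (c : ℕ) →
    Σ[ C ∈ ℕ ] Σ[ δ ∈ ℚ ] (0ℚ ℚ.< δ ×
    ((n : ℕ) → 2 ≤ n →
    Σ[ A ∈ StreamingAlgorithm n ]
    (SpaceBound k C n (StreamingAlgorithm.memory A) ×
    ((m : ℕ) (D : Stream n m) → PolynomiallyRelated c n m →
    (PrOutput A D (noOverestimate? D) ≡ 1ℚ) ×
    ((i : Fin n) → Heavy k D i → δ ℚ.≤ PrOutput A D (finds? ε D i))))))
theorem3p7 (suc (suc (suc k₀))) (s≤s (s≤s (s≤s z≤n))) ε ε>0 _ c =
  spaceConstant k₀ ε c , ℚ.½ , ℚ.*<* (ℤ.+<+ (s≤s z≤n)) , λ n 2≤n → Guarantee.guarantee k₀ c ε ε>0 2≤n
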